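{- Let $n=4m_2$ with $m_2$ odd, $m_1=2m_2$, $m_0=n$. Let $a\in\mathbb{F}_{2^{m_1}}^*$, $b\in\mathbb{F}_4^*$, $\omega\in\mathbb{F}_{2^{m_1}}^*$; write $\omega=w_2y$ with $w_2\in U_2$, $y\in\mathbb{F}_{2^{m_2}}^*$, and let $\gamma=b\,\psi_{m_1}(w_2)$ and $\alpha=\psi_{m_1}(a)$. Define \[ S_2(a,b,\omega)=\sum_{\substack{u=u_1u_2,\ u_1\in U_1,u_2\in U_2:\\ \mathrm{Tr}^{m_0}_{m_1}(u\omega)\ne0,\ \mathrm{Tr}^{m_0}_{m_2}(u\omega)=0,\ b\,\psi_{m_0}(u_2)=1}}\chi\bigl(\mathrm{Tr}_{m_0}(a u_1^{2^{m_1}-1})\bigr). \] Then \[ S_2(a,b,\omega)=\begin{cases} \frac13\bigl(2^{m_2+1}-2C_{m_1}(a,a)-K_{m_1}(a)\bigr)&\text{if }\gamma=\alpha\text{ and }\gamma=\alpha^{ -1},\\ \frac13\bigl(-2^{m_2}-2C_{m_1}(a,a)-K_{m_1}(a)\bigr)&\text{if }\gamma=\alpha\text{ and }\gamma\ne\alpha^{ -1},\\ \frac13\bigl(2^{m_2+1}+C_{m_1}(a,a)-K_{m_1}(a)\bigr)&\text{if }\gamma\ne\alpha\text{ and }\gamma=\alpha^{ -1},\\ \frac13\bigl(-2^{m_2}+C_{m_1}(a,a)-K_{m_1}(a)\bigr)&\text{if }\gamma\ne\alpha\text{ and }\gamma\ne\alpha^{ -1}. \end{cases} \]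
   Context: For $k\mid l$, $\mathrm{Tr}_k^l$ is the relative trace $\mathbb{F}_{2^l}\to\mathbb{F}_{2^k}$, $x\mapsto\sum_{j=0}^{l/k-1}x^{2^{kj}}$, and $\mathrm{Tr}_l=\mathrm{Tr}_1^l$. $\chi(x)=(-1)^x$ for $x\in\mathbb{F}_2$. $U_1\subset\mathbb{F}_{2^{m_0}}^*$ is the group of $(2^{m_1}+1)$-th roots of unity and $U_2\subset\mathbb{F}_{2^{m_1}}^*$ the group of $(2^{m_2}+1)$-th roots of unity. For $i\in\{0,1\}$, $\psi_{m_i}(x)=x^{(2^{m_i}-1)/3}\in\mathbb{F}_4$. Kloosterman sum: $K_{m_1}(a)=\sum_{x\in\mathbb{F}_{2^{m_1}}}\chi(\mathrm{Tr}_{m_1}(ax+x^{ -1}))$ with $0^{ -1}=0$. Cubic sum: $C_{m_1}(a,b)=\sum_{x\in\mathbb{F}_{2^{m_1}}}\chi(\mathrm{Tr}_{m_1}(ax^3+bx))$. -}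

module Defs where

open import Data.Nat as ℕ using (ℕ; zero; suc; _∸_; _^_)
open import Data.Integer as ℤ using (ℤ)
open import Data.Bool using (Bool; true; false; if_then_else_; _∧_; not)
open import Data.List using (List; []; _∷_; length)
open import Data.List.Membership.Propositional using (_∈_)
open import Data.List.Relation.Unary.Unique.Propositional using (Unique)
open import Relation.Binary.PropositionalEquality using (_≡_; _≢_)
open import Relation.Binary.Definitions using (DecidableEquality)
open import Relation.Nullary.Decidable using (⌊_⌋)
open import Algebra.Structures using (IsCommutativeRing)
open import Function using (id)

-- A finite field of order 2^n (characteristic 2), with propositional
-- equality.  Negation is the identity (characteristic 2), the inverse is
-- total with the convention 0⁻¹ = 0.  Any such structure is (isomorphic to)
-- F_{2^n}.
record FiniteField2 (n : ℕ) : Set₁ where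
  infixl 6 _+_
  infixl 7 _*_
  field
    Carrier   : Set
    _≟_       : DecidableEquality Carrier
    _+_ _*_   : Carrier → Carrier → Carrier
    0# 1#     : Carrier
    isCommRing : IsCommutativeRing _≡_ _+_ _*_ id 0# 1#
    0≢1       : 0# ≢ 1#
    _⁻¹       : Carrier → Carrier
    inv-zero  : 0# ⁻¹ ≡ 0#
    inverseʳ  : ∀ x → x ≢ 0# → x * (x ⁻¹) ≡ 1#
    elements  : List Carrier
    elements-unique   : Unique elements
    elements-complete : ∀ x → x ∈ elements
    elements-card     : length elements ≡ 2 ^ n

module FieldOps {n : ℕ} (F : FiniteField2 n) where
  open FiniteField2 F

  pow : Carrier → ℕ → Carrier
  pow x zero    = 1#
  pow x (suc k) = x * pow x k

  -- relative trace Tr_k^l with d = l / k : x ↦ Σ_{j<d} x^{2^{k j}}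
  trRel : (k d : ℕ) → Carrier → Carrier
  trRel k zero    x = 0#
  trRel k (suc j) x = trRel k j x + pow x (2 ^ (k ℕ.* j))

  tr : ℕ → Carrier → Carrier
  tr l = trRel 1 l

  -- χ(t) = (-1)^t for t ∈ F_2 ⊆ F (t = 0 ↦ 1, t = 1 ↦ -1)
  χ : Carrier → ℤ
  χ t = if ⌊ t ≟ 0# ⌋ then ℤ.+ 1 else ℤ.- ℤ.+ 1

  ψ : ℕ → Carrier → Carrier
  ψ m x = pow x ((2 ^ m ∸ 1) ℕ./ 3)

  isZero : Carrier → Bool
  isZero x = ⌊ x ≟ 0# ⌋

  eqB : Carrier → Carrier → Bool
  eqB x y = ⌊ x ≟ y ⌋

  -- x ∈ F_{2^k}
  inSub : ℕ → Carrier → Bool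
  inSub k x = eqB (pow x (2 ^ k)) x

  inRootsOfUnity : ℕ → Carrier → Bool
  inRootsOfUnity k x = eqB (pow x (2 ^ k ℕ.+ 1)) 1#

  sumList : List Carrier → (Carrier → Bool) → (Carrier → ℤ) → ℤ
  sumList []       P f = ℤ.+ 0
  sumList (x ∷ xs) P f = (if P x then f x else ℤ.+ 0) ℤ.+ sumList xs P f

  sumWhere : (Carrier → Bool) → (Carrier → ℤ) → ℤ
  sumWhere = sumList elements

  K : ℕ → Carrier → ℤ
  K m a = sumWhere (inSub m) (λ x → χ (tr m (a * x + x ⁻¹)))

  C : ℕ → Carrier → Carrier → ℤ
  C m a b = sumWhere (inSub m) (λ x → χ (tr m (a * pow x 3 + b * x)))

  -- S_2(a,b,ω) with m₂, m₁ = 2m₂, m₀ = 4m₂: summed over pairs (u₁,u₂),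
  -- u₁ ∈ U₁ ((2^{m₁}+1)-th roots of unity in F_{2^{m₀}}), u₂ ∈ U₂
  -- ((2^{m₂}+1)-th roots of unity in F_{2^{m₁}}), u = u₁u₂.
  S₂ : (m₂ : ℕ) → Carrier → Carrier → Carrier → ℤ
  S₂ m₂ a b ω =
    sumWhere (λ u₁ → inRootsOfUnity m₁ u₁) (λ u₁ →
      sumWhere (λ u₂ → inSub m₁ u₂ ∧ inRootsOfUnity m₂ u₂) (λ u₂ →
        let u = u₁ * u₂ in
        if not (isZero (trRel m₁ 2 (u * ω)))
           ∧ isZero (trRel m₂ 4 (u * ω))
           ∧ eqB (b * ψ m₀ u₂) 1#
        then χ (tr m₀ (a * pow u₁ (2 ^ m₁ ∸ 1)))
        else ℤ.+ 0))
    where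
      m₁ m₀ : ℕ
      m₁ = 2 ℕ.* m₂
      m₀ = 4 ℕ.* m₂

{-# OPTIONS --safe #-}

-- Write q = 2^m₂, Q = q², G = 𝔽_Q, e = χ ∘ Tr_{m₁} and κ = ψ_{m₁}.  For u₁ ≠ 1
-- in U₁ put t = u₁ + u₁⁻¹ ∈ G*.  The trace conditions say (u₂w₂)² = t^{q-1}, so
-- u₂ is determined by u₁, and the condition on ψ(u₂) becomes κ(t²) = γ.  Each
-- s ∈ G* is of the form u₁ + u₁⁻¹ for 1 - e(s⁻¹) elements u₁ of U₁, hence
--   S₂ = A - B,  A = Σ_{κ(v) = γ} e(av),  B = Σ_{κ(v) = γ} e(av + v⁻¹).
-- A is computed by averaging over 𝔽_q^*, on which κ is trivial.  The
-- substitution v ↦ (av)⁻¹ shows that B takes the same value on the two classes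
-- γ ≠ α, and the three classes add up to K(a) - 1.  For γ = α and a = c², B is
-- the sum of e(c(z + z⁻¹)) over the cubes z.  As x³ + x⁻³ = s³ + s for
-- s = x + x⁻¹, it is evaluated by comparing G*, where cubing is 3-to-1 onto the
-- cubes and s has 1 + e(s⁻¹) preimages, with U₁, where cubing is a bijection
-- and s has 1 - e(s⁻¹) preimages.
module Submission where

open import Defs
open import Algebra.Bundles using (CommutativeRing)
import Algebra.Properties.AbelianGroup as AbelianGroup
import Algebra.Solver.Ring as RingSolver
open import Algebra.Solver.Ring.AlmostCommutativeRing using (fromCommutativeRing; _-Raw-AlmostCommutative⟶_)
open import Data.Bool using (Bool; true; false; if_then_else_; _∧_; not)
import Data.Bool.Properties as Bool
open import Data.Integer as ℤ using (ℤ; 0ℤ; 1ℤ; -1ℤ)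
import Data.Integer.Properties as ℤ
open import Data.Integer.Tactic.RingSolver using (solve-∀)
open import Data.List using (List; []; _∷_; length; map; replicate)
open import Data.List.Membership.Propositional using (_∈_)
open import Data.List.Membership.Propositional.Properties using (∈-map⁺)
open import Data.List.Membership.Propositional.Properties.WithK using (unique∧set⇒bag)
open import Data.List.Properties using (length-replicate)
open import Data.List.Relation.Binary.BagAndSetEquality using (∼bag⇒↭)
open import Data.List.Relation.Binary.Permutation.Propositional as ↭ using (_↭_)
open import Data.List.Relation.Unary.All as All using (All)
open import Data.List.Relation.Unary.AllPairs using (_∷_)
open import Data.List.Relation.Unary.Any using (here; there)
open import Data.List.Relation.Unary.Unique.Propositional using (Unique)
open import Data.List.Relation.Unary.Unique.Propositional.Properties using (map⁺)
open import Data.Maybe using (Maybe; just; nothing)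
open import Data.Nat as ℕ using (ℕ; zero; suc; _^_; _∸_; _%_)
import Data.Nat.DivMod as ℕ
import Data.Nat.Properties as ℕ
import Data.Nat.Tactic.RingSolver as ℕ-Solver
open import Data.Product using (_×_; _,_; proj₁; proj₂; ∃-syntax)
open import Data.Sum using (_⊎_; inj₁; inj₂)
open import Function using (_∘_; mk⇔)
open import Level using (0ℓ)
open import Relation.Binary.PropositionalEquality hiding (J)
open import Relation.Nullary using (yes; no; contradiction)
open ≡-Reasoning
open AbelianGroup ℤ.+-0-abelianGroup using () renaming (∙-cancelˡ to ℤ+-cancelˡ)


-- Oddness of m₂ enters as q = 3j + 2. Then 3 divides q + 1, so r = (Q - 1)/3 is a multiple of q - 1
-- and κ is trivial on 𝔽_q^*; a cube root of unity z satisfies z^q = z²; and Q + 1 ≡ 2 mod 3 makes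
-- cubing invertible on U₁, in contrast to G*. This contrast is what evaluates B: the mixed sum of
-- e(s⁻¹) e(c(s³ + s)) occurs with opposite signs in the computations on G* and on U₁, and once it
-- is eliminated only C and K are left.
--
-- No generator of a multiplicative group is ever chosen. The size of a fibre is bounded above by
-- the degree of a polynomial, and comparing the total of such bounds with the known size of the
-- source gives the orders of G, 𝔽_q and U₁ as well as exact fibre sizes: when the bounds add up to
-- the size of the source, each of them is attained.
--
-- All sums run over the one list of field elements, restricted by a Boolean predicate. Thirds are
-- avoided by evaluating 3A and 3B.

∧-true⁻ : ∀ {p r} → p ∧ r ≡ true → p ≡ true × r ≡ true
∧-true⁻ {true} {true} _ = refl , refl

∧-true⁺ : ∀ {p r} → p ≡ true → r ≡ true → p ∧ r ≡ true
∧-true⁺ refl refl = refl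

⟦_⟧ : Bool → ℤ
⟦ p ⟧ = if p then 1ℤ else 0ℤ

Bool-ext : ∀ {p r} → (p ≡ true → r ≡ true) → (r ≡ true → p ≡ true) → p ≡ r
Bool-ext {true}  {true}  _ _ = refl
Bool-ext {true}  {false} f _ = sym (f refl)
Bool-ext {false} {true}  _ g = g refl
Bool-ext {false} {false} _ _ = refl

-- The third condition need only be translated where the second one holds: in the application the
-- class of u₂ can be read off from u₁ only for the one u₂ that satisfies the trace condition.
if-∧∧ : ∀ {c₁ c₂ c₃ d₂ d₃} z → c₁ ≡ true → c₂ ≡ d₂ → (d₂ ≡ true → c₃ ≡ d₃) →
        (if c₁ ∧ c₂ ∧ c₃ then z else 0ℤ) ≡ ⟦ d₂ ⟧ ℤ.* (⟦ d₃ ⟧ ℤ.* z)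
if-∧∧ {d₂ = false} {d₃}    z refl refl _ = refl
if-∧∧ {d₂ = true}  {true}  z refl refl h rewrite h refl = sym (trans (ℤ.*-identityˡ _) (ℤ.*-identityˡ z))
if-∧∧ {d₂ = true}  {false} z refl refl h rewrite h refl = refl

-- Arithmetic in a field of characteristic 2

module FiniteFieldTheory {n : ℕ} (F : FiniteField2 n) where
  open FiniteField2 F
  open FieldOps F

  commutativeRing : CommutativeRing 0ℓ 0ℓ
  commutativeRing = record { isCommutativeRing = isCommRing }

  open CommutativeRing commutativeRing public
    using (+-comm; +-assoc; *-comm; *-assoc; +-identityˡ; +-identityʳ; *-identityˡ; *-identityʳ; zeroˡ; zeroʳ; distribʳ)

  -- Negation is `id` in the ring structure, so this is the law of additive inverses.
  x+x≡0 : ∀ x → x + x ≡ 0#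
  x+x≡0 = CommutativeRing.-‿inverseʳ commutativeRing

  fromBool : Bool → Carrier
  fromBool true  = 1#
  fromBool false = 0#

  -- Taking coefficients in 𝔽₂ lets the solver use x + x ≡ 0.
  private
    R = fromCommutativeRing commutativeRing

    𝔽₂⟶F : CommutativeRing.rawRing Bool.xor-∧-commutativeRing -Raw-AlmostCommutative⟶ R
    𝔽₂⟶F = record
      { ⟦_⟧    = fromBool
      ; +-homo = λ { true true → sym (x+x≡0 1#) ; true false → sym (+-identityʳ _)
                   ; false true → sym (+-identityˡ _) ; false false → sym (+-identityˡ _) }
      ; *-homo = λ { true true → sym (*-identityˡ _) ; true false → sym (*-identityˡ _)
                   ; false true → sym (zeroˡ _) ; false false → sym (zeroˡ _) }
      ; -‿homo = λ _ → refl
      ; 0-homo = refl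
      ; 1-homo = refl
      }

    _≟𝔽₂_ : ∀ x y → Maybe (fromBool x ≡ fromBool y)
    true  ≟𝔽₂ true  = just refl
    false ≟𝔽₂ false = just refl
    _     ≟𝔽₂ _     = nothing

  module Solver = RingSolver (CommutativeRing.rawRing Bool.xor-∧-commutativeRing) R 𝔽₂⟶F _≟𝔽₂_
  open Solver using (solve; con; _:=_; _:+_; _:*_)

  x+y≡0⇒x≡y : ∀ {x y} → x + y ≡ 0# → x ≡ y
  x+y≡0⇒x≡y {x} {y} h = begin
    x           ≡⟨ solve 2 (λ x y → x := (x :+ y) :+ y) refl x y ⟩
    (x + y) + y ≡⟨ cong (_+ y) h ⟩
    0# + y      ≡⟨ +-identityˡ y ⟩
    y           ∎

  x≡y⇒x+y≡0 : ∀ {x y} → x ≡ y → x + y ≡ 0#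
  x≡y⇒x+y≡0 refl = x+x≡0 _

  inverseˡ : ∀ {x} → x ≢ 0# → x ⁻¹ * x ≡ 1#
  inverseˡ x≢0 = trans (*-comm _ _) (inverseʳ _ x≢0)

  *-cancelˡ : ∀ {x y z} → x ≢ 0# → x * y ≡ x * z → y ≡ z
  *-cancelˡ {x} {y} {z} x≢0 h = begin
    y              ≡⟨ expand y ⟩
    x ⁻¹ * (x * y) ≡⟨ cong (x ⁻¹ *_) h ⟩
    x ⁻¹ * (x * z) ≡⟨ expand z ⟨
    z              ∎
    where
    expand : ∀ w → w ≡ x ⁻¹ * (x * w)
    expand w = begin
      w              ≡⟨ *-identityˡ w ⟨
      1# * w         ≡⟨ cong (_* w) (inverseˡ x≢0) ⟨
      x ⁻¹ * x * w   ≡⟨ *-assoc _ _ _ ⟩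
      x ⁻¹ * (x * w) ∎

  xy≡0⇒y≡0 : ∀ {x y} → x ≢ 0# → x * y ≡ 0# → y ≡ 0#
  xy≡0⇒y≡0 x≢0 h = *-cancelˡ x≢0 (trans h (sym (zeroʳ _)))

  *-≢0 : ∀ {x y} → x ≢ 0# → y ≢ 0# → x * y ≢ 0#
  *-≢0 x≢0 y≢0 h = y≢0 (xy≡0⇒y≡0 x≢0 h)

  xy≡1⇒x≢0 : ∀ {x y} → x * y ≡ 1# → x ≢ 0#
  xy≡1⇒x≢0 h refl = 0≢1 (trans (sym (zeroˡ _)) h)

  ⁻¹-≢0 : ∀ {x} → x ≢ 0# → x ⁻¹ ≢ 0#
  ⁻¹-≢0 x≢0 = xy≡1⇒x≢0 (inverseˡ x≢0)

  ⁻¹-unique : ∀ {x y} → x * y ≡ 1# → y ≡ x ⁻¹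
  ⁻¹-unique h = *-cancelˡ (xy≡1⇒x≢0 h) (trans h (sym (inverseʳ _ (xy≡1⇒x≢0 h))))

  ⁻¹-involutive : ∀ {x} → x ≢ 0# → (x ⁻¹) ⁻¹ ≡ x
  ⁻¹-involutive x≢0 = sym (⁻¹-unique (inverseˡ x≢0))

  ⁻¹-distrib-* : ∀ {x y} → x ≢ 0# → y ≢ 0# → (x * y) ⁻¹ ≡ x ⁻¹ * y ⁻¹
  ⁻¹-distrib-* {x} {y} x≢0 y≢0 = sym (⁻¹-unique (begin
    (x * y) * (x ⁻¹ * y ⁻¹) ≡⟨ solve 4 (λ x y a b → (x :* y) :* (a :* b) := (x :* a) :* (y :* b)) refl x y _ _ ⟩
    (x * x ⁻¹) * (y * y ⁻¹) ≡⟨ cong₂ _*_ (inverseʳ x x≢0) (inverseʳ y y≢0) ⟩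
    1# * 1#                 ≡⟨ *-identityˡ 1# ⟩
    1#                      ∎))

  1≢0 : 1# ≢ 0#
  1≢0 h = 0≢1 (sym h)

  1⁻¹≡1 : 1# ⁻¹ ≡ 1#
  1⁻¹≡1 = sym (⁻¹-unique (*-identityˡ 1#))

  x²≡0⇒x≡0 : ∀ {x} → x * x ≡ 0# → x ≡ 0#
  x²≡0⇒x≡0 {x} h with x ≟ 0#
  ... | yes x≡0 = x≡0
  ... | no  x≢0 = xy≡0⇒y≡0 x≢0 h

  x²≡y²⇒x≡y : ∀ {x y} → x * x ≡ y * y → x ≡ y
  x²≡y²⇒x≡y {x} {y} h = x+y≡0⇒x≡y (x²≡0⇒x≡0 (begin
    (x + y) * (x + y) ≡⟨ solve 2 (λ x y → (x :+ y) :* (x :+ y) := x :* x :+ y :* y) refl x y ⟩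
    x * x + y * y     ≡⟨ x≡y⇒x+y≡0 h ⟩
    0#                ∎))

  -- Powers and the Frobenius map

  pow-+ : ∀ x k l → pow x (k ℕ.+ l) ≡ pow x k * pow x l
  pow-+ x zero    l = sym (*-identityˡ _)
  pow-+ x (suc k) l = trans (cong (x *_) (pow-+ x k l)) (sym (*-assoc _ _ _))

  pow-1# : ∀ k → pow 1# k ≡ 1#
  pow-1# zero    = refl
  pow-1# (suc k) = trans (*-identityˡ _) (pow-1# k)

  pow-1 : ∀ x → pow x 1 ≡ x
  pow-1 = *-identityʳ

  pow-distrib-* : ∀ x y k → pow (x * y) k ≡ pow x k * pow y k
  pow-distrib-* x y zero    = sym (*-identityˡ _)
  pow-distrib-* x y (suc k) = trans (cong ((x * y) *_) (pow-distrib-* x y k))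
    (solve 4 (λ x y a b → (x :* y) :* (a :* b) := (x :* a) :* (y :* b)) refl x y _ _)

  pow-* : ∀ x k l → pow x (k ℕ.* l) ≡ pow (pow x k) l
  pow-* x zero    l = sym (pow-1# l)
  pow-* x (suc k) l = begin
    pow x (l ℕ.+ k ℕ.* l)       ≡⟨ pow-+ x l (k ℕ.* l) ⟩
    pow x l * pow x (k ℕ.* l)   ≡⟨ cong (pow x l *_) (pow-* x k l) ⟩
    pow x l * pow (pow x k) l   ≡⟨ pow-distrib-* x (pow x k) l ⟨
    pow (x * pow x k) l         ∎

  pow-comm : ∀ x k l → pow (pow x k) l ≡ pow (pow x l) k
  pow-comm x k l = trans (sym (pow-* x k l)) (trans (cong (pow x) (ℕ.*-comm k l)) (pow-* x l k))

  pow-≢0 : ∀ {x} k → x ≢ 0# → pow x k ≢ 0#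
  pow-≢0 zero    x≢0 = 1≢0
  pow-≢0 (suc k) x≢0 = *-≢0 x≢0 (pow-≢0 k x≢0)

  pow-⁻¹ : ∀ {x} k → x ≢ 0# → pow (x ⁻¹) k ≡ pow x k ⁻¹
  pow-⁻¹ {x} k x≢0 = ⁻¹-unique (begin
    pow x k * pow (x ⁻¹) k ≡⟨ pow-distrib-* x (x ⁻¹) k ⟨
    pow (x * x ⁻¹) k       ≡⟨ cong (λ z → pow z k) (inverseʳ x x≢0) ⟩
    pow 1# k               ≡⟨ pow-1# k ⟩
    1#                     ∎)

  pow-2^suc : ∀ x k → pow x (2 ^ suc k) ≡ pow x (2 ^ k) * pow x (2 ^ k)
  pow-2^suc x k = trans (cong (λ l → pow x (2 ^ k ℕ.+ l)) (ℕ.+-identityʳ (2 ^ k))) (pow-+ x (2 ^ k) (2 ^ k))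

  frobenius : ∀ k x y → pow (x + y) (2 ^ k) ≡ pow x (2 ^ k) + pow y (2 ^ k)
  frobenius zero    x y = solve 2 (λ x y → (x :+ y) :* con true := x :* con true :+ y :* con true) refl x y
  frobenius (suc k) x y = begin
    pow (x + y) (2 ^ suc k)                                     ≡⟨ pow-2^suc (x + y) k ⟩
    pow (x + y) (2 ^ k) * pow (x + y) (2 ^ k)                   ≡⟨ cong₂ _*_ (frobenius k x y) (frobenius k x y) ⟩
    (pow x (2 ^ k) + pow y (2 ^ k)) * (pow x (2 ^ k) + pow y (2 ^ k))
      ≡⟨ solve 2 (λ x y → (x :+ y) :* (x :+ y) := x :* x :+ y :* y) refl _ _ ⟩
    pow x (2 ^ k) * pow x (2 ^ k) + pow y (2 ^ k) * pow y (2 ^ k)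
      ≡⟨ cong₂ _+_ (pow-2^suc x k) (pow-2^suc y k) ⟨
    pow x (2 ^ suc k) + pow y (2 ^ suc k)                       ∎

  pow-0# : ∀ k .{{_ : ℕ.NonZero k}} → pow 0# k ≡ 0#
  pow-0# (suc k) = zeroˡ _

  -- Boolean equality and the Kronecker delta

  eqB-true⁻ : ∀ {x y} → eqB x y ≡ true → x ≡ y
  eqB-true⁻ {x} {y} h with x ≟ y
  ... | yes x≡y = x≡y

  eqB-true⁺ : ∀ {x y} → x ≡ y → eqB x y ≡ true
  eqB-true⁺ {x} {y} h with x ≟ y
  ... | yes _   = refl
  ... | no  x≢y = contradiction h x≢y

  eqB-false⁺ : ∀ {x y} → x ≢ y → eqB x y ≡ false
  eqB-false⁺ {x} {y} h with x ≟ y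
  ... | yes x≡y = contradiction x≡y h
  ... | no  _   = refl

  not-eqB⁻ : ∀ {x y} → not (eqB x y) ≡ true → x ≢ y
  not-eqB⁻ {x} {y} h with x ≟ y
  ... | no x≢y = x≢y

  not-eqB⁺ : ∀ {x y} → x ≢ y → not (eqB x y) ≡ true
  not-eqB⁺ h = cong not (eqB-false⁺ h)

  eqB-cong : ∀ {w x y z} → (w ≡ x → y ≡ z) → (y ≡ z → w ≡ x) → eqB w x ≡ eqB y z
  eqB-cong f g = Bool-ext (eqB-true⁺ ∘ f ∘ eqB-true⁻) (eqB-true⁺ ∘ g ∘ eqB-true⁻)

  δ : Carrier → Carrier → ℤ
  δ x y = ⟦ eqB x y ⟧

  δ-≡ : ∀ {x y} → x ≡ y → δ x y ≡ 1ℤ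
  δ-≡ h = cong ⟦_⟧ (eqB-true⁺ h)

  δ-≢ : ∀ {x y} → x ≢ y → δ x y ≡ 0ℤ
  δ-≢ h = cong ⟦_⟧ (eqB-false⁺ h)

  δ-cong : ∀ {w x y z} → (w ≡ x → y ≡ z) → (y ≡ z → w ≡ x) → δ w x ≡ δ y z
  δ-cong f g = cong ⟦_⟧ (eqB-cong f g)

  -- Sums over lists of field elements

  sumList-cong : ∀ xs {P f g} → (∀ x → P x ≡ true → f x ≡ g x) → sumList xs P f ≡ sumList xs P g
  sumList-cong []       h = refl
  sumList-cong (x ∷ xs) {P} h with P x in Px
  ... | true  = cong₂ ℤ._+_ (h x Px) (sumList-cong xs h)
  ... | false = cong (λ s → 0ℤ ℤ.+ s) (sumList-cong xs h)

  sumList-+ : ∀ xs P (f g : Carrier → ℤ) → sumList xs P (λ x → f x ℤ.+ g x) ≡ sumList xs P f ℤ.+ sumList xs P g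
  sumList-+ []       P f g = refl
  sumList-+ (x ∷ xs) P f g with P x
  ... | true  = trans (cong (λ s → f x ℤ.+ g x ℤ.+ s) (sumList-+ xs P f g)) (interchange (f x) (g x) _ _)
    where
    interchange : ∀ a b c d → a ℤ.+ b ℤ.+ (c ℤ.+ d) ≡ a ℤ.+ c ℤ.+ (b ℤ.+ d)
    interchange = solve-∀
  ... | false = trans (cong (λ s → 0ℤ ℤ.+ s) (sumList-+ xs P f g)) (interchange (sumList xs P f) (sumList xs P g))
    where
    interchange : ∀ c d → 0ℤ ℤ.+ (c ℤ.+ d) ≡ 0ℤ ℤ.+ c ℤ.+ (0ℤ ℤ.+ d)
    interchange = solve-∀

  sumList-*ˡ : ∀ xs P c (f : Carrier → ℤ) → sumList xs P (λ x → c ℤ.* f x) ≡ c ℤ.* sumList xs P f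
  sumList-*ˡ []       P c f = sym (ℤ.*-zeroʳ c)
  sumList-*ˡ (x ∷ xs) P c f with P x
  ... | true  = trans (cong (λ s → c ℤ.* f x ℤ.+ s) (sumList-*ˡ xs P c f)) (sym (ℤ.*-distribˡ-+ c _ _))
  ... | false = trans (cong (λ s → 0ℤ ℤ.+ s) (sumList-*ˡ xs P c f)) (drop0 c _)
    where
    drop0 : ∀ a b → 0ℤ ℤ.+ a ℤ.* b ≡ a ℤ.* (0ℤ ℤ.+ b)
    drop0 = solve-∀

  sumList-0 : ∀ xs {P f} → (∀ x → P x ≡ true → f x ≡ 0ℤ) → sumList xs P f ≡ 0ℤ
  sumList-0 []       h = refl
  sumList-0 (x ∷ xs) {P} h with P x in Px
  ... | true  = cong₂ ℤ._+_ (h x Px) (sumList-0 xs h)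
  ... | false = cong (λ s → 0ℤ ℤ.+ s) (sumList-0 xs h)

  sumList-swap : ∀ xs ys P R (f : Carrier → Carrier → ℤ) →
    sumList xs P (λ x → sumList ys R (λ y → f x y)) ≡ sumList ys R (λ y → sumList xs P (λ x → f x y))
  sumList-swap []       ys P R f = sym (sumList-0 ys (λ _ _ → refl))
  sumList-swap (x ∷ xs) ys P R f with P x
  ... | true  = trans (cong (λ s → sumList ys R (f x) ℤ.+ s) (sumList-swap xs ys P R f)) (sym (sumList-+ ys R (f x) _))
  ... | false = trans (cong (λ s → 0ℤ ℤ.+ s) (sumList-swap xs ys P R f))
    (trans (cong (λ s → s ℤ.+ sumList ys R (λ y → sumList xs P (λ x → f x y))) (sym (sumList-0 ys {R} {λ _ → 0ℤ} (λ _ _ → refl)))) (sym (sumList-+ ys R (λ _ → 0ℤ) _)))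

  sumList-mono : ∀ xs {P f g} → (∀ x → P x ≡ true → f x ℤ.≤ g x) → sumList xs P f ℤ.≤ sumList xs P g
  sumList-mono []       h = ℤ.≤-refl
  sumList-mono (x ∷ xs) {P} h with P x in Px
  ... | true  = ℤ.+-mono-≤ (h x Px) (sumList-mono xs h)
  ... | false = ℤ.+-monoʳ-≤ (0ℤ) (sumList-mono xs h)

  private
    ≤-+-tight : ∀ {a b c d} → a ℤ.≤ b → c ℤ.≤ d → a ℤ.+ c ≡ b ℤ.+ d → a ≡ b × c ≡ d
    ≤-+-tight {a} {b} {c} {d} a≤b c≤d eq = a≡b , ℤ+-cancelˡ a c d (trans eq (cong (ℤ._+ d) (sym a≡b)))
      where
      b≤a : b ℤ.≤ a
      b≤a = ℤ.≮⇒≥ λ a<b → ℤ.<-irrefl eq (ℤ.+-mono-<-≤ a<b c≤d)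
      a≡b = ℤ.≤-antisym a≤b b≤a

  -- The counting principle of the development: upper bounds are easy to find, and equality of the
  -- totals turns them into exact values.
  sumList-tight : ∀ xs {P f g} → (∀ x → P x ≡ true → f x ℤ.≤ g x) → sumList xs P f ≡ sumList xs P g →
                  ∀ {x} → x ∈ xs → P x ≡ true → f x ≡ g x
  sumList-tight (x ∷ xs) {P} h eq x∈ Py with P x in Px
  sumList-tight (x ∷ xs) h eq (here refl) Py | true  = proj₁ (≤-+-tight (h x Px) (sumList-mono xs h) eq)
  sumList-tight (x ∷ xs) h eq (there x∈)  Py | true  =
    sumList-tight xs h (proj₂ (≤-+-tight (h x Px) (sumList-mono xs h) eq)) x∈ Py
  sumList-tight (x ∷ xs) h eq (here refl) Py | false = contradiction (trans (sym Py) Px) (λ ())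
  sumList-tight (x ∷ xs) h eq (there x∈)  Py | false =
    sumList-tight xs h (ℤ+-cancelˡ (0ℤ) _ _ eq) x∈ Py

  sumList-δ-∉ : ∀ xs P {c} (f : Carrier → ℤ) → All (c ≢_) xs → sumList xs P (λ x → δ x c ℤ.* f x) ≡ 0ℤ
  sumList-δ-∉ []       P f _           = refl
  sumList-δ-∉ (x ∷ xs) P f (c≢x All.∷ c∉) with P x
  ... | true  = cong₂ ℤ._+_ (cong (ℤ._* f x) (δ-≢ (c≢x ∘ sym))) (sumList-δ-∉ xs P f c∉)
  ... | false = cong (λ s → 0ℤ ℤ.+ s) (sumList-δ-∉ xs P f c∉)

  sumList-δ : ∀ xs {P c} (f : Carrier → ℤ) → Unique xs → c ∈ xs → P c ≡ true → sumList xs P (λ x → δ x c ℤ.* f x) ≡ f c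
  sumList-δ (x ∷ xs) {P} f (x∉ ∷ u) (here refl) Pc rewrite Pc =
    trans (cong₂ ℤ._+_ (trans (cong (ℤ._* f x) (δ-≡ {x} refl)) (ℤ.*-identityˡ (f x))) (sumList-δ-∉ xs P f x∉))
          (ℤ.+-identityʳ (f x))
  sumList-δ (x ∷ xs) {P} {c} f (x∉ ∷ u) (there c∈) Pc with P x
  ... | true  = trans (cong₂ ℤ._+_ (cong (ℤ._* f x) (δ-≢ (All.lookup x∉ c∈))) (sumList-δ xs {P} f u c∈ Pc)) (ℤ.+-identityˡ _)
  ... | false = trans (cong (λ s → 0ℤ ℤ.+ s) (sumList-δ xs {P} f u c∈ Pc)) (ℤ.+-identityˡ _)

  ∑-δ : ∀ {P c} (f : Carrier → ℤ) → P c ≡ true → sumWhere P (λ x → δ x c ℤ.* f x) ≡ f c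
  ∑-δ f = sumList-δ elements f elements-unique (elements-complete _)

  sumList-⟦⟧ : ∀ xs P (R : Carrier → Bool) (f : Carrier → ℤ) → sumList xs P (λ x → ⟦ R x ⟧ ℤ.* f x) ≡ sumList xs (λ x → P x ∧ R x) f
  sumList-⟦⟧ []       P R f = refl
  sumList-⟦⟧ (x ∷ xs) P R f with P x | R x
  ... | true  | true  = cong₂ ℤ._+_ (ℤ.*-identityˡ (f x)) (sumList-⟦⟧ xs P R f)
  ... | true  | false = cong₂ ℤ._+_ (ℤ.*-zeroˡ (f x)) (sumList-⟦⟧ xs P R f)
  ... | false | _     = cong (λ s → 0ℤ ℤ.+ s) (sumList-⟦⟧ xs P R f)

  sumList-1 : ∀ xs {P} → (∀ x → P x ≡ true) → sumList xs P (λ _ → 1ℤ) ≡ ℤ.+ length xs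
  sumList-1 []       h = refl
  sumList-1 (x ∷ xs) h rewrite h x = cong (λ s → 1ℤ ℤ.+ s) (sumList-1 xs h)

  sumList-cong-pred : ∀ xs {P S} f → (∀ x → P x ≡ S x) → sumList xs P f ≡ sumList xs S f
  sumList-cong-pred []       f h = refl
  sumList-cong-pred (x ∷ xs) f h = cong₂ ℤ._+_ (cong (if_then f x else 0ℤ) (h x)) (sumList-cong-pred xs f h)

  _∖_ : (Carrier → Bool) → Carrier → Carrier → Bool
  (P ∖ c) x = P x ∧ not (eqB x c)

  ∖⁻ : ∀ P {c x} → (P ∖ c) x ≡ true → P x ≡ true × x ≢ c
  ∖⁻ P h = proj₁ (∧-true⁻ h) , not-eqB⁻ (proj₂ (∧-true⁻ h))

  ∖⁺ : ∀ P {c x} → P x ≡ true → x ≢ c → (P ∖ c) x ≡ true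
  ∖⁺ P Px x≢c = ∧-true⁺ Px (not-eqB⁺ x≢c)

  ∑-split : ∀ {P c} (f : Carrier → ℤ) → P c ≡ true → sumWhere P f ≡ f c ℤ.+ sumWhere (P ∖ c) f
  ∑-split {P} {c} f Pc = begin
    sumWhere P f
      ≡⟨ sumList-cong elements (λ x _ → dichotomy (eqB x c) (f x)) ⟩
    sumWhere P (λ x → δ x c ℤ.* f x ℤ.+ ⟦ not (eqB x c) ⟧ ℤ.* f x)
      ≡⟨ sumList-+ elements P _ _ ⟩
    sumWhere P (λ x → δ x c ℤ.* f x) ℤ.+ sumWhere P (λ x → ⟦ not (eqB x c) ⟧ ℤ.* f x)
      ≡⟨ cong₂ ℤ._+_ (∑-δ f Pc) (sumList-⟦⟧ elements P _ f) ⟩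
    f c ℤ.+ sumWhere (P ∖ c) f ∎
    where
    dichotomy : ∀ p z → z ≡ ⟦ p ⟧ ℤ.* z ℤ.+ ⟦ not p ⟧ ℤ.* z
    dichotomy true  z = sym (trans (ℤ.+-identityʳ _) (ℤ.*-identityˡ z))
    dichotomy false z = sym (trans (ℤ.+-identityˡ _) (ℤ.*-identityˡ z))

  ∑-cong : ∀ {P f g} → (∀ x → P x ≡ true → f x ≡ g x) → sumWhere P f ≡ sumWhere P g
  ∑-cong = sumList-cong elements

  -- Counting by fibres

  card : (Carrier → Bool) → ℤ
  card P = sumWhere P (λ _ → 1ℤ)

  ∑-const : ∀ P c → sumWhere P (λ _ → c) ≡ c ℤ.* card P
  ∑-const P c = trans (∑-cong (λ _ _ → sym (ℤ.*-identityʳ c))) (sumList-*ˡ elements P c _)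

  -- An integer rather than a natural number, because it becomes the weight of y when a sum is
  -- pushed forward along g.
  fibre : (Carrier → Bool) → (Carrier → Carrier) → Carrier → ℤ
  fibre P g y = sumWhere P (λ x → δ (g x) y)

  -- Each h (g x) is expanded as a sum over y of δ y (g x) times h y, and the two summations are
  -- exchanged.
  ∑-fibre : ∀ {P R} (g : Carrier → Carrier) (h : Carrier → ℤ) → (∀ x → P x ≡ true → R (g x) ≡ true) →
            sumWhere P (h ∘ g) ≡ sumWhere R (λ y → fibre P g y ℤ.* h y)
  ∑-fibre {P} {R} g h P⇒R = begin
    sumWhere P (h ∘ g)
      ≡⟨ ∑-cong (λ x Px → sym (∑-δ h (P⇒R x Px))) ⟩
    sumWhere P (λ x → sumWhere R (λ y → δ y (g x) ℤ.* h y))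
      ≡⟨ sumList-swap elements elements P R _ ⟩
    sumWhere R (λ y → sumWhere P (λ x → δ y (g x) ℤ.* h y))
      ≡⟨ ∑-cong (λ y _ → begin
           sumWhere P (λ x → δ y (g x) ℤ.* h y) ≡⟨ ∑-cong (λ x _ → trans (ℤ.*-comm _ (h y)) (cong (h y ℤ.*_) (δ-cong sym sym))) ⟩
           sumWhere P (λ x → h y ℤ.* δ (g x) y) ≡⟨ sumList-*ˡ elements P (h y) _ ⟩
           h y ℤ.* fibre P g y                  ≡⟨ ℤ.*-comm (h y) _ ⟩
           fibre P g y ℤ.* h y                  ∎) ⟩
    sumWhere R (λ y → fibre P g y ℤ.* h y) ∎

  card-fibre : ∀ {P R} g → (∀ x → P x ≡ true → R (g x) ≡ true) → card P ≡ sumWhere R (fibre P g)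
  card-fibre g P⇒R = trans (∑-fibre g (λ _ → 1ℤ) P⇒R) (∑-cong (λ _ _ → ℤ.*-identityʳ _))

  fibre-tight : ∀ {P R} g {bound} → (∀ x → P x ≡ true → R (g x) ≡ true) →
    (∀ y → R y ≡ true → fibre P g y ℤ.≤ bound y) → card P ≡ sumWhere R bound →
    ∀ y → R y ≡ true → fibre P g y ≡ bound y
  fibre-tight g P⇒R le eq y = sumList-tight elements le (trans (sym (card-fibre g P⇒R)) eq) (elements-complete y)

  fibre-injective-≤1 : ∀ {P g} → (∀ {x y} → P x ≡ true → P y ≡ true → g x ≡ g y → x ≡ y) →
                       ∀ y → fibre P g y ℤ.≤ 1ℤ
  fibre-injective-≤1 {P} {g} inj y = go elements elements-unique
    where
    go : ∀ xs → Unique xs → sumList xs P (λ x → δ (g x) y) ℤ.≤ 1ℤ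
    go []       u        = ℤ.+≤+ ℕ.z≤n
    go (x ∷ xs) (x∉ ∷ u) with P x in Px | g x ≟ y
    ... | false | _       = subst (ℤ._≤ 1ℤ) (sym (ℤ.+-identityˡ _)) (go xs u)
    ... | true  | no _    = subst (ℤ._≤ 1ℤ) (sym (ℤ.+-identityˡ _)) (go xs u)
    ... | true  | yes gx≡y = ℤ.≤-reflexive (cong (λ s → 1ℤ ℤ.+ s) (rest xs x∉))
      where
      rest : ∀ zs → All (x ≢_) zs → sumList zs P (λ x → δ (g x) y) ≡ 0ℤ
      rest []       _            = refl
      rest (z ∷ zs) (x≢z All.∷ x∉) with P z in Pz
      ... | false = cong (λ s → 0ℤ ℤ.+ s) (rest zs x∉)
      ... | true  = cong₂ ℤ._+_ (δ-≢ (λ gz≡y → x≢z (inj Px Pz (trans gx≡y (sym gz≡y))))) (rest zs x∉)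

  -- An injective self-map of a finite set is a bijection: its fibres have at
  -- most one element, and they account for the whole set.
  ∑-reindex : ∀ {P} (g : Carrier → Carrier) (h : Carrier → ℤ) → (∀ x → P x ≡ true → P (g x) ≡ true) →
    (∀ {x y} → P x ≡ true → P y ≡ true → g x ≡ g y → x ≡ y) →
    sumWhere P (h ∘ g) ≡ sumWhere P h
  ∑-reindex {P} g h closed inj = trans (∑-fibre g h closed) (∑-cong (λ y Py →
    trans (cong (ℤ._* h y) (fibre-tight g closed (λ y _ → fibre-injective-≤1 inj y) refl y Py)) (ℤ.*-identityˡ (h y))))

  -- Polynomials and their roots

  -- A list c₀, …, c_{d-1} stands for the monic polynomial
  -- c₀ + c₁ X + … + c_{d-1} X^{d-1} + X^d, so its length is the degree.
  eval : List Carrier → Carrier → Carrier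
  eval []      x = 1#
  eval (c ∷ p) x = c + x * eval p x

  -- Synthetic division by X + r: the coefficients are the Horner values of the tails at r, and the
  -- leading 1 again stays implicit.
  quotient : Carrier → List Carrier → List Carrier
  quotient r []               = []
  quotient r (c ∷ [])         = []
  quotient r (c ∷ p@(_ ∷ _)) = eval p r ∷ quotient r p

  eval-quotient : ∀ c p r x → eval (c ∷ p) x ≡ eval (c ∷ p) r + (x + r) * eval (quotient r (c ∷ p)) x
  eval-quotient c []       r x =
    solve 3 (λ c r x → c :+ x :* con true := (c :+ r :* con true) :+ (x :+ r) :* con true) refl c r x
  eval-quotient c p@(d ∷ p′) r x = trans (cong (λ z → c + x * z) (eval-quotient d p′ r x))
    (solve 5 (λ c r x s t → c :+ x :* (s :+ (x :+ r) :* t) := (c :+ r :* s) :+ (x :+ r) :* (s :+ x :* t)) refl c r x _ _)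

  length-quotient : ∀ c p r → length (quotient r (c ∷ p)) ≡ length p
  length-quotient c []       r = refl
  length-quotient c (d ∷ p) r = cong suc (length-quotient d p r)

  quotient-root : ∀ c p {r x} → eval (c ∷ p) r ≡ 0# → eval (c ∷ p) x ≡ 0# → r ≢ x → eval (quotient r (c ∷ p)) x ≡ 0#
  quotient-root c p {r} {x} pr px r≢x = xy≡0⇒y≡0 (λ h → r≢x (sym (x+y≡0⇒x≡y h))) (begin
    (x + r) * eval (quotient r (c ∷ p)) x                  ≡⟨ +-identityˡ _ ⟨
    0# + (x + r) * eval (quotient r (c ∷ p)) x             ≡⟨ cong (_+ (x + r) * eval (quotient r (c ∷ p)) x) pr ⟨
    eval (c ∷ p) r + (x + r) * eval (quotient r (c ∷ p)) x ≡⟨ eval-quotient c p r x ⟨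
    eval (c ∷ p) x                                         ≡⟨ px ⟩
    0#                                                     ∎)

  -- Each root splits off a linear factor. The later entries of the list differ from it, so they are
  -- roots of the quotient, whose degree is one less; this is why only roots that occur in the list
  -- are considered.
  #roots≤degree : ∀ xs p P → Unique xs → (∀ {x} → x ∈ xs → P x ≡ true → eval p x ≡ 0#) →
                  sumList xs P (λ _ → 1ℤ) ℤ.≤ ℤ.+ length p
  #roots≤degree []       p P u roots = ℤ.+≤+ ℕ.z≤n
  #roots≤degree (x ∷ xs) p P (x∉ ∷ u) roots with P x in Px
  ... | false = subst (ℤ._≤ ℤ.+ length p) (sym (ℤ.+-identityˡ _)) (#roots≤degree xs p P u (roots ∘ there))
  #roots≤degree (x ∷ xs) []      P (x∉ ∷ u) roots | true = contradiction (roots (here refl) Px) 1≢0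
  #roots≤degree (x ∷ xs) (c ∷ p) P (x∉ ∷ u) roots | true = ℤ.+-monoʳ-≤ 1ℤ
    (subst (λ l → sumList xs P (λ _ → 1ℤ) ℤ.≤ ℤ.+ l) (length-quotient c p x)
      (#roots≤degree xs (quotient x (c ∷ p)) P u λ y∈ Py →
        quotient-root c p (roots (here refl) Px) (roots (there y∈) Py) (All.lookup x∉ y∈)))

  card≤degree : ∀ p P → (∀ x → P x ≡ true → eval p x ≡ 0#) → card P ℤ.≤ ℤ.+ length p
  card≤degree p P roots = #roots≤degree elements p P elements-unique (λ _ → roots _)

  fibre≤degree : ∀ p P g y → (∀ x → P x ≡ true → g x ≡ y → eval p x ≡ 0#) → fibre P g y ℤ.≤ ℤ.+ length p
  fibre≤degree p P g y roots = subst (ℤ._≤ ℤ.+ length p)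
    (trans (sym (sumList-⟦⟧ elements P (λ x → eqB (g x) y) (λ _ → 1ℤ))) (∑-cong (λ x _ → ℤ.*-identityʳ _)))
    (card≤degree p (λ x → P x ∧ eqB (g x) y) (λ x h → roots x (proj₁ (∧-true⁻ h)) (eqB-true⁻ (proj₂ (∧-true⁻ h)))))

  search : ∀ xs (P : Carrier → Bool) → (∃[ x ] P x ≡ true) ⊎ (∀ {x} → x ∈ xs → P x ≡ false)
  search []       P = inj₂ λ ()
  search (x ∷ xs) P with P x in Px | search xs P
  ... | true  | _         = inj₁ (x , Px)
  ... | false | inj₁ w    = inj₁ w
  ... | false | inj₂ none = inj₂ λ { (here refl) → Px ; (there x∈) → none x∈ }

  -- The source of existence statements: it provides an element of trace 1 and a non-cube.
  nonroot : ∀ p P → ℤ.+ length p ℤ.< card P → ∃[ x ] P x ≡ true × eval p x ≢ 0#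
  nonroot p P big with search elements (λ x → P x ∧ not (eqB (eval p x) 0#))
  ... | inj₁ (x , h) = x , proj₁ (∧-true⁻ h) , not-eqB⁻ (proj₂ (∧-true⁻ h))
  ... | inj₂ none    = contradiction (ℤ.<-≤-trans big (card≤degree p P root)) (ℤ.<-irrefl refl)
    where
    root : ∀ x → P x ≡ true → eval p x ≡ 0#
    root x Px with eval p x ≟ 0#
    ... | yes px≡0 = px≡0
    ... | no  px≢0 = contradiction
      (trans (sym (∧-true⁺ Px (not-eqB⁺ px≢0))) (none (elements-complete x))) (λ ())

  X^_ : ℕ → List Carrier
  X^ d = replicate d 0#

  eval-X^ : ∀ d x → eval (X^ d) x ≡ pow x d
  eval-X^ zero    x = refl
  eval-X^ (suc d) x = trans (+-identityˡ _) (cong (x *_) (eval-X^ d x))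

  -- The leading coefficient is not stored, so only exponents below the degree have an effect; any
  -- other e leaves p unchanged.
  addTerm : Carrier → ℕ → List Carrier → List Carrier
  addTerm a e       []      = []
  addTerm a zero    (c ∷ p) = (a + c) ∷ p
  addTerm a (suc e) (c ∷ p) = c ∷ addTerm a e p

  length-addTerm : ∀ a e p → length (addTerm a e p) ≡ length p
  length-addTerm a e       []      = refl
  length-addTerm a zero    (c ∷ p) = refl
  length-addTerm a (suc e) (c ∷ p) = cong suc (length-addTerm a e p)

  eval-addTerm : ∀ a e p x → e ℕ.< length p → eval (addTerm a e p) x ≡ a * pow x e + eval p x
  eval-addTerm a zero    (c ∷ p) x _         =
    solve 3 (λ a c z → (a :+ c) :+ z := a :* con true :+ (c :+ z)) refl a c _
  eval-addTerm a (suc e) (c ∷ p) x (ℕ.s≤s h) = trans (cong (λ z → c + x * z) (eval-addTerm a e p x h))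
    (solve 5 (λ a c x s t → c :+ x :* (a :* s :+ t) := a :* (x :* s) :+ (c :+ x :* t)) refl a c x _ _)

  X^_⊹_ : ℕ → Carrier → List Carrier
  X^ d ⊹ c = addTerm c 0 (X^ d)

  length-X^⊹ : ∀ d c → length (X^ d ⊹ c) ≡ d
  length-X^⊹ d c = trans (length-addTerm c 0 (X^ d)) (length-replicate d)

  X^⊹-root : ∀ {d c x} → 0 ℕ.< d → pow x d ≡ c → eval (X^ d ⊹ c) x ≡ 0#
  X^⊹-root {d} {c} {x} 0<d h = trans (eval-addTerm c 0 (X^ d) x (subst (0 ℕ.<_) (sym (length-replicate d)) 0<d))
    (trans (cong₂ _+_ (*-identityʳ c) (eval-X^ d x)) (x≡y⇒x+y≡0 (sym h)))

  -- Products over the field and Fermat's little theorem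

  product : List Carrier → (Carrier → Carrier) → Carrier
  product []       f = 1#
  product (x ∷ xs) f = f x * product xs f

  product-* : ∀ xs f g → product xs (λ x → f x * g x) ≡ product xs f * product xs g
  product-* []       f g = sym (*-identityˡ 1#)
  product-* (x ∷ xs) f g = trans (cong (f x * g x *_) (product-* xs f g))
    (solve 4 (λ a b c d → (a :* b) :* (c :* d) := (a :* c) :* (b :* d)) refl _ _ _ _)

  product-cong : ∀ xs {f g} → (∀ x → f x ≡ g x) → product xs f ≡ product xs g
  product-cong []       h = refl
  product-cong (x ∷ xs) h = cong₂ _*_ (h x) (product-cong xs h)

  product-const : ∀ xs a → product xs (λ _ → a) ≡ pow a (length xs)
  product-const []       a = refl
  product-const (x ∷ xs) a = cong (a *_) (product-const xs a)

  product-map : ∀ xs f g → product (map g xs) f ≡ product xs (f ∘ g)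
  product-map []       f g = refl
  product-map (x ∷ xs) f g = cong (f (g x) *_) (product-map xs f g)

  product-↭ : ∀ {xs ys} f → xs ↭ ys → product xs f ≡ product ys f
  product-↭ f ↭.refl         = refl
  product-↭ f (↭.prep x p)   = cong (f x *_) (product-↭ f p)
  product-↭ f (↭.swap x y p) = trans (cong (λ z → f x * (f y * z)) (product-↭ f p))
    (solve 3 (λ a b c → a :* (b :* c) := b :* (a :* c)) refl _ _ _)
  product-↭ f (↭.trans p q)  = trans (product-↭ f p) (product-↭ f q)

  product-≢0 : ∀ xs {f} → (∀ x → f x ≢ 0#) → product xs f ≢ 0#
  product-≢0 []       h = 1≢0
  product-≢0 (x ∷ xs) h = *-≢0 (h x) (product-≢0 xs h)

  product-δ : ∀ xs c a → Unique xs → c ∈ xs → product xs (λ x → if eqB x c then a else 1#) ≡ a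
  product-δ (x ∷ xs) c a (x∉ ∷ u) (here refl) rewrite eqB-true⁺ {x} refl = trans (cong (a *_) (ones xs x∉)) (*-identityʳ a)
    where
    ones : ∀ zs → All (x ≢_) zs → product zs (λ z → if eqB z x then a else 1#) ≡ 1#
    ones []       _              = refl
    ones (z ∷ zs) (x≢z All.∷ x∉) rewrite eqB-false⁺ {z} {x} (x≢z ∘ sym) = trans (*-identityˡ _) (ones zs x∉)
  product-δ (x ∷ xs) c a (x∉ ∷ u) (there c∈) rewrite eqB-false⁺ {x} {c} (All.lookup x∉ c∈) =
    trans (*-identityˡ _) (product-δ xs c a u c∈)

  -- With 0 replaced by 1, a product over the full list of elements is the product of the nonzero
  -- ones.
  nonzeroPart : Carrier → Carrier
  nonzeroPart x = if eqB x 0# then 1# else x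

  nonzeroPart-≢0 : ∀ x → nonzeroPart x ≢ 0#
  nonzeroPart-≢0 x with x ≟ 0#
  ... | yes _   = 1≢0
  ... | no  x≢0 = x≢0

  map-*-↭ : ∀ {a} → a ≢ 0# → map (a *_) elements ↭ elements
  map-*-↭ {a} a≢0 = ∼bag⇒↭ (unique∧set⇒bag (map⁺ (*-cancelˡ a≢0) elements-unique) elements-unique
    λ {x} → mk⇔ (λ _ → elements-complete x)
                (λ _ → subst (_∈ map (a *_) elements) (a*[a⁻¹*x]≡x x) (∈-map⁺ (a *_) (elements-complete (a ⁻¹ * x)))))
    where
    a*[a⁻¹*x]≡x : ∀ x → a * (a ⁻¹ * x) ≡ x
    a*[a⁻¹*x]≡x x = trans (sym (*-assoc _ _ _)) (trans (cong (_* x) (inverseʳ a a≢0)) (*-identityˡ x))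

  -- Multiplication by a permutes the field; compare the products of all
  -- nonzero elements before and after.
  fermat : ∀ a → pow a (2 ^ n) ≡ a
  fermat a with a ≟ 0#
  ... | yes refl = pow-0# (2 ^ n) {{ℕ.m^n≢0 2 n}}
  ... | no  a≢0  = *-cancelˡ (product-≢0 elements nonzeroPart-≢0) (begin
    Π * pow a (2 ^ n)                                     ≡⟨ cong (λ l → Π * pow a l) elements-card ⟨
    Π * pow a (length elements)                           ≡⟨ cong (Π *_) (product-const elements a) ⟨
    Π * product elements (λ _ → a)                        ≡⟨ product-* elements nonzeroPart (λ _ → a) ⟨
    product elements (λ x → nonzeroPart x * a)            ≡⟨ product-cong elements scale ⟩
    product elements (λ x → nonzeroPart (a * x) * (if eqB x 0# then a else 1#))
      ≡⟨ product-* elements _ _ ⟩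
    product elements (λ x → nonzeroPart (a * x)) * product elements (λ x → if eqB x 0# then a else 1#)
      ≡⟨ cong₂ _*_ (sym (product-map elements nonzeroPart (a *_))) (product-δ elements 0# a elements-unique (elements-complete 0#)) ⟩
    product (map (a *_) elements) nonzeroPart * a         ≡⟨ cong (_* a) (product-↭ nonzeroPart (map-*-↭ a≢0)) ⟩
    Π * a                                                 ∎)
    where
    Π = product elements nonzeroPart
    -- At x = 0 the factor a is invisible to `nonzeroPart`; the correction factor restores it. Over
    -- the whole field the corrections multiply to a, hence the exponent 2^n instead of 2^n - 1.
    scale : ∀ x → nonzeroPart x * a ≡ nonzeroPart (a * x) * (if eqB x 0# then a else 1#)
    scale x with x ≟ 0#
    ... | yes refl = cong (_* a) (sym (cong (if_then 1# else (a * 0#)) (eqB-true⁺ (zeroʳ a))))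
    ... | no  x≢0  = begin
      x * a                       ≡⟨ *-comm x a ⟩
      a * x                       ≡⟨ cong (if_then 1# else (a * x)) (eqB-false⁺ (*-≢0 a≢0 x≢0)) ⟨
      nonzeroPart (a * x)         ≡⟨ *-identityʳ _ ⟨
      nonzeroPart (a * x) * 1#    ∎

  -- Subfields

  Sub : ℕ → Carrier → Set
  Sub k x = pow x (2 ^ k) ≡ x

  Sub-0# : ∀ k → Sub k 0#
  Sub-0# k = pow-0# (2 ^ k) {{ℕ.m^n≢0 2 k}}

  Sub-1# : ∀ k → Sub k 1#
  Sub-1# k = pow-1# (2 ^ k)

  Sub-+ : ∀ k {x y} → Sub k x → Sub k y → Sub k (x + y)
  Sub-+ k hx hy = trans (frobenius k _ _) (cong₂ _+_ hx hy)

  Sub-* : ∀ k {x y} → Sub k x → Sub k y → Sub k (x * y)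
  Sub-* k hx hy = trans (pow-distrib-* _ _ (2 ^ k)) (cong₂ _*_ hx hy)

  Sub-pow : ∀ k l {x} → Sub k x → Sub k (pow x l)
  Sub-pow k l hx = trans (pow-comm _ l (2 ^ k)) (cong (λ z → pow z l) hx)

  Sub-⁻¹ : ∀ k {x} → Sub k x → Sub k (x ⁻¹)
  Sub-⁻¹ k {x} hx with x ≟ 0#
  ... | yes refl = trans (cong (λ z → pow z (2 ^ k)) inv-zero) (trans (Sub-0# k) (sym inv-zero))
  ... | no  x≢0  = trans (pow-⁻¹ (2 ^ k) x≢0) (cong _⁻¹ hx)

  2^[2k]≡2^k*2^k : ∀ k → 2 ^ (2 ℕ.* k) ≡ 2 ^ k ℕ.* 2 ^ k
  2^[2k]≡2^k*2^k k = trans (cong (λ l → 2 ^ (k ℕ.+ l)) (ℕ.+-identityʳ k)) (ℕ.^-distribˡ-+-* 2 k k)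

  pow-2^[2k] : ∀ k x → pow x (2 ^ (2 ℕ.* k)) ≡ pow (pow x (2 ^ k)) (2 ^ k)
  pow-2^[2k] k x = trans (cong (pow x) (2^[2k]≡2^k*2^k k)) (pow-* x (2 ^ k) (2 ^ k))

  Sub-double : ∀ k {x} → Sub k x → Sub (2 ℕ.* k) x
  Sub-double k {x} hx = trans (pow-2^[2k] k x) (trans (cong (λ z → pow z (2 ^ k)) hx) hx)

  Sub-relTrace : ∀ k {x} → Sub (2 ℕ.* k) x → Sub k (x + pow x (2 ^ k))
  Sub-relTrace k {x} hx = begin
    pow (x + pow x (2 ^ k)) (2 ^ k)             ≡⟨ frobenius k _ _ ⟩
    pow x (2 ^ k) + pow (pow x (2 ^ k)) (2 ^ k) ≡⟨ cong (pow x (2 ^ k) +_) (trans (sym (pow-2^[2k] k x)) hx) ⟩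
    pow x (2 ^ k) + x                           ≡⟨ +-comm _ _ ⟩
    x + pow x (2 ^ k)                           ∎

  -- With q = 2^k, the polynomial X^q + X has at most q roots. Conversely, the relative trace x +
  -- x^q maps the q² elements of the larger field into this root set with fibres of at most q
  -- elements, so q² is at most q times the number of roots.
  card-inSub-half : ∀ k .{{_ : ℕ.NonZero k}} → card (inSub (2 ℕ.* k)) ≡ ℤ.+ (2 ^ (2 ℕ.* k)) → card (inSub k) ≡ ℤ.+ (2 ^ k)
  card-inSub-half k h = ℤ.≤-antisym upper lower
    where
    q = 2 ^ k
    instance
      q≢0 : ℕ.NonZero q
      q≢0 = ℕ.m^n≢0 2 k
    1<q : 1 ℕ.< q
    1<q = ℕ.^-monoʳ-< 2 (ℕ.s≤s (ℕ.s≤s ℕ.z≤n)) (ℕ.>-nonZero⁻¹ k)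
    X^q+X = addTerm 1# 1 (X^ q)
    len : length X^q+X ≡ q
    len = trans (length-addTerm 1# 1 (X^ q)) (length-replicate q)
    eval-X^q+X : ∀ x → eval X^q+X x ≡ x + pow x q
    eval-X^q+X x = trans (eval-addTerm 1# 1 (X^ q) x (subst (1 ℕ.<_) (sym (length-replicate q)) 1<q))
      (cong₂ _+_ (trans (*-identityˡ _) (pow-1 x)) (eval-X^ q x))
    upper : card (inSub k) ℤ.≤ ℤ.+ q
    upper = subst (λ l → card (inSub k) ℤ.≤ ℤ.+ l) len (card≤degree X^q+X (inSub k)
      (λ x hx → trans (eval-X^q+X x) (x≡y⇒x+y≡0 (sym (eqB-true⁻ hx)))))
    relTrace : Carrier → Carrier
    relTrace x = x + pow x q
    fibre≤q : ∀ y → fibre (inSub (2 ℕ.* k)) relTrace y ℤ.≤ ℤ.+ q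
    fibre≤q y = subst (λ l → fibre (inSub (2 ℕ.* k)) relTrace y ℤ.≤ ℤ.+ l)
      (trans (length-addTerm y 0 X^q+X) len)
      (fibre≤degree (addTerm y 0 X^q+X) (inSub (2 ℕ.* k)) relTrace y λ x _ h →
        trans (eval-addTerm y 0 X^q+X x (subst (0 ℕ.<_) (sym len) (ℕ.<-trans (ℕ.s≤s ℕ.z≤n) 1<q)))
          (trans (cong₂ _+_ (*-identityʳ y) (eval-X^q+X x)) (x≡y⇒x+y≡0 (sym h))))
    lower : ℤ.+ q ℤ.≤ card (inSub k)
    lower = ℤ.*-cancelˡ-≤-pos (ℤ.+ q) (card (inSub k)) (ℤ.+ q) {{ℤ.positive (ℤ.+<+ (ℕ.>-nonZero⁻¹ q))}}
      (subst₂ ℤ._≤_ (trans h (trans (cong ℤ.+_ (2^[2k]≡2^k*2^k k)) (ℤ.pos-* q q))) (∑-const (inSub k) (ℤ.+ q))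
        (subst (ℤ._≤ sumWhere (inSub k) (λ _ → ℤ.+ q))
          (sym (card-fibre relTrace (λ x hx → eqB-true⁺ (Sub-relTrace k (eqB-true⁻ hx)))))
          (sumList-mono elements (λ y _ → fibre≤q y))))

  -- Traces and additive characters

  tr-step : ∀ k x → tr (suc k) x ≡ tr k x + pow x (2 ^ k)
  tr-step k x = cong (λ l → tr k x + pow x (2 ^ l)) (ℕ.*-identityˡ k)

  tr-+ : ∀ k x y → tr k (x + y) ≡ tr k x + tr k y
  tr-+ zero    x y = sym (+-identityˡ 0#)
  tr-+ (suc k) x y = trans (cong₂ _+_ (tr-+ k x y) (frobenius (1 ℕ.* k) x y))
    (solve 4 (λ a b c d → (a :+ b) :+ (c :+ d) := (a :+ c) :+ (b :+ d)) refl _ _ _ _)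

  tr-0# : ∀ k → tr k 0# ≡ 0#
  tr-0# zero    = refl
  tr-0# (suc k) = trans (cong₂ _+_ (tr-0# k) (Sub-0# (1 ℕ.* k))) (+-identityˡ 0#)

  tr-square : ∀ k x → tr k (x * x) ≡ tr k x * tr k x
  tr-square zero    x = sym (zeroˡ 0#)
  tr-square (suc k) x = trans (cong₂ _+_ (tr-square k x) (pow-distrib-* x x (2 ^ (1 ℕ.* k))))
    (solve 2 (λ a b → a :* a :+ b :* b := (a :+ b) :* (a :+ b)) refl _ _)

  -- Squaring moves every summand of the trace one place up, so only the two end terms survive. The
  -- element x is arbitrary: later it lies outside the subfield, and then the end terms carry the
  -- information.
  tr-telescope : ∀ k x → tr k (x * x) ≡ tr k x + (pow x (2 ^ k) + x)
  tr-telescope zero    x = solve 1 (λ x → con false := con false :+ (x :* con true :+ x)) refl x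
  tr-telescope (suc k) x = begin
    tr (suc k) (x * x)                                      ≡⟨ tr-step k (x * x) ⟩
    tr k (x * x) + pow (x * x) (2 ^ k)
      ≡⟨ cong₂ _+_ (tr-telescope k x) (trans (pow-distrib-* x x (2 ^ k)) (sym (pow-2^suc x k))) ⟩
    (tr k x + (pow x (2 ^ k) + x)) + pow x (2 ^ suc k)
      ≡⟨ solve 4 (λ a b c d → (a :+ (b :+ c)) :+ d := (a :+ b) :+ (d :+ c)) refl _ _ _ _ ⟩
    (tr k x + pow x (2 ^ k)) + (pow x (2 ^ suc k) + x)      ≡⟨ cong (_+ (pow x (2 ^ suc k) + x)) (tr-step k x) ⟨
    tr (suc k) x + (pow x (2 ^ suc k) + x)                  ∎

  tr-square-Sub : ∀ k {x} → Sub k x → tr k (x * x) ≡ tr k x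
  tr-square-Sub k {x} hx = trans (tr-telescope k x) (trans (cong (tr k x +_) (x≡y⇒x+y≡0 hx)) (+-identityʳ _))

  tr-+-index : ∀ l k x → tr (l ℕ.+ k) x ≡ tr k x + tr l (pow x (2 ^ k))
  tr-+-index zero    k x = sym (+-identityʳ _)
  tr-+-index (suc l) k x = begin
    tr (suc l ℕ.+ k) x                                      ≡⟨ tr-step (l ℕ.+ k) x ⟩
    tr (l ℕ.+ k) x + pow x (2 ^ (l ℕ.+ k))
      ≡⟨ cong₂ _+_ (tr-+-index l k x)
           (trans (cong (pow x) (trans (ℕ.^-distribˡ-+-* 2 l k) (ℕ.*-comm (2 ^ l) (2 ^ k)))) (pow-* x (2 ^ k) (2 ^ l))) ⟩
    (tr k x + tr l (pow x (2 ^ k))) + pow (pow x (2 ^ k)) (2 ^ l) ≡⟨ +-assoc _ _ _ ⟩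
    tr k x + (tr l (pow x (2 ^ k)) + pow (pow x (2 ^ k)) (2 ^ l)) ≡⟨ cong (tr k x +_) (tr-step l _) ⟨
    tr k x + tr (suc l) (pow x (2 ^ k))                     ∎

  tr-double : ∀ k x → tr (2 ℕ.* k) x ≡ tr k (x + pow x (2 ^ k))
  tr-double k x = trans (cong (λ l → tr (k ℕ.+ l) x) (ℕ.+-identityʳ k))
    (trans (tr-+-index k k x) (sym (tr-+ k x _)))

  Bit : Carrier → Set
  Bit t = t ≡ 0# ⊎ t ≡ 1#

  -- The trace of an element of the subfield is idempotent.
  tr-Bit : ∀ k {x} → Sub k x → Bit (tr k x)
  tr-Bit k {x} hx with tr k x ≟ 0#
  ... | yes t≡0 = inj₁ t≡0
  ... | no  t≢0 = inj₂ (*-cancelˡ t≢0 (trans (trans (sym (tr-square k x)) (tr-square-Sub k hx)) (sym (*-identityʳ _))))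

  χ-0# : χ 0# ≡ 1ℤ
  χ-0# rewrite eqB-true⁺ {0#} refl = refl

  χ-1# : χ 1# ≡ -1ℤ
  χ-1# rewrite eqB-false⁺ {1#} {0#} 1≢0 = refl

  -- Every nonzero element is sent to -1 by χ, so multiplicativity is a statement about 0 and 1.
  χ-+ : ∀ {s t} → Bit s → Bit t → χ (s + t) ≡ χ s ℤ.* χ t
  χ-+ {s} {t} (inj₁ refl) _ = trans (cong χ (+-identityˡ t)) (sym (trans (cong (ℤ._* χ t) χ-0#) (ℤ.*-identityˡ _)))
  χ-+ {s} (inj₂ _) (inj₁ refl) = trans (cong χ (+-identityʳ s)) (sym (trans (cong (χ s ℤ.*_) χ-0#) (ℤ.*-identityʳ _)))
  χ-+ (inj₂ refl) (inj₂ refl) = trans (cong χ (x+x≡0 1#)) (trans χ-0# (sym (cong₂ ℤ._*_ χ-1# χ-1#)))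

  χtr-+ : ∀ k {x y} → Sub k x → Sub k y → χ (tr k (x + y)) ≡ χ (tr k x) ℤ.* χ (tr k y)
  χtr-+ k {x} {y} hx hy = trans (cong χ (tr-+ k x y)) (χ-+ (tr-Bit k hx) (tr-Bit k hy))

  χtr-0# : ∀ k → χ (tr k 0#) ≡ 1ℤ
  χtr-0# k = trans (cong χ (tr-0# k)) χ-0#

  -- The term X^(2^d) together with the j lowest terms of the trace polynomial; for j = d this is
  -- `tr (suc d)`, monic of degree 2^d.
  tracePoly : ℕ → ℕ → List Carrier
  tracePoly d zero    = X^ (2 ^ d)
  tracePoly d (suc j) = addTerm 1# (2 ^ j) (tracePoly d j)

  length-tracePoly : ∀ d j → length (tracePoly d j) ≡ 2 ^ d
  length-tracePoly d zero    = length-replicate (2 ^ d)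
  length-tracePoly d (suc j) = trans (length-addTerm 1# (2 ^ j) (tracePoly d j)) (length-tracePoly d j)

  eval-tracePoly : ∀ d j x → j ℕ.≤ d → eval (tracePoly d j) x ≡ tr j x + pow x (2 ^ d)
  eval-tracePoly d zero    x _   = trans (eval-X^ (2 ^ d) x) (sym (+-identityˡ _))
  eval-tracePoly d (suc j) x j<d = begin
    eval (tracePoly d (suc j)) x
      ≡⟨ eval-addTerm 1# (2 ^ j) (tracePoly d j) x
           (subst (2 ^ j ℕ.<_) (sym (length-tracePoly d j)) (ℕ.^-monoʳ-< 2 (ℕ.s≤s (ℕ.s≤s ℕ.z≤n)) j<d)) ⟩
    1# * pow x (2 ^ j) + eval (tracePoly d j) x
      ≡⟨ cong₂ _+_ (*-identityˡ _) (eval-tracePoly d j x (ℕ.<⇒≤ j<d)) ⟩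
    pow x (2 ^ j) + (tr j x + pow x (2 ^ d)) ≡⟨ solve 3 (λ a b c → a :+ (b :+ c) := (b :+ a) :+ c) refl _ _ _ ⟩
    (tr j x + pow x (2 ^ j)) + pow x (2 ^ d) ≡⟨ cong (_+ pow x (2 ^ d)) (tr-step j x) ⟨
    tr (suc j) x + pow x (2 ^ d)             ∎

  -- The trace polynomial has degree 2^(k-1), which is less than the 2^k elements available, so some
  -- trace is nonzero and hence 1.
  trace-one : ∀ k .{{_ : ℕ.NonZero k}} → card (inSub k) ≡ ℤ.+ (2 ^ k) → ∃[ θ ] Sub k θ × tr k θ ≡ 1#
  trace-one k@(suc l) card-k with nonroot (tracePoly l l) (inSub k)
    (subst₂ ℤ._<_ (cong ℤ.+_ (sym (length-tracePoly l l))) (sym card-k)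
      (ℤ.+<+ (ℕ.^-monoʳ-< 2 (ℕ.s≤s (ℕ.s≤s ℕ.z≤n)) (ℕ.n<1+n l))))
  ... | θ , hθ , tr≢0 with tr-Bit k (eqB-true⁻ hθ)
  ...   | inj₁ t≡0 = contradiction (trans (eval-tracePoly l l θ ℕ.≤-refl) (trans (sym (tr-step l θ)) t≡0)) tr≢0
  ...   | inj₂ t≡1 = θ , eqB-true⁻ hθ , t≡1

  -- Translation by c⁻¹θ, where θ has trace 1, flips the sign of every term, so the sum equals its
  -- own negative.
  ∑-χtr-orthogonal : ∀ k .{{_ : ℕ.NonZero k}} → card (inSub k) ≡ ℤ.+ (2 ^ k) →
    ∀ {c} → Sub k c → c ≢ 0# → sumWhere (inSub k) (λ x → χ (tr k (c * x))) ≡ 0ℤ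
  ∑-χtr-orthogonal k card-k {c} hc c≢0 with trace-one k card-k
  ... | θ , hθ , trθ = x≡-x⇒x≡0 _ (begin
    sumWhere (inSub k) (λ x → χ (tr k (c * x)))
      ≡⟨ ∑-reindex (_+ c ⁻¹ * θ) (λ x → χ (tr k (c * x))) (λ x hx → eqB-true⁺ (Sub-+ k (eqB-true⁻ hx) hs))
           (λ {x} {y} _ _ h → trans (cancel x) (trans (cong (_+ c ⁻¹ * θ) h) (sym (cancel y)))) ⟨
    sumWhere (inSub k) (λ x → χ (tr k (c * (x + c ⁻¹ * θ))))
      ≡⟨ ∑-cong (λ x hx → begin
           χ (tr k (c * (x + c ⁻¹ * θ)))      ≡⟨ cong (χ ∘ tr k) (shift x) ⟩
           χ (tr k (c * x + θ))               ≡⟨ χtr-+ k (Sub-* k hc (eqB-true⁻ hx)) hθ ⟩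
           χ (tr k (c * x)) ℤ.* χ (tr k θ)    ≡⟨ cong (χ (tr k (c * x)) ℤ.*_) (trans (cong χ trθ) χ-1#) ⟩
           χ (tr k (c * x)) ℤ.* -1ℤ           ≡⟨ ℤ.*-comm _ -1ℤ ⟩
           -1ℤ ℤ.* χ (tr k (c * x))           ∎) ⟩
    sumWhere (inSub k) (λ x → -1ℤ ℤ.* χ (tr k (c * x)))
      ≡⟨ sumList-*ˡ elements (inSub k) -1ℤ _ ⟩
    -1ℤ ℤ.* sumWhere (inSub k) (λ x → χ (tr k (c * x))) ∎)
    where
    hs : Sub k (c ⁻¹ * θ)
    hs = Sub-* k (Sub-⁻¹ k hc) hθ
    cancel : ∀ x → x ≡ (x + c ⁻¹ * θ) + c ⁻¹ * θ
    cancel x = solve 2 (λ x s → x := (x :+ s) :+ s) refl x _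
    shift : ∀ x → c * (x + c ⁻¹ * θ) ≡ c * x + θ
    shift x = trans (solve 4 (λ c x i θ → c :* (x :+ i :* θ) := c :* x :+ (c :* i) :* θ) refl c x (c ⁻¹) θ)
      (cong (c * x +_) (trans (cong (_* θ) (inverseʳ c c≢0)) (*-identityˡ θ)))
    x≡-x⇒x≡0 : ∀ z → z ≡ -1ℤ ℤ.* z → z ≡ 0ℤ
    x≡-x⇒x≡0 (ℤ.+ zero)   _ = refl
    x≡-x⇒x≡0 (ℤ.+ suc _)  ()
    x≡-x⇒x≡0 ℤ.-[1+ _ ] ()

-- The tower of fields with q, Q = q² and Q² elements

module Tower (m j : ℕ) .{{m≢0 : ℕ.NonZero m}} (2^m≡3j+2 : 2 ^ m ≡ 3 ℕ.* j ℕ.+ 2) (F : FiniteField2 (4 ℕ.* m)) where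
  open FiniteField2 F
  open FieldOps F
  open FiniteFieldTheory F
  open Solver using (solve; con; _:=_; _:+_; _:*_)

  -- r = (Q - 1)/3, the exponent of ψ_{m₁}
  m₁ q Q r : ℕ
  m₁ = 2 ℕ.* m
  q  = 2 ^ m
  Q  = 2 ^ m₁
  r  = (3 ℕ.* j ℕ.+ 1) ℕ.* (j ℕ.+ 1)

  q≡1+[3j+1] : q ≡ suc (3 ℕ.* j ℕ.+ 1)
  q≡1+[3j+1] = trans 2^m≡3j+2 (ℕ.+-suc (3 ℕ.* j) 1)

  Q≡1+3r : Q ≡ suc (3 ℕ.* r)
  Q≡1+3r = trans (2^[2k]≡2^k*2^k m) (trans (cong₂ ℕ._*_ 2^m≡3j+2 2^m≡3j+2) (expand j))
    where
    expand : ∀ j → (3 ℕ.* j ℕ.+ 2) ℕ.* (3 ℕ.* j ℕ.+ 2) ≡ suc (3 ℕ.* ((3 ℕ.* j ℕ.+ 1) ℕ.* (j ℕ.+ 1)))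
    expand = ℕ-Solver.solve-∀

  4m≡2[2m] : 4 ℕ.* m ≡ 2 ℕ.* m₁
  4m≡2[2m] = ℕ.*-assoc 2 2 m

  -- Integer counterparts of j and r. Writing q, Q and r as polynomials in the single variable J
  -- leaves the comparison of counts to the ring solver.
  J R : ℤ
  J = ℤ.+ j
  R = (ℤ.+ 3 ℤ.* J ℤ.+ 1ℤ) ℤ.* (J ℤ.+ 1ℤ)

  +r≡R : ℤ.+ r ≡ R
  +r≡R = trans (ℤ.pos-* (3 ℕ.* j ℕ.+ 1) (j ℕ.+ 1)) (cong₂ ℤ._*_ (cong (ℤ._+ 1ℤ) (ℤ.pos-* 3 j)) refl)

  +q≡3J+2 : ℤ.+ q ≡ ℤ.+ 3 ℤ.* J ℤ.+ ℤ.+ 2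
  +q≡3J+2 = trans (cong ℤ.+_ 2^m≡3j+2) (cong (ℤ._+ ℤ.+ 2) (ℤ.pos-* 3 j))

  +Q≡1+3R : ℤ.+ Q ≡ 1ℤ ℤ.+ ℤ.+ 3 ℤ.* R
  +Q≡1+3R = trans (cong ℤ.+_ Q≡1+3r) (cong (λ s → 1ℤ ℤ.+ s) (trans (ℤ.pos-* 3 r) (cong (ℤ.+ 3 ℤ.*_) +r≡R)))

  instance
    m₁≢0 : ℕ.NonZero m₁
    m₁≢0 = ℕ.m*n≢0 2 m

  G G* Fq Fq* : Carrier → Bool
  G   = inSub m₁
  G*  = G ∖ 0#
  Fq  = inSub m
  Fq* = Fq ∖ 0#

  fermat₂ : ∀ x → Sub (2 ℕ.* m₁) x
  fermat₂ x = subst (λ k → Sub k x) 4m≡2[2m] (fermat x)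

  card-G : card G ≡ ℤ.+ Q
  card-G = card-inSub-half m₁ (trans (sumList-1 elements (eqB-true⁺ ∘ fermat₂))
    (cong ℤ.+_ (trans elements-card (cong (2 ^_) 4m≡2[2m]))))

  card-Fq : card Fq ≡ ℤ.+ q
  card-Fq = card-inSub-half m card-G

  G*⁻ : ∀ {x} → G* x ≡ true → Sub m₁ x × x ≢ 0#
  G*⁻ h = eqB-true⁻ (proj₁ (∖⁻ G h)) , proj₂ (∖⁻ G h)

  G*⁺ : ∀ {x} → Sub m₁ x → x ≢ 0# → G* x ≡ true
  G*⁺ hx x≢0 = ∖⁺ G (eqB-true⁺ hx) x≢0

  G*-* : ∀ {x y} → G* x ≡ true → G* y ≡ true → G* (x * y) ≡ true
  G*-* hx hy = G*⁺ (Sub-* m₁ (proj₁ (G*⁻ hx)) (proj₁ (G*⁻ hy))) (*-≢0 (proj₂ (G*⁻ hx)) (proj₂ (G*⁻ hy)))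

  G*-⁻¹ : ∀ {x} → G* x ≡ true → G* (x ⁻¹) ≡ true
  G*-⁻¹ hx = G*⁺ (Sub-⁻¹ m₁ (proj₁ (G*⁻ hx))) (⁻¹-≢0 (proj₂ (G*⁻ hx)))

  Fq*⇒G* : ∀ {x} → Fq* x ≡ true → G* x ≡ true
  Fq*⇒G* h = G*⁺ (Sub-double m (eqB-true⁻ (proj₁ (∖⁻ Fq h)))) (proj₂ (∖⁻ Fq h))

  ∑G≡f0+∑G* : ∀ f → sumWhere G f ≡ f 0# ℤ.+ sumWhere G* f
  ∑G≡f0+∑G* f = ∑-split f (eqB-true⁺ (Sub-0# m₁))

  card-G* : card G* ≡ ℤ.+ 3 ℤ.* R
  card-G* = ℤ+-cancelˡ 1ℤ _ _ (trans (sym (∑G≡f0+∑G* (λ _ → 1ℤ))) (trans card-G +Q≡1+3R))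

  card-Fq* : card Fq* ≡ ℤ.+ 3 ℤ.* J ℤ.+ 1ℤ
  card-Fq* = ℤ+-cancelˡ 1ℤ _ _ (trans (sym (∑-split {Fq} (λ _ → 1ℤ) (eqB-true⁺ (Sub-0# m))))
    (trans card-Fq (trans +q≡3J+2 (shift J))))
    where
    shift : ∀ J → ℤ.+ 3 ℤ.* J ℤ.+ ℤ.+ 2 ≡ ℤ.+ 1 ℤ.+ (ℤ.+ 3 ℤ.* J ℤ.+ ℤ.+ 1)
    shift = solve-∀

  ∑G*-scale : ∀ {c} (h : Carrier → ℤ) → G* c ≡ true → sumWhere G* (λ x → h (c * x)) ≡ sumWhere G* h
  ∑G*-scale {c} h hc = ∑-reindex (c *_) h (λ x hx → G*-* hc hx) (λ _ _ → *-cancelˡ (proj₂ (G*⁻ hc)))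

  ∑G*-⁻¹ : ∀ (h : Carrier → ℤ) → sumWhere G* (λ x → h (x ⁻¹)) ≡ sumWhere G* h
  ∑G*-⁻¹ h = ∑-reindex _⁻¹ h (λ x → G*-⁻¹) (λ {x} {y} hx hy eq →
    trans (sym (⁻¹-involutive (proj₂ (G*⁻ hx)))) (trans (cong _⁻¹ eq) (⁻¹-involutive (proj₂ (G*⁻ hy)))))

  ∑G*-square : ∀ (h : Carrier → ℤ) → sumWhere G* (λ x → h (x * x)) ≡ sumWhere G* h
  ∑G*-square h = ∑-reindex (λ x → x * x) h (λ x hx → G*-* hx hx) (λ _ _ → x²≡y²⇒x≡y)

  e : Carrier → ℤ
  e x = χ (tr m₁ x)

  e-0 : e 0# ≡ 1ℤ
  e-0 = χtr-0# m₁

  e-+ : ∀ {x y} → Sub m₁ x → Sub m₁ y → e (x + y) ≡ e x ℤ.* e y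
  e-+ = χtr-+ m₁

  e-square : ∀ {x} → Sub m₁ x → e (x * x) ≡ e x
  e-square hx = cong χ (tr-square-Sub m₁ hx)

  ∑G*-e : ∀ {c} → G* c ≡ true → sumWhere G* (λ x → e (c * x)) ≡ -1ℤ
  ∑G*-e {c} hc = ℤ+-cancelˡ 1ℤ _ _ (begin
    1ℤ ℤ.+ sumWhere G* (λ x → e (c * x))         ≡⟨ cong (ℤ._+ sumWhere G* (λ x → e (c * x))) (trans (cong e (zeroʳ c)) e-0) ⟨
    e (c * 0#) ℤ.+ sumWhere G* (λ x → e (c * x)) ≡⟨ ∑G≡f0+∑G* (λ x → e (c * x)) ⟨
    sumWhere G (λ x → e (c * x))                 ≡⟨ ∑-χtr-orthogonal m₁ card-G (proj₁ (G*⁻ hc)) (proj₂ (G*⁻ hc)) ⟩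
    0ℤ                                           ∎)

  -- The cubic character

  κ : Carrier → Carrier
  κ x = pow x r

  κ-* : ∀ x y → κ (x * y) ≡ κ x * κ y
  κ-* x y = pow-distrib-* x y r

  Cubic : Carrier → Set
  Cubic z = z * (z * z) ≡ 1#

  Cubic-≢0 : ∀ {z} → Cubic z → z ≢ 0#
  Cubic-≢0 = xy≡1⇒x≢0

  Cubic-* : ∀ {x y} → Cubic x → Cubic y → Cubic (x * y)
  Cubic-* {x} {y} hx hy = begin
    x * y * (x * y * (x * y))     ≡⟨ solve 2 (λ x y → x :* y :* (x :* y :* (x :* y)) := (x :* (x :* x)) :* (y :* (y :* y))) refl x y ⟩
    x * (x * x) * (y * (y * y))   ≡⟨ cong₂ _*_ hx hy ⟩
    1# * 1#                       ≡⟨ *-identityˡ 1# ⟩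
    1#                            ∎

  Cubic-κ : ∀ {x} → G* x ≡ true → Cubic (κ x)
  Cubic-κ {x} hx = begin
    κ x * (κ x * κ x)          ≡⟨ cong (λ z → κ x * (κ x * z)) (*-identityʳ (κ x)) ⟨
    pow (pow x r) 3            ≡⟨ pow-comm x r 3 ⟩
    pow (pow x 3) r            ≡⟨ pow-* x 3 r ⟨
    pow x (3 ℕ.* r)            ≡⟨ *-cancelˡ (proj₂ (G*⁻ hx)) (begin
      x * pow x (3 ℕ.* r)        ≡⟨ cong (pow x) Q≡1+3r ⟨
      pow x Q                    ≡⟨ proj₁ (G*⁻ hx) ⟩
      x                          ≡⟨ *-identityʳ x ⟨
      x * 1#                     ∎) ⟩
    1#                         ∎

  -- The exponent is r = (q - 1)(q + 1)/3 with q - 1 = 3j + 1 and (q + 1)/3 = j + 1.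
  κ-Fq* : ∀ {y} → Fq* y ≡ true → κ y ≡ 1#
  κ-Fq* {y} hy = begin
    pow y r                                ≡⟨ pow-* y (3 ℕ.* j ℕ.+ 1) (j ℕ.+ 1) ⟩
    pow (pow y (3 ℕ.* j ℕ.+ 1)) (j ℕ.+ 1)  ≡⟨ cong (λ z → pow z (j ℕ.+ 1)) (*-cancelˡ (proj₂ (∖⁻ Fq hy)) (begin
      y * pow y (3 ℕ.* j ℕ.+ 1)              ≡⟨ cong (pow y) q≡1+[3j+1] ⟨
      pow y q                                ≡⟨ eqB-true⁻ (proj₁ (∖⁻ Fq hy)) ⟩
      y                                      ≡⟨ *-identityʳ y ⟨
      y * 1#                                 ∎)) ⟩
    pow 1# (j ℕ.+ 1)                       ≡⟨ pow-1# (j ℕ.+ 1) ⟩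
    1#                                     ∎

  r≡1+ : ∃[ k ] r ≡ suc k
  r≡1+ = 3 ℕ.* j ℕ.* j ℕ.+ 4 ℕ.* j , expand j
    where
    expand : ∀ j → (3 ℕ.* j ℕ.+ 1) ℕ.* (j ℕ.+ 1) ≡ suc (3 ℕ.* j ℕ.* j ℕ.+ 4 ℕ.* j)
    expand = ℕ-Solver.solve-∀

  abstract
    -- At most r of the 3r elements of `G*` are roots of X^r + 1. Only the two stated properties
    -- matter, so the exhaustive search that finds v is sealed off.
    nonresidue : ∃[ v ] G* v ≡ true × κ v ≢ 1#
    nonresidue with nonroot (X^ r ⊹ 1#) G* (subst₂ ℤ._<_ (cong ℤ.+_ (sym (length-X^⊹ r 1#))) (sym card≡) (ℤ.+<+ r<3r))
      where
      card≡ : card G* ≡ ℤ.+ (3 ℕ.* r)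
      card≡ = trans card-G* (sym (trans (ℤ.pos-* 3 r) (cong (ℤ.+ 3 ℤ.*_) +r≡R)))
      r<3r : r ℕ.< 3 ℕ.* r
      r<3r = subst (λ r → r ℕ.< 3 ℕ.* r) (sym (proj₂ r≡1+)) (ℕ.m<m+n (suc (proj₁ r≡1+)) (ℕ.s≤s ℕ.z≤n))
    ... | v , hv , nonroot-v = v , hv , nonroot-v ∘ X^⊹-root (subst (0 ℕ.<_) (sym (proj₂ r≡1+)) (ℕ.s≤s ℕ.z≤n))

  v₀ : Carrier
  v₀ = proj₁ nonresidue

  v₀∈G* : G* v₀ ≡ true
  v₀∈G* = proj₁ (proj₂ nonresidue)

  -- A primitive cube root of unity. Being a value of κ, it makes multiplication by `v₀` permute the
  -- three classes cyclically.
  ω₃ : Carrier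
  ω₃ = κ v₀

  ω₃≢1 : ω₃ ≢ 1#
  ω₃≢1 = proj₂ (proj₂ nonresidue)

  Cubic-ω₃ : Cubic ω₃
  Cubic-ω₃ = Cubic-κ v₀∈G*

  ω₃+ω₃²≡1 : ω₃ + ω₃ * ω₃ ≡ 1#
  ω₃+ω₃²≡1 = x+y≡0⇒x≡y (xy≡0⇒y≡0 {ω₃ + 1#} (λ h → ω₃≢1 (x+y≡0⇒x≡y h)) (begin
    (ω₃ + 1#) * (ω₃ + ω₃ * ω₃ + 1#)
      ≡⟨ solve 1 (λ w → (w :+ con true) :* (w :+ w :* w :+ con true) := w :* (w :* w) :+ con true) refl ω₃ ⟩
    ω₃ * (ω₃ * ω₃) + 1# ≡⟨ x≡y⇒x+y≡0 Cubic-ω₃ ⟩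
    0#                  ∎))

  Cubic⇒1∨ω₃∨ω₃² : ∀ {z} → Cubic z → z ≡ 1# ⊎ z ≡ ω₃ ⊎ z ≡ ω₃ * ω₃
  Cubic⇒1∨ω₃∨ω₃² {z} hz with z ≟ 1# | z ≟ ω₃
  ... | yes z≡1 | _       = inj₁ z≡1
  ... | no  _   | yes z≡ω = inj₂ (inj₁ z≡ω)
  ... | no  z≢1 | no  z≢ω = inj₂ (inj₂ (x+y≡0⇒x≡y (xy≡0⇒y≡0 (λ h → z≢ω (x+y≡0⇒x≡y h))
    (xy≡0⇒y≡0 {z + 1#} (λ h → z≢1 (x+y≡0⇒x≡y h)) (begin
      (z + 1#) * ((z + ω₃) * (z + ω₃ * ω₃))
        ≡⟨ solve 2 (λ z w → (z :+ con true) :* ((z :+ w) :* (z :+ w :* w))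
             := (z :+ con true) :* (z :* z :+ z :* (w :+ w :* w) :+ w :* (w :* w))) refl z ω₃ ⟩
      (z + 1#) * (z * z + z * (ω₃ + ω₃ * ω₃) + ω₃ * (ω₃ * ω₃))
        ≡⟨ cong₂ (λ s t → (z + 1#) * (z * z + z * s + t)) ω₃+ω₃²≡1 Cubic-ω₃ ⟩
      (z + 1#) * (z * z + z * 1# + 1#)
        ≡⟨ solve 1 (λ z → (z :+ con true) :* (z :* z :+ z :* con true :+ con true) := z :* (z :* z) :+ con true) refl z ⟩
      z * (z * z) + 1# ≡⟨ x≡y⇒x+y≡0 hz ⟩
      0# ∎)))))

  ω₃²≢1 : ω₃ * ω₃ ≢ 1#
  ω₃²≢1 h = ω₃≢1 (x²≡y²⇒x≡y (trans h (sym (*-identityˡ 1#))))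

  -- For a cube root of unity γ, the inverse is γ².
  Cubic-divide : ∀ {x γ w} → Cubic γ → x * (γ * γ) ≡ w → x ≡ γ * w
  Cubic-divide {x} {γ} {w} hγ h = begin
    x                 ≡⟨ *-identityˡ x ⟨
    1# * x            ≡⟨ cong (_* x) hγ ⟨
    γ * (γ * γ) * x   ≡⟨ solve 2 (λ x g → g :* (g :* g) :* x := g :* (x :* (g :* g))) refl x γ ⟩
    γ * (x * (γ * γ)) ≡⟨ cong (γ *_) h ⟩
    γ * w             ∎

  Cubic-cosets : ∀ {x γ} → Cubic x → Cubic γ → x ≡ γ ⊎ x ≡ γ * ω₃ ⊎ x ≡ γ * (ω₃ * ω₃)
  Cubic-cosets {x} {γ} hx hγ with Cubic⇒1∨ω₃∨ω₃² (Cubic-* hx (Cubic-* hγ hγ))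
  ... | inj₁ h        = inj₁ (trans (Cubic-divide hγ h) (*-identityʳ γ))
  ... | inj₂ (inj₁ h) = inj₂ (inj₁ (Cubic-divide hγ h))
  ... | inj₂ (inj₂ h) = inj₂ (inj₂ (Cubic-divide hγ h))

  ∑δ-cosets : ∀ {x γ} → Cubic x → Cubic γ → δ x γ ℤ.+ δ x (γ * ω₃) ℤ.+ δ x (γ * (ω₃ * ω₃)) ≡ 1ℤ
  ∑δ-cosets {x} {γ} hx hγ with Cubic-cosets hx hγ
  ... | inj₁ refl        = cong₂ ℤ._+_ (cong₂ ℤ._+_ (δ-≡ {γ} refl) (δ-≢ γ≢γω)) (δ-≢ γ≢γω²)
    where
    γ≢γω : γ ≢ γ * ω₃
    γ≢γω h = ω₃≢1 (sym (*-cancelˡ (Cubic-≢0 hγ) (trans (*-identityʳ γ) h)))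
    γ≢γω² : γ ≢ γ * (ω₃ * ω₃)
    γ≢γω² h = ω₃²≢1 (sym (*-cancelˡ (Cubic-≢0 hγ) (trans (*-identityʳ γ) h)))
  ... | inj₂ (inj₁ refl) = cong₂ ℤ._+_ (cong₂ ℤ._+_ (δ-≢ γω≢γ) (δ-≡ {γ * ω₃} refl)) (δ-≢ γω≢γω²)
    where
    γω≢γ : γ * ω₃ ≢ γ
    γω≢γ h = ω₃≢1 (*-cancelˡ (Cubic-≢0 hγ) (trans h (sym (*-identityʳ γ))))
    γω≢γω² : γ * ω₃ ≢ γ * (ω₃ * ω₃)
    γω≢γω² h = ω₃≢1 (sym (*-cancelˡ (Cubic-≢0 Cubic-ω₃) (trans (*-identityʳ ω₃) (*-cancelˡ (Cubic-≢0 hγ) h))))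
  ... | inj₂ (inj₂ refl) = cong₂ ℤ._+_ (cong₂ ℤ._+_ (δ-≢ γω²≢γ) (δ-≢ γω²≢γω)) (δ-≡ {γ * (ω₃ * ω₃)} refl)
    where
    γω²≢γ : γ * (ω₃ * ω₃) ≢ γ
    γω²≢γ h = ω₃²≢1 (*-cancelˡ (Cubic-≢0 hγ) (trans h (sym (*-identityʳ γ))))
    γω²≢γω : γ * (ω₃ * ω₃) ≢ γ * ω₃
    γω²≢γω h = ω₃≢1 (*-cancelˡ (Cubic-≢0 Cubic-ω₃) (trans (*-cancelˡ (Cubic-≢0 hγ) h) (sym (*-identityʳ ω₃))))

  -- The class κ(v) = γ is cut out by a factor and not by a predicate, so every such sum runs over
  -- `G*` and the substitutions on `G*` apply unchanged.
  ∑ᶜ : Carrier → (Carrier → ℤ) → ℤ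
  ∑ᶜ γ f = sumWhere G* (λ v → δ (κ v) γ ℤ.* f v)

  ∑ᶜ-cosets : ∀ {γ} f → Cubic γ → ∑ᶜ γ f ℤ.+ ∑ᶜ (γ * ω₃) f ℤ.+ ∑ᶜ (γ * (ω₃ * ω₃)) f ≡ sumWhere G* f
  ∑ᶜ-cosets {γ} f hγ = begin
    ∑ᶜ γ f ℤ.+ ∑ᶜ (γ * ω₃) f ℤ.+ ∑ᶜ (γ * (ω₃ * ω₃)) f
      ≡⟨ cong (ℤ._+ ∑ᶜ (γ * (ω₃ * ω₃)) f) (sumList-+ elements G* _ _) ⟨
    sumWhere G* (λ v → δ (κ v) γ ℤ.* f v ℤ.+ δ (κ v) (γ * ω₃) ℤ.* f v) ℤ.+ ∑ᶜ (γ * (ω₃ * ω₃)) f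
      ≡⟨ sumList-+ elements G* _ _ ⟨
    sumWhere G* (λ v → δ (κ v) γ ℤ.* f v ℤ.+ δ (κ v) (γ * ω₃) ℤ.* f v ℤ.+ δ (κ v) (γ * (ω₃ * ω₃)) ℤ.* f v)
      ≡⟨ ∑-cong (λ v hv → trans (factor (δ (κ v) γ) (δ (κ v) (γ * ω₃)) (δ (κ v) (γ * (ω₃ * ω₃))) (f v))
           (trans (cong (ℤ._* f v) (∑δ-cosets (Cubic-κ hv) hγ)) (ℤ.*-identityˡ (f v)))) ⟩
    sumWhere G* f ∎
    where
    factor : ∀ a b c z → a ℤ.* z ℤ.+ b ℤ.* z ℤ.+ c ℤ.* z ≡ (a ℤ.+ b ℤ.+ c) ℤ.* z
    factor = solve-∀

  -- Multiplication by `v₀` carries the class of γ to that of γω₃, so the three classes share the 3R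
  -- elements of `G*` equally.
  card-∑ᶜ : ∀ {γ} → Cubic γ → ∑ᶜ γ (λ _ → 1ℤ) ≡ R
  card-∑ᶜ {γ} hγ = ℤ.*-cancelˡ-≡ (ℤ.+ 3) _ _ (begin
    ℤ.+ 3 ℤ.* N γ                                     ≡⟨ triple (N γ) ⟩
    N γ ℤ.+ N γ ℤ.+ N γ
      ≡⟨ cong₂ (λ s t → N γ ℤ.+ s ℤ.+ t) (shift γ) (trans (shift γ) (trans (shift (γ * ω₃)) (cong N (*-assoc γ ω₃ ω₃)))) ⟩
    N γ ℤ.+ N (γ * ω₃) ℤ.+ N (γ * (ω₃ * ω₃))          ≡⟨ ∑ᶜ-cosets _ hγ ⟩
    card G*                                           ≡⟨ card-G* ⟩
    ℤ.+ 3 ℤ.* R                                       ∎)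
    where
    N : Carrier → ℤ
    N γ = ∑ᶜ γ (λ _ → 1ℤ)
    triple : ∀ a → ℤ.+ 3 ℤ.* a ≡ a ℤ.+ a ℤ.+ a
    triple = solve-∀
    shift : ∀ γ → N γ ≡ N (γ * ω₃)
    shift γ = begin
      N γ ≡⟨ ∑-cong (λ v _ → cong (ℤ._* 1ℤ) (δ-cong
               (λ h → trans (κ-* v₀ v) (trans (cong (ω₃ *_) h) (*-comm ω₃ γ)))
               (λ h → *-cancelˡ (Cubic-≢0 Cubic-ω₃) (trans (sym (κ-* v₀ v)) (trans h (*-comm γ ω₃)))))) ⟩
      sumWhere G* (λ v → δ (κ (v₀ * v)) (γ * ω₃) ℤ.* 1ℤ)
        ≡⟨ ∑G*-scale (λ v → δ (κ v) (γ * ω₃) ℤ.* 1ℤ) v₀∈G* ⟩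
      N (γ * ω₃) ∎

  -- Linear character sums over a class of the cubic character

  -- By transitivity of the trace, e(zy) is the character of 𝔽_q evaluated at (z + z^q) y, which is
  -- trivial exactly when z lies in 𝔽_q. The -1 removes y = 0.
  ∑Fq*-e : ∀ {z} → Sub m₁ z → sumWhere Fq* (λ y → e (z * y)) ≡ ℤ.+ q ℤ.* ⟦ Fq z ⟧ ℤ.- 1ℤ
  ∑Fq*-e {z} hz = begin
    sumWhere Fq* (λ y → e (z * y))                                ≡⟨ subtract _ ⟩
    1ℤ ℤ.+ sumWhere Fq* (λ y → e (z * y)) ℤ.- 1ℤ
      ≡⟨ cong (λ s → s ℤ.+ sumWhere Fq* (λ y → e (z * y)) ℤ.- 1ℤ) (trans (cong e (zeroʳ z)) e-0) ⟨
    e (z * 0#) ℤ.+ sumWhere Fq* (λ y → e (z * y)) ℤ.- 1ℤ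
      ≡⟨ cong (ℤ._- 1ℤ) (∑-split (λ y → e (z * y)) (eqB-true⁺ (Sub-0# m))) ⟨
    sumWhere Fq (λ y → e (z * y)) ℤ.- 1ℤ                          ≡⟨ cong (ℤ._- 1ℤ) ∑Fq-e ⟩
    ℤ.+ q ℤ.* ⟦ Fq z ⟧ ℤ.- 1ℤ                                     ∎
    where
    subtract : ∀ a → a ≡ ℤ.+ 1 ℤ.+ a ℤ.- ℤ.+ 1
    subtract = solve-∀
    s = z + pow z q
    relTrace : ∀ y → Sub m y → e (z * y) ≡ χ (tr m (s * y))
    relTrace y hy = cong χ (trans (tr-double m (z * y)) (cong (tr m)
      (trans (cong (z * y +_) (trans (pow-distrib-* z y q) (cong (pow z q *_) hy))) (sym (distribʳ y z (pow z q))))))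
    ∑Fq-e : sumWhere Fq (λ y → e (z * y)) ≡ ℤ.+ q ℤ.* ⟦ Fq z ⟧
    ∑Fq-e with pow z q ≟ z
    ... | yes z∈Fq = begin
      sumWhere Fq (λ y → e (z * y)) ≡⟨ ∑-cong (λ y hy → trans (relTrace y (eqB-true⁻ hy))
           (trans (cong (λ s → χ (tr m (s * y))) (x≡y⇒x+y≡0 (sym z∈Fq))) (trans (cong (χ ∘ tr m) (zeroˡ y)) (χtr-0# m)))) ⟩
      card Fq                       ≡⟨ card-Fq ⟩
      ℤ.+ q                         ≡⟨ ℤ.*-identityʳ (ℤ.+ q) ⟨
      ℤ.+ q ℤ.* 1ℤ                  ∎
    ... | no  z∉Fq = begin
      sumWhere Fq (λ y → e (z * y))             ≡⟨ ∑-cong (λ y hy → relTrace y (eqB-true⁻ hy)) ⟩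
      sumWhere Fq (λ y → χ (tr m (s * y)))      ≡⟨ ∑-χtr-orthogonal m card-Fq (Sub-relTrace m hz) (λ h → z∉Fq (sym (x+y≡0⇒x≡y h))) ⟩
      0ℤ                                        ≡⟨ ℤ.*-zeroʳ (ℤ.+ q) ⟨
      ℤ.+ q ℤ.* 0ℤ                              ∎

  -- After v is replaced by v/a, the sum counts the elements of 𝔽_q^* in the class γκ(a). All of
  -- them have κ = 1, so the count is q - 1 or 0.
  ∑ᶜ-Fq : ∀ {a γ} → G* a ≡ true → ∑ᶜ γ (λ v → ⟦ Fq (a * v) ⟧) ≡ δ (γ * κ a) 1# ℤ.* (ℤ.+ 3 ℤ.* J ℤ.+ 1ℤ)
  ∑ᶜ-Fq {a} {γ} ha = begin
    sumWhere G* (λ v → δ (κ v) γ ℤ.* ⟦ Fq (a * v) ⟧)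
      ≡⟨ ∑-cong (λ v _ → cong (ℤ._* ⟦ Fq (a * v) ⟧) (δ-cong
           (λ h → trans (κ-* a v) (trans (cong (κ a *_) h) (*-comm (κ a) γ)))
           (λ h → *-cancelˡ (Cubic-≢0 (Cubic-κ ha)) (trans (sym (κ-* a v)) (trans h (*-comm γ (κ a))))))) ⟩
    sumWhere G* (λ v → δ (κ (a * v)) (γ * κ a) ℤ.* ⟦ Fq (a * v) ⟧)
      ≡⟨ ∑G*-scale (λ v → δ (κ v) (γ * κ a) ℤ.* ⟦ Fq v ⟧) ha ⟩
    sumWhere G* (λ v → δ (κ v) (γ * κ a) ℤ.* ⟦ Fq v ⟧)
      ≡⟨ ∑-cong (λ v hv → constant v (proj₂ (G*⁻ hv))) ⟩
    sumWhere G* (λ v → δ (γ * κ a) 1# ℤ.* (⟦ Fq v ⟧ ℤ.* 1ℤ))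
      ≡⟨ sumList-*ˡ elements G* (δ (γ * κ a) 1#) _ ⟩
    δ (γ * κ a) 1# ℤ.* sumWhere G* (λ v → ⟦ Fq v ⟧ ℤ.* 1ℤ)
      ≡⟨ cong (δ (γ * κ a) 1# ℤ.*_) (trans (sumList-⟦⟧ elements G* Fq (λ _ → 1ℤ))
           (trans (sumList-cong-pred elements _ same) card-Fq*)) ⟩
    δ (γ * κ a) 1# ℤ.* (ℤ.+ 3 ℤ.* J ℤ.+ 1ℤ) ∎
    where
    constant : ∀ v → v ≢ 0# → δ (κ v) (γ * κ a) ℤ.* ⟦ Fq v ⟧ ≡ δ (γ * κ a) 1# ℤ.* (⟦ Fq v ⟧ ℤ.* 1ℤ)
    constant v v≢0 with Fq v in hv
    ... | true  = cong (ℤ._* 1ℤ) (trans (cong (λ z → δ z (γ * κ a)) (κ-Fq* (∖⁺ Fq hv v≢0))) (δ-cong sym sym))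
    ... | false = trans (ℤ.*-zeroʳ (δ (κ v) (γ * κ a))) (sym (ℤ.*-zeroʳ (δ (γ * κ a) 1#)))
    same : ∀ x → (G* x ∧ Fq x) ≡ Fq* x
    same x = Bool-ext
      (λ h → ∖⁺ Fq (proj₂ (∧-true⁻ h)) (proj₂ (G*⁻ (proj₁ (∧-true⁻ h)))))
      (λ h → ∧-true⁺ (Fq*⇒G* h) (proj₁ (∖⁻ Fq h)))

  -- Classes of κ are stable under 𝔽_q^*, so the sum may be averaged over 𝔽_q^*.
  3∑ᶜ-linear : ∀ {a γ} → G* a ≡ true → Cubic γ →
    ℤ.+ 3 ℤ.* ∑ᶜ γ (λ v → e (a * v)) ≡ ℤ.+ 3 ℤ.* ℤ.+ q ℤ.* δ (γ * κ a) 1# ℤ.- ℤ.+ q ℤ.- 1ℤ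
  3∑ᶜ-linear {a} {γ} ha hγ = ℤ.*-cancelˡ-≡ N _ _ {{N≢0}} (begin
    N ℤ.* (ℤ.+ 3 ℤ.* A)                       ≡⟨ assemble₁ N A ⟩
    ℤ.+ 3 ℤ.* (A ℤ.* N)                       ≡⟨ cong (λ z → ℤ.+ 3 ℤ.* (A ℤ.* z)) card-Fq* ⟨
    ℤ.+ 3 ℤ.* (A ℤ.* card Fq*)                ≡⟨ cong (ℤ.+ 3 ℤ.*_) averaged ⟩
    ℤ.+ 3 ℤ.* (ℤ.+ q ℤ.* (D ℤ.* N) ℤ.- R)     ≡⟨ cong (λ z → ℤ.+ 3 ℤ.* (z ℤ.* (D ℤ.* N) ℤ.- R)) +q≡3J+2 ⟩
    ℤ.+ 3 ℤ.* ((ℤ.+ 3 ℤ.* J ℤ.+ ℤ.+ 2) ℤ.* (D ℤ.* N) ℤ.- R) ≡⟨ assemble₂ J D ⟩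
    N ℤ.* (ℤ.+ 3 ℤ.* (ℤ.+ 3 ℤ.* J ℤ.+ ℤ.+ 2) ℤ.* D ℤ.- (ℤ.+ 3 ℤ.* J ℤ.+ ℤ.+ 2) ℤ.- 1ℤ)
      ≡⟨ cong (λ z → N ℤ.* (ℤ.+ 3 ℤ.* z ℤ.* D ℤ.- z ℤ.- 1ℤ)) +q≡3J+2 ⟨
    N ℤ.* (ℤ.+ 3 ℤ.* ℤ.+ q ℤ.* D ℤ.- ℤ.+ q ℤ.- 1ℤ) ∎)
    where
    A N D : ℤ
    A = ∑ᶜ γ (λ v → e (a * v))
    N = ℤ.+ 3 ℤ.* J ℤ.+ 1ℤ
    D = δ (γ * κ a) 1#
    N≢0 : ℤ.NonZero N
    N≢0 = subst ℤ.NonZero (trans (cong ℤ.+_ (sym (ℕ.+-comm (3 ℕ.* j) 1))) (cong (ℤ._+ 1ℤ) (ℤ.pos-* 3 j))) _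
    assemble₁ : ∀ N A → N ℤ.* (ℤ.+ 3 ℤ.* A) ≡ ℤ.+ 3 ℤ.* (A ℤ.* N)
    assemble₁ = solve-∀
    assemble₂ : ∀ J D →
      ℤ.+ 3 ℤ.* ((ℤ.+ 3 ℤ.* J ℤ.+ ℤ.+ 2) ℤ.* (D ℤ.* (ℤ.+ 3 ℤ.* J ℤ.+ ℤ.+ 1)) ℤ.- (ℤ.+ 3 ℤ.* J ℤ.+ ℤ.+ 1) ℤ.* (J ℤ.+ ℤ.+ 1))
      ≡ (ℤ.+ 3 ℤ.* J ℤ.+ ℤ.+ 1) ℤ.* (ℤ.+ 3 ℤ.* (ℤ.+ 3 ℤ.* J ℤ.+ ℤ.+ 2) ℤ.* D ℤ.- (ℤ.+ 3 ℤ.* J ℤ.+ ℤ.+ 2) ℤ.- ℤ.+ 1)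
    assemble₂ = solve-∀
    averaged : A ℤ.* card Fq* ≡ ℤ.+ q ℤ.* (D ℤ.* N) ℤ.- R
    averaged = begin
      A ℤ.* card Fq*                                                        ≡⟨ ∑-const Fq* A ⟨
      sumWhere Fq* (λ y → A)                                                ≡⟨ ∑-cong (λ y hy → begin
        A ≡⟨ ∑G*-scale (λ v → δ (κ v) γ ℤ.* e (a * v)) (Fq*⇒G* hy) ⟨
        sumWhere G* (λ v → δ (κ (y * v)) γ ℤ.* e (a * (y * v)))
          ≡⟨ ∑-cong (λ v _ → cong₂ (λ s t → δ s γ ℤ.* e t)
               (trans (κ-* y v) (trans (cong (_* κ v) (κ-Fq* hy)) (*-identityˡ _)))
               (solve 3 (λ a y v → a :* (y :* v) := a :* v :* y) refl a y v)) ⟩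
        sumWhere G* (λ v → δ (κ v) γ ℤ.* e (a * v * y)) ∎) ⟩
      sumWhere Fq* (λ y → sumWhere G* (λ v → δ (κ v) γ ℤ.* e (a * v * y)))  ≡⟨ sumList-swap elements elements Fq* G* (λ y v → δ (κ v) γ ℤ.* e (a * v * y)) ⟩
      sumWhere G* (λ v → sumWhere Fq* (λ y → δ (κ v) γ ℤ.* e (a * v * y)))  ≡⟨ ∑-cong (λ v hv → begin
        sumWhere Fq* (λ y → δ (κ v) γ ℤ.* e (a * v * y)) ≡⟨ sumList-*ˡ elements Fq* (δ (κ v) γ) _ ⟩
        δ (κ v) γ ℤ.* sumWhere Fq* (λ y → e (a * v * y))
          ≡⟨ cong (δ (κ v) γ ℤ.*_) (∑Fq*-e (proj₁ (G*⁻ (G*-* ha hv)))) ⟩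
        δ (κ v) γ ℤ.* (ℤ.+ q ℤ.* ⟦ Fq (a * v) ⟧ ℤ.- 1ℤ)
          ≡⟨ distribute (δ (κ v) γ) (ℤ.+ q) ⟦ Fq (a * v) ⟧ ⟩
        ℤ.+ q ℤ.* (δ (κ v) γ ℤ.* ⟦ Fq (a * v) ⟧) ℤ.+ -1ℤ ℤ.* (δ (κ v) γ ℤ.* 1ℤ) ∎) ⟩
      sumWhere G* (λ v → ℤ.+ q ℤ.* (δ (κ v) γ ℤ.* ⟦ Fq (a * v) ⟧) ℤ.+ -1ℤ ℤ.* (δ (κ v) γ ℤ.* 1ℤ))
        ≡⟨ sumList-+ elements G* _ _ ⟩
      sumWhere G* (λ v → ℤ.+ q ℤ.* (δ (κ v) γ ℤ.* ⟦ Fq (a * v) ⟧)) ℤ.+ sumWhere G* (λ v → -1ℤ ℤ.* (δ (κ v) γ ℤ.* 1ℤ))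
        ≡⟨ cong₂ ℤ._+_ (sumList-*ˡ elements G* (ℤ.+ q) _) (sumList-*ˡ elements G* -1ℤ _) ⟩
      ℤ.+ q ℤ.* ∑ᶜ γ (λ v → ⟦ Fq (a * v) ⟧) ℤ.+ -1ℤ ℤ.* ∑ᶜ γ (λ _ → 1ℤ)
        ≡⟨ cong₂ (λ s t → ℤ.+ q ℤ.* s ℤ.+ -1ℤ ℤ.* t) (∑ᶜ-Fq ha) (card-∑ᶜ hγ) ⟩
      ℤ.+ q ℤ.* (D ℤ.* N) ℤ.+ -1ℤ ℤ.* R ≡⟨ cong (λ s → ℤ.+ q ℤ.* (D ℤ.* N) ℤ.+ s) (ℤ.-1*i≡-i R) ⟩
      ℤ.+ q ℤ.* (D ℤ.* N) ℤ.- R ∎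
      where
      distribute : ∀ a b c → a ℤ.* (b ℤ.* c ℤ.- ℤ.+ 1) ≡ b ℤ.* (a ℤ.* c) ℤ.+ ℤ.- ℤ.+ 1 ℤ.* (a ℤ.* ℤ.+ 1)
      distribute = solve-∀

  -- The group U₁ of (Q+1)-st roots of unity

  U₁ U₁∖1 F* : Carrier → Bool
  U₁   = inRootsOfUnity m₁
  U₁∖1 = U₁ ∖ 1#
  F*   = (λ _ → true) ∖ 0#

  1∈U₁ : U₁ 1# ≡ true
  1∈U₁ = eqB-true⁺ (pow-1# (Q ℕ.+ 1))

  U₁-norm : ∀ {u} → U₁ u ≡ true → u * pow u Q ≡ 1#
  U₁-norm {u} hu = trans (cong (pow u) (ℕ.+-comm 1 Q)) (eqB-true⁻ hu)

  U₁-≢0 : ∀ {u} → U₁ u ≡ true → u ≢ 0#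
  U₁-≢0 hu = xy≡1⇒x≢0 (U₁-norm hu)

  U₁-conj : ∀ {u} → U₁ u ≡ true → pow u Q ≡ u ⁻¹
  U₁-conj hu = ⁻¹-unique (U₁-norm hu)

  Q²≡1+3r[Q+1] : 2 ^ (4 ℕ.* m) ≡ suc (3 ℕ.* r ℕ.* (Q ℕ.+ 1))
  Q²≡1+3r[Q+1] = begin
    2 ^ (4 ℕ.* m)                             ≡⟨ cong (2 ^_) 4m≡2[2m] ⟩
    2 ^ (2 ℕ.* m₁)                            ≡⟨ 2^[2k]≡2^k*2^k m₁ ⟩
    Q ℕ.* Q                                   ≡⟨ cong₂ ℕ._*_ Q≡1+3r Q≡1+3r ⟩
    suc (3 ℕ.* r) ℕ.* suc (3 ℕ.* r)           ≡⟨ expand (3 ℕ.* r) ⟩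
    suc (3 ℕ.* r ℕ.* (suc (3 ℕ.* r) ℕ.+ 1))   ≡⟨ cong (λ z → suc (3 ℕ.* r ℕ.* (z ℕ.+ 1))) Q≡1+3r ⟨
    suc (3 ℕ.* r ℕ.* (Q ℕ.+ 1))               ∎
    where
    expand : ∀ s → suc s ℕ.* suc s ≡ suc (s ℕ.* (suc s ℕ.+ 1))
    expand = ℕ-Solver.solve-∀

  card-F* : card F* ≡ ℤ.+ (3 ℕ.* r ℕ.* (Q ℕ.+ 1))
  card-F* = ℤ+-cancelˡ 1ℤ _ _ (begin
    1ℤ ℤ.+ card F*        ≡⟨ ∑-split {λ _ → true} {0#} (λ _ → 1ℤ) refl ⟨
    card (λ _ → true)     ≡⟨ sumList-1 elements (λ _ → refl) ⟩
    ℤ.+ length elements   ≡⟨ cong ℤ.+_ (trans elements-card Q²≡1+3r[Q+1]) ⟩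
    1ℤ ℤ.+ ℤ.+ (3 ℕ.* r ℕ.* (Q ℕ.+ 1)) ∎)

  -- Here 3r = Q - 1, and (Q - 1)(Q + 1) = Q² - 1 annihilates the nonzero elements.
  pow-3r-U₁ : ∀ {x} → x ≢ 0# → U₁ (pow x (3 ℕ.* r)) ≡ true
  pow-3r-U₁ {x} x≢0 = eqB-true⁺ (trans (sym (pow-* x (3 ℕ.* r) (Q ℕ.+ 1))) (*-cancelˡ x≢0 (begin
    x * pow x (3 ℕ.* r ℕ.* (Q ℕ.+ 1)) ≡⟨ cong (pow x) Q²≡1+3r[Q+1] ⟨
    pow x (2 ^ (4 ℕ.* m))             ≡⟨ fermat x ⟩
    x                                 ≡⟨ *-identityʳ x ⟨
    x * 1#                            ∎)))

  0<3r : 0 ℕ.< 3 ℕ.* r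
  0<3r = subst (λ r → 0 ℕ.< 3 ℕ.* r) (sym (proj₂ r≡1+)) (ℕ.s≤s ℕ.z≤n)

  -- The degree of X^(Q+1) + 1 bounds the order from above. From below: x ↦ x^(Q-1) maps the (Q -
  -- 1)(Q + 1) nonzero elements into `U₁`, with at most Q - 1 of them in each fibre.
  card-U₁ : card U₁ ≡ ℤ.+ (Q ℕ.+ 1)
  card-U₁ = ℤ.≤-antisym upper lower
    where
    upper : card U₁ ℤ.≤ ℤ.+ (Q ℕ.+ 1)
    upper = subst (λ l → card U₁ ℤ.≤ ℤ.+ l) (length-X^⊹ (Q ℕ.+ 1) 1#) (card≤degree (X^ (Q ℕ.+ 1) ⊹ 1#) U₁
      (λ x hx → X^⊹-root (subst (0 ℕ.<_) (ℕ.+-comm 1 Q) (ℕ.s≤s ℕ.z≤n)) (eqB-true⁻ hx)))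
    fibre≤3r : ∀ y → fibre F* (λ x → pow x (3 ℕ.* r)) y ℤ.≤ ℤ.+ (3 ℕ.* r)
    fibre≤3r y = subst (λ l → fibre F* (λ x → pow x (3 ℕ.* r)) y ℤ.≤ ℤ.+ l) (length-X^⊹ (3 ℕ.* r) y)
      (fibre≤degree (X^ (3 ℕ.* r) ⊹ y) F* _ y (λ x _ h → X^⊹-root 0<3r h))
    lower : ℤ.+ (Q ℕ.+ 1) ℤ.≤ card U₁
    lower = ℤ.*-cancelˡ-≤-pos (ℤ.+ (Q ℕ.+ 1)) (card U₁) (ℤ.+ (3 ℕ.* r)) {{ℤ.positive (ℤ.+<+ 0<3r)}}
      (subst₂ ℤ._≤_ (trans card-F* (ℤ.pos-* (3 ℕ.* r) (Q ℕ.+ 1))) (∑-const U₁ (ℤ.+ (3 ℕ.* r)))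
        (subst (ℤ._≤ sumWhere U₁ (λ _ → ℤ.+ (3 ℕ.* r)))
          (sym (card-fibre (λ x → pow x (3 ℕ.* r)) (λ x hx → pow-3r-U₁ (proj₂ (∖⁻ (λ _ → true) {0#} {x} hx)))))
          (sumList-mono elements (λ y _ → fibre≤3r y))))

  -- The number is Q = 3R + 1, written as 3R - σ with σ = -1 because `Fibres` treats both signs at
  -- once.
  card-U₁∖1 : card U₁∖1 ≡ ℤ.+ 3 ℤ.* R ℤ.- -1ℤ
  card-U₁∖1 = ℤ+-cancelˡ 1ℤ _ _ (begin
    1ℤ ℤ.+ card U₁∖1                   ≡⟨ ∑-split (λ _ → 1ℤ) 1∈U₁ ⟨
    card U₁                            ≡⟨ card-U₁ ⟩
    ℤ.+ Q ℤ.+ 1ℤ                       ≡⟨ cong (ℤ._+ 1ℤ) +Q≡1+3R ⟩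
    1ℤ ℤ.+ ℤ.+ 3 ℤ.* R ℤ.+ 1ℤ          ≡⟨ ℤ.+-assoc 1ℤ (ℤ.+ 3 ℤ.* R) 1ℤ ⟩
    1ℤ ℤ.+ (ℤ.+ 3 ℤ.* R ℤ.- -1ℤ)       ∎)

  -- The fibres of x ↦ x + x⁻¹

  x+x⁻¹ : Carrier → Carrier
  x+x⁻¹ x = x + x ⁻¹

  x+x⁻¹≢0 : ∀ {x} → x ≢ 0# → x ≢ 1# → x+x⁻¹ x ≢ 0#
  x+x⁻¹≢0 {x} x≢0 x≢1 h = x≢1 (x²≡y²⇒x≡y (begin
    x * x    ≡⟨ cong (x *_) (x+y≡0⇒x≡y h) ⟩
    x * x ⁻¹ ≡⟨ inverseʳ x x≢0 ⟩
    1#       ≡⟨ *-identityˡ 1# ⟨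
    1# * 1#  ∎))

  -- With s = x + x⁻¹, the element z = x/s satisfies z² + z = s⁻².
  tr-[x+x⁻¹]⁻¹ : ∀ {x} → x ≢ 0# → x+x⁻¹ x ≢ 0# → Sub m₁ (x+x⁻¹ x) → tr m₁ (x+x⁻¹ x ⁻¹) ≡ (pow x Q + x) * x+x⁻¹ x ⁻¹
  tr-[x+x⁻¹]⁻¹ {x} x≢0 s≢0 hs = begin
    tr m₁ i                               ≡⟨ tr-square-Sub m₁ (Sub-⁻¹ m₁ hs) ⟨
    tr m₁ (i * i)                         ≡⟨ cong (tr m₁) z²+z≡i² ⟨
    tr m₁ (z * z + z)                     ≡⟨ tr-+ m₁ (z * z) z ⟩
    -- The element z may lie outside G. The defect z^Q + z is 0 for x in G and 1 for x in `U₁`, and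
    -- this separates the two cases.
    tr m₁ (z * z) + tr m₁ z               ≡⟨ cong (_+ tr m₁ z) (tr-telescope m₁ z) ⟩
    tr m₁ z + (pow z Q + z) + tr m₁ z     ≡⟨ solve 2 (λ a b → a :+ b :+ a := b) refl (tr m₁ z) (pow z Q + z) ⟩
    pow z Q + z                           ≡⟨ cong (_+ z) (trans (pow-distrib-* x i Q) (cong (pow x Q *_) (Sub-⁻¹ m₁ hs))) ⟩
    pow x Q * i + x * i                   ≡⟨ distribʳ i (pow x Q) x ⟨
    (pow x Q + x) * i                     ∎
    where
    s = x+x⁻¹ x
    i = s ⁻¹
    z = x * i
    z²+z≡i² : z * z + z ≡ i * i
    z²+z≡i² = begin
      x * i * (x * i) + x * i                ≡⟨ cong (x * i * (x * i) +_) (trans (sym (*-identityʳ _)) (cong (x * i *_) (sym (inverseʳ s s≢0)))) ⟩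
      x * i * (x * i) + x * i * (s * i)
        ≡⟨ solve 3 (λ x i w → x :* i :* (x :* i) :+ x :* i :* ((x :+ w) :* i) := (x :* w) :* (i :* i)) refl x i (x ⁻¹) ⟩
      x * x ⁻¹ * (i * i)                     ≡⟨ cong (_* (i * i)) (inverseʳ x x≢0) ⟩
      1# * (i * i)                           ≡⟨ *-identityˡ _ ⟩
      i * i                                  ∎

  Sign : ℤ → Set
  Sign σ = σ ≡ 1ℤ ⊎ σ ≡ -1ℤ

  e-Sign : ∀ {x} → Sub m₁ x → Sign (e x)
  e-Sign hx with tr-Bit m₁ hx
  ... | inj₁ h = inj₁ (trans (cong χ h) χ-0#)
  ... | inj₂ h = inj₂ (trans (cong χ h) χ-1#)

  Sign-≢ : ∀ {σ τ} → Sign σ → Sign τ → τ ≢ σ → 1ℤ ℤ.+ σ ℤ.* τ ≡ 0ℤ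
  Sign-≢ (inj₁ refl) (inj₁ refl) h = contradiction refl h
  Sign-≢ (inj₁ refl) (inj₂ refl) h = refl
  Sign-≢ (inj₂ refl) (inj₁ refl) h = refl
  Sign-≢ (inj₂ refl) (inj₂ refl) h = contradiction refl h

  Sign-≡ : ∀ {σ τ} → Sign σ → τ ≡ σ → 1ℤ ℤ.+ σ ℤ.* τ ≡ ℤ.+ 2
  Sign-≡ (inj₁ refl) refl = refl
  Sign-≡ (inj₂ refl) refl = refl

  ∑G*-1+σe : ∀ σ (h : Carrier → ℤ) →
    sumWhere G* (λ s → (1ℤ ℤ.+ σ ℤ.* e (s ⁻¹)) ℤ.* h s) ≡ sumWhere G* h ℤ.+ σ ℤ.* sumWhere G* (λ s → e (s ⁻¹) ℤ.* h s)
  ∑G*-1+σe σ h = begin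
    sumWhere G* (λ s → (1ℤ ℤ.+ σ ℤ.* e (s ⁻¹)) ℤ.* h s)   ≡⟨ ∑-cong (λ s _ → expand σ (e (s ⁻¹)) (h s)) ⟩
    sumWhere G* (λ s → h s ℤ.+ σ ℤ.* (e (s ⁻¹) ℤ.* h s))  ≡⟨ sumList-+ elements G* h _ ⟩
    sumWhere G* h ℤ.+ sumWhere G* (λ s → σ ℤ.* (e (s ⁻¹) ℤ.* h s))
      ≡⟨ cong (λ z → sumWhere G* h ℤ.+ z) (sumList-*ˡ elements G* σ _) ⟩
    sumWhere G* h ℤ.+ σ ℤ.* sumWhere G* (λ s → e (s ⁻¹) ℤ.* h s) ∎
    where
    expand : ∀ σ a b → (ℤ.+ 1 ℤ.+ σ ℤ.* a) ℤ.* b ≡ b ℤ.+ σ ℤ.* (a ℤ.* b)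
    expand = solve-∀

  -- A fibre is the root set of X² + sX + 1, so it has at most two elements,
  -- and it is empty if e (s⁻¹) is wrong.  These bounds add up to card P.
  module Fibres (P : Carrier → Bool) (σ : ℤ) (hσ : Sign σ)
    (P-≢0 : ∀ {x} → P x ≡ true → x ≢ 0#)
    (P-G* : ∀ {x} → P x ≡ true → G* (x+x⁻¹ x) ≡ true)
    (P-e  : ∀ {x} → P x ≡ true → e (x+x⁻¹ x ⁻¹) ≡ σ)
    (card-P : card P ≡ ℤ.+ 3 ℤ.* R ℤ.- σ) where

    bound : Carrier → ℤ
    bound s = 1ℤ ℤ.+ σ ℤ.* e (s ⁻¹)

    fibre≤bound : ∀ s → G* s ≡ true → fibre P x+x⁻¹ s ℤ.≤ bound s
    fibre≤bound s hs with e (s ⁻¹) ℤ.≟ σ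
    ... | yes e≡σ = subst (fibre P x+x⁻¹ s ℤ.≤_) (sym (Sign-≡ hσ e≡σ)) (fibre≤degree (1# ∷ s ∷ []) P x+x⁻¹ s root)
      where
      root : ∀ x → P x ≡ true → x+x⁻¹ x ≡ s → 1# + x * (s + x * 1#) ≡ 0#
      root x Px refl = begin
        1# + x * (x + x ⁻¹ + x * 1#) ≡⟨ solve 2 (λ x i → con true :+ x :* (x :+ i :+ x :* con true) := con true :+ x :* i) refl x (x ⁻¹) ⟩
        1# + x * x ⁻¹                ≡⟨ cong (1# +_) (inverseʳ x (P-≢0 Px)) ⟩
        1# + 1#                      ≡⟨ x+x≡0 1# ⟩
        0#                           ∎
    ... | no  e≢σ = ℤ.≤-reflexive (trans
      (sumList-0 elements (λ x Px → δ-≢ (λ h → e≢σ (trans (cong (e ∘ _⁻¹) (sym h)) (P-e Px)))))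
      (sym (Sign-≢ hσ (e-Sign (Sub-⁻¹ m₁ (proj₁ (G*⁻ hs)))) e≢σ)))

    -- The values e(s⁻¹) sum to -1 over `G*`, so the total is Q - 1 - σ, the number of elements
    -- other than 1 in `G*` for σ = 1 and in `U₁` for σ = -1.
    ∑-bound : sumWhere G* bound ≡ ℤ.+ 3 ℤ.* R ℤ.- σ
    ∑-bound = begin
      sumWhere G* bound                                          ≡⟨ ∑-cong (λ s _ → sym (ℤ.*-identityʳ (bound s))) ⟩
      sumWhere G* (λ s → bound s ℤ.* 1ℤ)                         ≡⟨ ∑G*-1+σe σ (λ _ → 1ℤ) ⟩
      card G* ℤ.+ σ ℤ.* sumWhere G* (λ s → e (s ⁻¹) ℤ.* 1ℤ)
        ≡⟨ cong₂ (λ s t → s ℤ.+ σ ℤ.* t) card-G* (begin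
             sumWhere G* (λ s → e (s ⁻¹) ℤ.* 1ℤ) ≡⟨ ∑G*-⁻¹ (λ s → e s ℤ.* 1ℤ) ⟩
             sumWhere G* (λ s → e s ℤ.* 1ℤ)
               ≡⟨ ∑-cong (λ s _ → trans (ℤ.*-identityʳ (e s)) (cong e (sym (*-identityˡ s)))) ⟩
             sumWhere G* (λ s → e (1# * s))      ≡⟨ ∑G*-e (G*⁺ (Sub-1# m₁) 1≢0) ⟩
             -1ℤ                                 ∎) ⟩
      ℤ.+ 3 ℤ.* R ℤ.+ σ ℤ.* -1ℤ
        ≡⟨ cong (λ z → ℤ.+ 3 ℤ.* R ℤ.+ z) (trans (ℤ.*-comm σ -1ℤ) (ℤ.-1*i≡-i σ)) ⟩
      ℤ.+ 3 ℤ.* R ℤ.- σ                                          ∎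

    ∑-x+x⁻¹ : ∀ (h : Carrier → ℤ) →
      sumWhere P (h ∘ x+x⁻¹) ≡ sumWhere G* h ℤ.+ σ ℤ.* sumWhere G* (λ s → e (s ⁻¹) ℤ.* h s)
    ∑-x+x⁻¹ h = begin
      sumWhere P (h ∘ x+x⁻¹)                         ≡⟨ ∑-fibre x+x⁻¹ h (λ _ → P-G*) ⟩
      sumWhere G* (λ s → fibre P x+x⁻¹ s ℤ.* h s)
        ≡⟨ ∑-cong (λ s hs → cong (ℤ._* h s)
             (fibre-tight x+x⁻¹ (λ _ → P-G*) fibre≤bound (trans card-P (sym ∑-bound)) s hs)) ⟩
      sumWhere G* (λ s → bound s ℤ.* h s)            ≡⟨ ∑G*-1+σe σ h ⟩
      sumWhere G* h ℤ.+ σ ℤ.* sumWhere G* (λ s → e (s ⁻¹) ℤ.* h s) ∎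

  G*∖1 : Carrier → Bool
  G*∖1 = G* ∖ 1#

  1∈G* : G* 1# ≡ true
  1∈G* = G*⁺ (Sub-1# m₁) 1≢0

  G*-s∈G* : ∀ {x} → G*∖1 x ≡ true → G* (x+x⁻¹ x) ≡ true
  G*-s∈G* h = G*⁺ (Sub-+ m₁ hx (Sub-⁻¹ m₁ hx)) (x+x⁻¹≢0 (proj₂ (G*⁻ (proj₁ (∖⁻ G* h)))) (proj₂ (∖⁻ G* h)))
    where hx = proj₁ (G*⁻ (proj₁ (∖⁻ G* h)))

  G*-e≡1 : ∀ {x} → G*∖1 x ≡ true → e (x+x⁻¹ x ⁻¹) ≡ 1ℤ
  G*-e≡1 {x} h = trans (cong χ (begin
    tr m₁ (x+x⁻¹ x ⁻¹)           ≡⟨ tr-[x+x⁻¹]⁻¹ (proj₂ (G*⁻ hx)) (proj₂ (G*⁻ (G*-s∈G* h))) (proj₁ (G*⁻ (G*-s∈G* h))) ⟩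
    (pow x Q + x) * x+x⁻¹ x ⁻¹   ≡⟨ cong (_* x+x⁻¹ x ⁻¹) (x≡y⇒x+y≡0 (proj₁ (G*⁻ hx))) ⟩
    0# * x+x⁻¹ x ⁻¹              ≡⟨ zeroˡ _ ⟩
    0#                           ∎)) χ-0#
    where hx = proj₁ (∖⁻ G* h)

  card-G*∖1 : card G*∖1 ≡ ℤ.+ 3 ℤ.* R ℤ.- 1ℤ
  card-G*∖1 = trans (subtract (card G*∖1)) (cong (ℤ._- 1ℤ) (trans (sym (∑-split (λ _ → 1ℤ) 1∈G*)) card-G*))
    where
    subtract : ∀ a → a ≡ ℤ.+ 1 ℤ.+ a ℤ.- ℤ.+ 1
    subtract = solve-∀

  G*∖1-≢0 : ∀ {x} → G*∖1 x ≡ true → x ≢ 0#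
  G*∖1-≢0 h = proj₂ (G*⁻ (proj₁ (∖⁻ G* h)))

  -- For s in `G*`, the polynomial X² + sX + 1 splits over G when e(s⁻¹) = 1; otherwise it is
  -- irreducible there and its roots lie in `U₁`, which is the case of `Inert`.
  module Split = Fibres G*∖1 1ℤ (inj₁ refl) G*∖1-≢0 G*-s∈G* G*-e≡1 card-G*∖1

  U₁-s∈G* : ∀ {x} → U₁∖1 x ≡ true → G* (x+x⁻¹ x) ≡ true
  U₁-s∈G* {x} h = G*⁺ (begin
      pow (x + x ⁻¹) Q               ≡⟨ frobenius m₁ x (x ⁻¹) ⟩
      pow x Q + pow (x ⁻¹) Q         ≡⟨ cong₂ _+_ (U₁-conj hx) (trans (pow-⁻¹ Q (U₁-≢0 hx)) (cong _⁻¹ (U₁-conj hx))) ⟩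
      x ⁻¹ + (x ⁻¹) ⁻¹               ≡⟨ cong (x ⁻¹ +_) (⁻¹-involutive (U₁-≢0 hx)) ⟩
      x ⁻¹ + x                       ≡⟨ +-comm _ _ ⟩
      x + x ⁻¹                       ∎)
    (x+x⁻¹≢0 (U₁-≢0 hx) (proj₂ (∖⁻ U₁ h)))
    where hx = proj₁ (∖⁻ U₁ h)

  U₁-e≡-1 : ∀ {x} → U₁∖1 x ≡ true → e (x+x⁻¹ x ⁻¹) ≡ -1ℤ
  U₁-e≡-1 {x} h = trans (cong χ (begin
    tr m₁ (x+x⁻¹ x ⁻¹)             ≡⟨ tr-[x+x⁻¹]⁻¹ (U₁-≢0 hx) (proj₂ (G*⁻ (U₁-s∈G* h))) (proj₁ (G*⁻ (U₁-s∈G* h))) ⟩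
    (pow x Q + x) * x+x⁻¹ x ⁻¹     ≡⟨ cong (_* x+x⁻¹ x ⁻¹) (trans (cong (_+ x) (U₁-conj hx)) (+-comm _ _)) ⟩
    x+x⁻¹ x * x+x⁻¹ x ⁻¹           ≡⟨ inverseʳ _ (proj₂ (G*⁻ (U₁-s∈G* h))) ⟩
    1#                             ∎)) χ-1#
    where hx = proj₁ (∖⁻ U₁ h)

  U₁∖1-≢0 : ∀ {x} → U₁∖1 x ≡ true → x ≢ 0#
  U₁∖1-≢0 h = U₁-≢0 (proj₁ (∖⁻ U₁ h))

  module Inert = Fibres U₁∖1 -1ℤ (inj₂ refl) U₁∖1-≢0 U₁-s∈G* U₁-e≡-1 card-U₁∖1

  -- Cubing on `G*` and on `U₁`

  cube : Carrier → Carrier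
  cube x = x * (x * x)

  cube≡pow3 : ∀ x → cube x ≡ pow x 3
  cube≡pow3 x = cong (λ z → x * (x * z)) (sym (*-identityʳ x))

  cube-⁻¹ : ∀ {x} → x ≢ 0# → cube x ⁻¹ ≡ cube (x ⁻¹)
  cube-⁻¹ {x} x≢0 = begin
    cube x ⁻¹       ≡⟨ cong _⁻¹ (cube≡pow3 x) ⟩
    pow x 3 ⁻¹      ≡⟨ pow-⁻¹ 3 x≢0 ⟨
    pow (x ⁻¹) 3    ≡⟨ cube≡pow3 (x ⁻¹) ⟨
    cube (x ⁻¹)     ∎

  -- A fibre of cubing has at most 3 elements and is empty unless κ(v) = 1. These bounds add up to
  -- 3R, the size of `G*`, so each is attained; in particular the cubes are exactly the class of 1.
  ∑G*-cube : ∀ (h : Carrier → ℤ) → sumWhere G* (h ∘ cube) ≡ ℤ.+ 3 ℤ.* ∑ᶜ 1# h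
  ∑G*-cube h = begin
    sumWhere G* (h ∘ cube)                          ≡⟨ ∑-fibre cube h closed ⟩
    sumWhere G* (λ v → fibre G* cube v ℤ.* h v)
      ≡⟨ ∑-cong (λ v hv → trans (cong (ℤ._* h v) (fibre-tight cube closed fibre≤ card≡ v hv)) (ℤ.*-assoc (ℤ.+ 3) (δ (κ v) 1#) (h v))) ⟩
    sumWhere G* (λ v → ℤ.+ 3 ℤ.* (δ (κ v) 1# ℤ.* h v)) ≡⟨ sumList-*ˡ elements G* (ℤ.+ 3) _ ⟩
    ℤ.+ 3 ℤ.* ∑ᶜ 1# h                               ∎
    where
    closed : ∀ x → G* x ≡ true → G* (cube x) ≡ true
    closed x hx = G*-* hx (G*-* hx hx)
    fibre≤ : ∀ v → G* v ≡ true → fibre G* cube v ℤ.≤ ℤ.+ 3 ℤ.* δ (κ v) 1#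
    fibre≤ v hv with κ v ≟ 1#
    ... | yes _    = fibre≤degree (X^ 3 ⊹ v) G* cube v (λ x _ h → X^⊹-root {3} (ℕ.s≤s ℕ.z≤n) (trans (sym (cube≡pow3 x)) h))
    ... | no  κv≢1 = ℤ.≤-reflexive (sumList-0 elements (λ x hx → δ-≢ (λ h → κv≢1 (begin
      κ v                   ≡⟨ cong κ h ⟨
      κ (cube x)            ≡⟨ trans (κ-* x (x * x)) (cong (κ x *_) (κ-* x x)) ⟩
      κ x * (κ x * κ x)     ≡⟨ Cubic-κ hx ⟩
      1#                    ∎))))
    card≡ : card G* ≡ sumWhere G* (λ v → ℤ.+ 3 ℤ.* δ (κ v) 1#)
    card≡ = begin
      card G*                                             ≡⟨ card-G* ⟩
      ℤ.+ 3 ℤ.* R                                         ≡⟨ cong (ℤ.+ 3 ℤ.*_) (card-∑ᶜ (trans (*-identityˡ _) (*-identityˡ _))) ⟨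
      ℤ.+ 3 ℤ.* ∑ᶜ 1# (λ _ → 1ℤ)                          ≡⟨ sumList-*ˡ elements G* (ℤ.+ 3) _ ⟨
      sumWhere G* (λ v → ℤ.+ 3 ℤ.* (δ (κ v) 1# ℤ.* 1ℤ))   ≡⟨ ∑-cong (λ v _ → cong (ℤ.+ 3 ℤ.*_) (ℤ.*-identityʳ _)) ⟩
      sumWhere G* (λ v → ℤ.+ 3 ℤ.* δ (κ v) 1#)            ∎

  -- Since 3(r+1) = (Q+1) + 1, the inverse of cubing on U₁ is u ↦ u^(r+1).
  cube-root-U₁ : ∀ {u} → U₁ u ≡ true → pow (cube u) (suc r) ≡ u
  cube-root-U₁ {u} hu = begin
    pow (cube u) (suc r)            ≡⟨ cong (λ z → pow z (suc r)) (cube≡pow3 u) ⟩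
    pow (pow u 3) (suc r)           ≡⟨ pow-* u 3 (suc r) ⟨
    pow u (3 ℕ.* suc r)             ≡⟨ cong (pow u) (trans (expand r) (cong (λ z → suc (z ℕ.+ 1)) (sym Q≡1+3r))) ⟩
    u * pow u (Q ℕ.+ 1)             ≡⟨ cong (u *_) (eqB-true⁻ hu) ⟩
    u * 1#                          ≡⟨ *-identityʳ u ⟩
    u                               ∎
    where
    expand : ∀ r → 3 ℕ.* suc r ≡ suc (suc (3 ℕ.* r) ℕ.+ 1)
    expand = ℕ-Solver.solve-∀

  ∑U₁∖1-cube : ∀ (h : Carrier → ℤ) → sumWhere U₁∖1 (h ∘ cube) ≡ sumWhere U₁∖1 h
  ∑U₁∖1-cube h = ∑-reindex cube h closed (λ hx hy → injective (proj₁ (∖⁻ U₁ hx)) (proj₁ (∖⁻ U₁ hy)))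
    where
    injective : ∀ {x y} → U₁ x ≡ true → U₁ y ≡ true → cube x ≡ cube y → x ≡ y
    injective hx hy h = trans (sym (cube-root-U₁ hx)) (trans (cong (λ z → pow z (suc r)) h) (cube-root-U₁ hy))
    closed : ∀ x → U₁∖1 x ≡ true → U₁∖1 (cube x) ≡ true
    closed x h = ∖⁺ U₁
      (eqB-true⁺ (begin
        pow (cube x) (Q ℕ.+ 1)         ≡⟨ cong (λ z → pow z (Q ℕ.+ 1)) (cube≡pow3 x) ⟩
        pow (pow x 3) (Q ℕ.+ 1)        ≡⟨ pow-comm x 3 (Q ℕ.+ 1) ⟩
        pow (pow x (Q ℕ.+ 1)) 3        ≡⟨ cong (λ z → pow z 3) (eqB-true⁻ hx) ⟩
        pow 1# 3                       ≡⟨ pow-1# 3 ⟩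
        1#                             ∎))
      (λ c≡1 → proj₂ (∖⁻ U₁ h) (injective hx 1∈U₁ (trans c≡1 (sym (trans (*-identityˡ _) (*-identityˡ _))))))
      where hx = proj₁ (∖⁻ U₁ h)

  -- The Dickson polynomial s³ + s

  -- Written like the argument in `C m₁ c c`, which thereby is the sum of `e ∘ D c` over G by
  -- definition.
  D : Carrier → Carrier → Carrier
  D c s = c * pow s 3 + c * s

  -- With i = x⁻¹ one has (x + i)³ = x³ + i³ + xi(x + i) and xi = 1. The solver treats x and i as
  -- independent, so a factor 1 is exposed and rewritten as xi in between.
  dickson : ∀ c {x} → x ≢ 0# → c * x+x⁻¹ (cube x) ≡ D c (x+x⁻¹ x)
  dickson c {x} x≢0 = begin
    c * (cube x + cube x ⁻¹)                   ≡⟨ cong (λ z → c * (cube x + z)) (cube-⁻¹ x≢0) ⟩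
    c * (cube x + cube i)
      ≡⟨ solve 3 (λ c x i → c :* (x :* (x :* x) :+ i :* (i :* i))
           := c :* (x :* (x :* x) :+ i :* (i :* i) :+ con true :* (x :+ i)) :+ c :* (x :+ i)) refl c x i ⟩
    c * (cube x + cube i + 1# * (x + i)) + c * (x + i)
      ≡⟨ cong (λ z → c * (cube x + cube i + z * (x + i)) + c * (x + i)) (inverseʳ x x≢0) ⟨
    c * (cube x + cube i + x * i * (x + i)) + c * (x + i)
      ≡⟨ solve 3 (λ c x i → c :* (x :* (x :* x) :+ i :* (i :* i) :+ x :* i :* (x :+ i)) :+ c :* (x :+ i)
           := c :* ((x :+ i) :* ((x :+ i) :* ((x :+ i) :* con true))) :+ c :* (x :+ i)) refl c x i ⟩
    c * pow (x + i) 3 + c * (x + i)            ∎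
    where i = x ⁻¹

  module CubicKloosterman {c : Carrier} (hc : G* c ≡ true) where

    -- Y is the mixed sum to be eliminated: `inert` and `split` are two linear relations that
    -- contain it, while W = K - 1 and the sum of `e ∘ D c` over `G*` is C - 1.
    C₁ K₁ Y W T : ℤ
    C₁ = C m₁ c c
    K₁ = K m₁ c
    Y  = sumWhere G* (λ s → e (s ⁻¹) ℤ.* e (D c s))
    W  = sumWhere G* (λ s → e (s ⁻¹) ℤ.* e (c * s))
    T  = ∑ᶜ 1# (λ z → e (c * x+x⁻¹ z))

    c∈G : Sub m₁ c
    c∈G = proj₁ (G*⁻ hc)

    C₁≡1+∑ : C₁ ≡ 1ℤ ℤ.+ sumWhere G* (e ∘ D c)
    C₁≡1+∑ = trans (∑G≡f0+∑G* (e ∘ D c)) (cong (ℤ._+ sumWhere G* (e ∘ D c))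
      (trans (cong e (solve 1 (λ c → c :* (con false :* (con false :* (con false :* con true))) :+ c :* con false := con false) refl c)) e-0))

    K₁≡1+W : K₁ ≡ 1ℤ ℤ.+ W
    K₁≡1+W = trans (∑G≡f0+∑G* (λ x → e (c * x + x ⁻¹))) (cong₂ ℤ._+_
      (trans (cong e (trans (cong (c * 0# +_) inv-zero) (trans (+-identityʳ _) (zeroʳ c)))) e-0)
      (∑-cong (λ x hx → trans (e-+ (Sub-* m₁ c∈G (proj₁ (G*⁻ hx))) (Sub-⁻¹ m₁ (proj₁ (G*⁻ hx)))) (ℤ.*-comm (e (c * x)) _))))

    -- The sum of e(c(u + u⁻¹)) over u ≠ 1 in `U₁` is computed twice, once directly and once after
    -- replacing u by u³.
    inert : sumWhere G* (e ∘ D c) ℤ.+ -1ℤ ℤ.* Y ≡ -1ℤ ℤ.+ -1ℤ ℤ.* W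
    inert = begin
      sumWhere G* (e ∘ D c) ℤ.+ -1ℤ ℤ.* Y             ≡⟨ Inert.∑-x+x⁻¹ (e ∘ D c) ⟨
      sumWhere U₁∖1 (λ u → e (D c (x+x⁻¹ u)))         ≡⟨ ∑-cong (λ u hu → cong e (dickson c (U₁-≢0 (proj₁ (∖⁻ U₁ hu))))) ⟨
      sumWhere U₁∖1 (λ u → e (c * x+x⁻¹ (cube u)))    ≡⟨ ∑U₁∖1-cube (λ u → e (c * x+x⁻¹ u)) ⟩
      sumWhere U₁∖1 (λ u → e (c * x+x⁻¹ u))           ≡⟨ Inert.∑-x+x⁻¹ (λ s → e (c * s)) ⟩
      sumWhere G* (λ s → e (c * s)) ℤ.+ -1ℤ ℤ.* W     ≡⟨ cong (ℤ._+ -1ℤ ℤ.* W) (∑G*-e hc) ⟩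
      -1ℤ ℤ.+ -1ℤ ℤ.* W                               ∎

    split : ℤ.+ 3 ℤ.* T ≡ 1ℤ ℤ.+ (sumWhere G* (e ∘ D c) ℤ.+ 1ℤ ℤ.* Y)
    split = begin
      ℤ.+ 3 ℤ.* T                                     ≡⟨ ∑G*-cube (λ z → e (c * x+x⁻¹ z)) ⟨
      sumWhere G* (λ x → e (c * x+x⁻¹ (cube x)))      ≡⟨ ∑-cong (λ x hx → cong e (dickson c (proj₂ (G*⁻ hx)))) ⟩
      -- For x = 1 the value x + x⁻¹ = 0 falls outside `G*`, so this term is taken out first; it
      -- equals e(0) = 1.
      sumWhere G* (λ x → e (D c (x+x⁻¹ x)))           ≡⟨ ∑-split (λ x → e (D c (x+x⁻¹ x))) 1∈G* ⟩
      e (D c (x+x⁻¹ 1#)) ℤ.+ sumWhere G*∖1 (λ x → e (D c (x+x⁻¹ x)))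
        ≡⟨ cong₂ ℤ._+_ (trans (cong e at-1) e-0) (Split.∑-x+x⁻¹ (e ∘ D c)) ⟩
      1ℤ ℤ.+ (sumWhere G* (e ∘ D c) ℤ.+ 1ℤ ℤ.* Y)     ∎
      where
      at-1 : D c (x+x⁻¹ 1#) ≡ 0#
      at-1 = trans (cong (D c) (trans (cong (1# +_) 1⁻¹≡1) (x+x≡0 1#)))
        (solve 1 (λ c → c :* (con false :* (con false :* (con false :* con true))) :+ c :* con false := con false) refl c)

    3∑ᶜ-cubes : ℤ.+ 3 ℤ.* ∑ᶜ 1# (λ z → e (c * x+x⁻¹ z)) ≡ ℤ.+ 2 ℤ.* C m₁ c c ℤ.+ K m₁ c ℤ.- 1ℤ
    3∑ᶜ-cubes = begin
      ℤ.+ 3 ℤ.* T                                                      ≡⟨ split ⟩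
      1ℤ ℤ.+ (X ℤ.+ 1ℤ ℤ.* Y)                                          ≡⟨ expand X Y ⟩
      1ℤ ℤ.+ (X ℤ.+ X ℤ.- (X ℤ.+ -1ℤ ℤ.* Y))                           ≡⟨ cong (λ z → 1ℤ ℤ.+ (X ℤ.+ X ℤ.- z)) inert ⟩
      1ℤ ℤ.+ (X ℤ.+ X ℤ.- (-1ℤ ℤ.+ -1ℤ ℤ.* W))                         ≡⟨ collect X W ⟩
      ℤ.+ 2 ℤ.* (1ℤ ℤ.+ X) ℤ.+ (1ℤ ℤ.+ W) ℤ.- 1ℤ                       ≡⟨ cong₂ (λ s t → ℤ.+ 2 ℤ.* s ℤ.+ t ℤ.- 1ℤ) C₁≡1+∑ K₁≡1+W ⟨
      ℤ.+ 2 ℤ.* C₁ ℤ.+ K₁ ℤ.- 1ℤ                                       ∎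
      where
      X = sumWhere G* (e ∘ D c)
      expand : ∀ X Y → ℤ.+ 1 ℤ.+ (X ℤ.+ ℤ.+ 1 ℤ.* Y) ≡ ℤ.+ 1 ℤ.+ (X ℤ.+ X ℤ.- (X ℤ.+ ℤ.- ℤ.+ 1 ℤ.* Y))
      expand = solve-∀
      collect : ∀ X W → ℤ.+ 1 ℤ.+ (X ℤ.+ X ℤ.- (ℤ.- ℤ.+ 1 ℤ.+ ℤ.- ℤ.+ 1 ℤ.* W)) ≡ ℤ.+ 2 ℤ.* (ℤ.+ 1 ℤ.+ X) ℤ.+ (ℤ.+ 1 ℤ.+ W) ℤ.- ℤ.+ 1
      collect = solve-∀

  -- Square roots and Frobenius invariance of K and C

  sqrt : ∀ {x} → Sub m₁ x → ∃[ c ] Sub m₁ c × c * c ≡ x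
  -- The m₁-th iterate of squaring is the identity on G, so the (m₁ - 1)-st iterate is its inverse.
  sqrt {x} hx = pow x (2 ^ ℕ.pred m₁) , Sub-pow m₁ (2 ^ ℕ.pred m₁) hx ,
    trans (sym (pow-2^suc x (ℕ.pred m₁))) (trans (cong (λ k → pow x (2 ^ k)) (ℕ.suc-pred m₁)) hx)

  ∑G-square : ∀ (h : Carrier → ℤ) → sumWhere G (λ x → h (x * x)) ≡ sumWhere G h
  ∑G-square h = ∑-reindex (λ x → x * x) h
    (λ x hx → eqB-true⁺ (Sub-* m₁ (eqB-true⁻ hx) (eqB-true⁻ hx))) (λ _ _ → x²≡y²⇒x≡y)

  square-⁻¹ : ∀ x → (x * x) ⁻¹ ≡ x ⁻¹ * x ⁻¹
  square-⁻¹ x with x ≟ 0#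
  ... | yes refl = trans (cong _⁻¹ (zeroˡ 0#)) (trans inv-zero (sym (trans (cong (_* 0# ⁻¹) inv-zero) (zeroˡ _))))
  ... | no  x≢0  = ⁻¹-distrib-* x≢0 x≢0

  -- After x is replaced by x², the argument of e is the square of cx + x⁻¹, and e is invariant
  -- under squaring. This brings the result for the square root c of a back to a itself.
  K-square : ∀ {c} → Sub m₁ c → K m₁ (c * c) ≡ K m₁ c
  K-square {c} hc = begin
    sumWhere G (λ x → e (c * c * x + x ⁻¹))              ≡⟨ ∑G-square (λ x → e (c * c * x + x ⁻¹)) ⟨
    sumWhere G (λ x → e (c * c * (x * x) + (x * x) ⁻¹))
      ≡⟨ ∑-cong (λ x hx → trans (cong e (trans (cong (c * c * (x * x) +_) (square-⁻¹ x))
           (solve 3 (λ c x i → c :* c :* (x :* x) :+ i :* i := (c :* x :+ i) :* (c :* x :+ i)) refl c x (x ⁻¹))))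
           (e-square (Sub-+ m₁ (Sub-* m₁ hc (eqB-true⁻ hx)) (Sub-⁻¹ m₁ (eqB-true⁻ hx))))) ⟩
    sumWhere G (λ x → e (c * x + x ⁻¹))                  ∎

  C-square : ∀ {c} → Sub m₁ c → C m₁ (c * c) (c * c) ≡ C m₁ c c
  C-square {c} hc = begin
    sumWhere G (e ∘ D (c * c))              ≡⟨ ∑G-square (e ∘ D (c * c)) ⟨
    sumWhere G (λ x → e (D (c * c) (x * x)))
      ≡⟨ ∑-cong (λ x hx → trans (cong e
           (solve 2 (λ c x → c :* c :* ((x :* x) :* ((x :* x) :* ((x :* x) :* con true))) :+ c :* c :* (x :* x)
             := (c :* (x :* (x :* (x :* con true))) :+ c :* x) :* (c :* (x :* (x :* (x :* con true))) :+ c :* x)) refl c x))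
           (e-square (Sub-+ m₁ (Sub-* m₁ hc (Sub-pow m₁ 3 (eqB-true⁻ hx))) (Sub-* m₁ hc (eqB-true⁻ hx))))) ⟩
    sumWhere G (e ∘ D c)                    ∎

  -- Kloosterman sums over a class of the cubic character

  κ-⁻¹ : ∀ {x} → x ≢ 0# → κ (x ⁻¹) ≡ κ x ⁻¹
  κ-⁻¹ = pow-⁻¹ r

  B : Carrier → Carrier → ℤ
  B a γ = ∑ᶜ γ (λ v → e (v ⁻¹) ℤ.* e (a * v))

  -- The substitution v ↦ (a v)⁻¹ exchanges the two terms of a v + v⁻¹.
  B-symmetric : ∀ {a γ γ′} → G* a ≡ true → Cubic γ → κ a * γ * γ′ ≡ 1# → B a γ ≡ B a γ′
  B-symmetric {a} {γ} {γ′} ha hγ αγγ′≡1 = begin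
    B a γ                                   ≡⟨ ∑-cong (λ v hv → term v hv) ⟩
    sumWhere G* (λ v → h ((a * v) ⁻¹))      ≡⟨ ∑G*-scale (h ∘ _⁻¹) ha ⟩
    sumWhere G* (λ v → h (v ⁻¹))            ≡⟨ ∑G*-⁻¹ h ⟩
    B a γ′                                  ∎
    where
    h : Carrier → ℤ
    h v = δ (κ v) γ′ ℤ.* (e (v ⁻¹) ℤ.* e (a * v))
    a≢0 = proj₂ (G*⁻ ha)
    αγ≢0 : κ a * γ ≢ 0#
    αγ≢0 = *-≢0 (Cubic-≢0 (Cubic-κ ha)) (Cubic-≢0 hγ)
    term : ∀ v → G* v ≡ true → δ (κ v) γ ℤ.* (e (v ⁻¹) ℤ.* e (a * v)) ≡ h ((a * v) ⁻¹)
    term v hv = cong₂ ℤ._*_ (δ-cong to from) (trans (ℤ.*-comm (e (v ⁻¹)) _) (cong₂ (λ s t → e s ℤ.* e t)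
        (sym (⁻¹-involutive av≢0))
        (sym (⁻¹-unique (trans (solve 3 (λ v a i → v :* (a :* i) := a :* v :* i) refl v a ((a * v) ⁻¹)) (inverseʳ (a * v) av≢0))))))
      where
      av≢0 = *-≢0 a≢0 (proj₂ (G*⁻ hv))
      κ[av]⁻¹ : κ ((a * v) ⁻¹) ≡ (κ a * κ v) ⁻¹
      κ[av]⁻¹ = trans (κ-⁻¹ av≢0) (cong _⁻¹ (κ-* a v))
      to : κ v ≡ γ → κ ((a * v) ⁻¹) ≡ γ′
      to κv≡γ = trans κ[av]⁻¹ (sym (⁻¹-unique (trans (cong (λ z → κ a * z * γ′) κv≡γ) αγγ′≡1)))
      from : κ ((a * v) ⁻¹) ≡ γ′ → κ v ≡ γ
      from eq = *-cancelˡ (Cubic-≢0 (Cubic-κ ha)) (begin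
        κ a * κ v                  ≡⟨ ⁻¹-involutive (*-≢0 (Cubic-≢0 (Cubic-κ ha)) (Cubic-≢0 (Cubic-κ hv))) ⟨
        ((κ a * κ v) ⁻¹) ⁻¹        ≡⟨ cong _⁻¹ (trans (sym κ[av]⁻¹) (trans eq (⁻¹-unique αγγ′≡1))) ⟩
        ((κ a * γ) ⁻¹) ⁻¹          ≡⟨ ⁻¹-involutive αγ≢0 ⟩
        κ a * γ                    ∎)

  B-cosets : ∀ {a γ} → Cubic γ → G* a ≡ true → B a γ ℤ.+ B a (γ * ω₃) ℤ.+ B a (γ * (ω₃ * ω₃)) ≡ K m₁ a ℤ.- 1ℤ
  B-cosets {a} {γ} hγ ha = begin
    B a γ ℤ.+ B a (γ * ω₃) ℤ.+ B a (γ * (ω₃ * ω₃))   ≡⟨ ∑ᶜ-cosets _ hγ ⟩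
    W                                                ≡⟨ subtract W ⟩
    1ℤ ℤ.+ W ℤ.- 1ℤ                                  ≡⟨ cong (ℤ._- 1ℤ) (CubicKloosterman.K₁≡1+W ha) ⟨
    K m₁ a ℤ.- 1ℤ                                    ∎
    where
    W = sumWhere G* (λ s → e (s ⁻¹) ℤ.* e (a * s))
    subtract : ∀ a → a ≡ ℤ.+ 1 ℤ.+ a ℤ.- ℤ.+ 1
    subtract = solve-∀

  -- Put a = c² and z = cv. Then av + v⁻¹ = c(z + z⁻¹), and κ(v) = κ(c²) turns into κ(z) = κ(c)³ =
  -- 1.
  3B-α : ∀ {a} → G* a ≡ true → ℤ.+ 3 ℤ.* B a (κ a) ≡ ℤ.+ 2 ℤ.* C m₁ a a ℤ.+ K m₁ a ℤ.- 1ℤ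
  3B-α {a} ha with sqrt (proj₁ (G*⁻ ha))
  ... | c , hc , refl = begin
    ℤ.+ 3 ℤ.* B (c * c) (κ (c * c))                         ≡⟨ cong (ℤ.+ 3 ℤ.*_) (∑-cong term) ⟩
    ℤ.+ 3 ℤ.* sumWhere G* (λ v → h (c * v))                 ≡⟨ cong (ℤ.+ 3 ℤ.*_) (∑G*-scale h c∈G*) ⟩
    ℤ.+ 3 ℤ.* ∑ᶜ 1# (λ z → e (c * x+x⁻¹ z))                 ≡⟨ CubicKloosterman.3∑ᶜ-cubes c∈G* ⟩
    ℤ.+ 2 ℤ.* C m₁ c c ℤ.+ K m₁ c ℤ.- 1ℤ                    ≡⟨ cong₂ (λ s t → ℤ.+ 2 ℤ.* s ℤ.+ t ℤ.- 1ℤ) (C-square hc) (K-square hc) ⟨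
    ℤ.+ 2 ℤ.* C m₁ (c * c) (c * c) ℤ.+ K m₁ (c * c) ℤ.- 1ℤ  ∎
    where
    c≢0 : c ≢ 0#
    c≢0 refl = proj₂ (G*⁻ ha) (zeroˡ 0#)
    c∈G* : G* c ≡ true
    c∈G* = G*⁺ hc c≢0
    h : Carrier → ℤ
    h z = δ (κ z) 1# ℤ.* e (c * x+x⁻¹ z)
    κc≢0 = Cubic-≢0 (Cubic-κ c∈G*)
    term : ∀ v → G* v ≡ true → δ (κ v) (κ (c * c)) ℤ.* (e (v ⁻¹) ℤ.* e (c * c * v)) ≡ h (c * v)
    term v hv = cong₂ ℤ._*_
      (δ-cong (λ eq → trans (κ-* c v) (trans (cong (κ c *_) (trans eq (κ-* c c))) (Cubic-κ c∈G*)))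
              (λ eq → *-cancelˡ κc≢0 (begin
                κ c * κ v         ≡⟨ κ-* c v ⟨
                κ (c * v)         ≡⟨ eq ⟩
                1#                ≡⟨ Cubic-κ c∈G* ⟨
                κ c * (κ c * κ c) ≡⟨ cong (κ c *_) (κ-* c c) ⟨
                κ c * κ (c * c)   ∎)))
      (trans (sym (e-+ (Sub-⁻¹ m₁ v∈G) (Sub-* m₁ (Sub-* m₁ hc hc) v∈G))) (cong e (begin
        v ⁻¹ + c * c * v                  ≡⟨ cong (_+ c * c * v) (trans (sym (*-identityˡ _)) (cong (_* v ⁻¹) (sym (inverseʳ c c≢0)))) ⟩
        c * c ⁻¹ * v ⁻¹ + c * c * v
          ≡⟨ solve 4 (λ c i v w → c :* i :* w :+ c :* c :* v := c :* (c :* v :+ i :* w)) refl c (c ⁻¹) v (v ⁻¹) ⟩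
        c * (c * v + c ⁻¹ * v ⁻¹)         ≡⟨ cong (λ z → c * (c * v + z)) (⁻¹-distrib-* c≢0 (proj₂ (G*⁻ hv))) ⟨
        c * (c * v + (c * v) ⁻¹)          ∎)))
      where v∈G = proj₁ (G*⁻ hv)

  -- Since α · αω₃ · αω₃² = α³ω₃³ = 1, `B-symmetric` identifies the two classes other than α, and
  -- each gets half of what α leaves of the total. Doubling both sides avoids the halving.
  3B-≢α : ∀ {a γ} → G* a ≡ true → Cubic γ → γ ≢ κ a → ℤ.+ 3 ℤ.* B a γ ≡ K m₁ a ℤ.- C m₁ a a ℤ.- 1ℤ
  3B-≢α {a} {γ} ha hγ γ≢α = ℤ.*-cancelˡ-≡ (ℤ.+ 2) _ _ (begin
    ℤ.+ 2 ℤ.* (ℤ.+ 3 ℤ.* B a γ)                     ≡⟨ cong (λ z → ℤ.+ 2 ℤ.* (ℤ.+ 3 ℤ.* z)) Bγ≡B₁ ⟩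
    ℤ.+ 2 ℤ.* (ℤ.+ 3 ℤ.* B₁)                        ≡⟨ expand B₀ B₁ ⟩
    ℤ.+ 3 ℤ.* (B₀ ℤ.+ B₁ ℤ.+ B₁) ℤ.- ℤ.+ 3 ℤ.* B₀   ≡⟨ cong (λ z → ℤ.+ 3 ℤ.* (B₀ ℤ.+ B₁ ℤ.+ z) ℤ.- ℤ.+ 3 ℤ.* B₀) B₁≡B₂ ⟩
    ℤ.+ 3 ℤ.* (B₀ ℤ.+ B₁ ℤ.+ B₂) ℤ.- ℤ.+ 3 ℤ.* B₀   ≡⟨ cong₂ (λ s t → ℤ.+ 3 ℤ.* s ℤ.- t) (B-cosets hα ha) (3B-α ha) ⟩
    ℤ.+ 3 ℤ.* (K m₁ a ℤ.- 1ℤ) ℤ.- (ℤ.+ 2 ℤ.* C m₁ a a ℤ.+ K m₁ a ℤ.- 1ℤ) ≡⟨ collect (K m₁ a) (C m₁ a a) ⟩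
    ℤ.+ 2 ℤ.* (K m₁ a ℤ.- C m₁ a a ℤ.- 1ℤ)          ∎)
    where
    α = κ a
    hα = Cubic-κ ha
    B₀ B₁ B₂ : ℤ
    B₀ = B a α
    B₁ = B a (α * ω₃)
    B₂ = B a (α * (ω₃ * ω₃))
    B₁≡B₂ : B₁ ≡ B₂
    B₁≡B₂ = B-symmetric ha (Cubic-* hα Cubic-ω₃) (begin
      α * (α * ω₃) * (α * (ω₃ * ω₃)) ≡⟨ solve 2 (λ a w → a :* (a :* w) :* (a :* (w :* w)) := (a :* (a :* a)) :* (w :* (w :* w))) refl α ω₃ ⟩
      α * (α * α) * (ω₃ * (ω₃ * ω₃)) ≡⟨ cong₂ _*_ hα Cubic-ω₃ ⟩
      1# * 1#                        ≡⟨ *-identityˡ 1# ⟩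
      1#                             ∎)
    Bγ≡B₁ : B a γ ≡ B₁
    Bγ≡B₁ with Cubic-cosets hγ hα
    ... | inj₁ γ≡α         = contradiction γ≡α γ≢α
    ... | inj₂ (inj₁ γ≡αω) = cong (B a) γ≡αω
    ... | inj₂ (inj₂ γ≡αω²) = trans (cong (B a) γ≡αω²) (sym B₁≡B₂)
    expand : ∀ a b → ℤ.+ 2 ℤ.* (ℤ.+ 3 ℤ.* b) ≡ ℤ.+ 3 ℤ.* (a ℤ.+ b ℤ.+ b) ℤ.- ℤ.+ 3 ℤ.* a
    expand = solve-∀
    collect : ∀ K C → ℤ.+ 3 ℤ.* (K ℤ.- ℤ.+ 1) ℤ.- (ℤ.+ 2 ℤ.* C ℤ.+ K ℤ.- ℤ.+ 1) ≡ ℤ.+ 2 ℤ.* (K ℤ.- C ℤ.- ℤ.+ 1)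
    collect = solve-∀

  -- The characters and traces in the definition of `S₂`

  3k/3≡k : ∀ k → 3 ℕ.* k ℕ./ 3 ≡ k
  3k/3≡k k = trans (cong (ℕ._/ 3) (ℕ.*-comm 3 k)) (ℕ.m*n/n≡m k 3)

  Q∸1≡3r : Q ∸ 1 ≡ 3 ℕ.* r
  Q∸1≡3r = cong (_∸ 1) Q≡1+3r

  ψ-m₁ : ∀ x → ψ m₁ x ≡ κ x
  ψ-m₁ x = cong (pow x) (trans (cong (ℕ._/ 3) Q∸1≡3r) (3k/3≡k r))

  -- The exponent is (Q² - 1)/3 = r(Q + 1), and κ(x) is fixed by the Q-th power. For x ≠ 0 the value
  -- κ(x)² is the inverse of κ(x), so b ψ(u₂) = 1 amounts to b = κ(u₂).
  ψ-m₀ : ∀ {x} → Sub m₁ x → ψ (4 ℕ.* m) x ≡ κ x * κ x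
  ψ-m₀ {x} hx = begin
    pow x ((2 ^ (4 ℕ.* m) ∸ 1) ℕ./ 3)   ≡⟨ cong (λ k → pow x ((k ∸ 1) ℕ./ 3)) Q²≡1+3r[Q+1] ⟩
    pow x (3 ℕ.* r ℕ.* (Q ℕ.+ 1) ℕ./ 3) ≡⟨ cong (λ k → pow x (k ℕ./ 3)) (ℕ.*-assoc 3 r (Q ℕ.+ 1)) ⟩
    pow x (3 ℕ.* (r ℕ.* (Q ℕ.+ 1)) ℕ./ 3) ≡⟨ cong (pow x) (3k/3≡k (r ℕ.* (Q ℕ.+ 1))) ⟩
    pow x (r ℕ.* (Q ℕ.+ 1))             ≡⟨ pow-* x r (Q ℕ.+ 1) ⟩
    pow (κ x) (Q ℕ.+ 1)                 ≡⟨ pow-+ (κ x) Q 1 ⟩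
    pow (κ x) Q * pow (κ x) 1           ≡⟨ cong₂ _*_ (Sub-pow m₁ r hx) (pow-1 (κ x)) ⟩
    κ x * κ x                           ∎

  trRel-m₁-2 : ∀ z → trRel m₁ 2 z ≡ z + pow z Q
  trRel-m₁-2 z = cong₂ _+_
    (trans (+-identityˡ _) (trans (cong (λ k → pow z (2 ^ k)) (ℕ.*-zeroʳ m₁)) (pow-1 z)))
    (cong (λ k → pow z (2 ^ k)) (ℕ.*-identityʳ m₁))

  -- Transitivity of the trace, with G as the intermediate field.
  trRel-m-4 : ∀ z → trRel m 4 z ≡ (z + pow z Q) + pow (z + pow z Q) q
  trRel-m-4 z = begin
    0# + pow z (2 ^ (m ℕ.* 0)) + pow z (2 ^ (m ℕ.* 1)) + pow z (2 ^ (m ℕ.* 2)) + pow z (2 ^ (m ℕ.* 3))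
      ≡⟨ cong₂ _+_ (cong₂ _+_ (cong₂ _+_ (trans (+-identityˡ _) (trans (cong (λ k → pow z (2 ^ k)) (ℕ.*-zeroʳ m)) (pow-1 z)))
           (cong (λ k → pow z (2 ^ k)) (ℕ.*-identityʳ m))) (cong (λ k → pow z (2 ^ k)) (ℕ.*-comm m 2))) z^Qq ⟩
    z + pow z q + pow z Q + pow (pow z Q) q
      ≡⟨ solve 4 (λ a b c d → a :+ b :+ c :+ d := (a :+ c) :+ (b :+ d)) refl z (pow z q) (pow z Q) (pow (pow z Q) q) ⟩
    (z + pow z Q) + (pow z q + pow (pow z Q) q) ≡⟨ cong ((z + pow z Q) +_) (frobenius m z (pow z Q)) ⟨
    (z + pow z Q) + pow (z + pow z Q) q ∎
    where
    3m : ∀ m → m ℕ.* 3 ≡ 2 ℕ.* m ℕ.+ m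
    3m = ℕ-Solver.solve-∀
    z^Qq : pow z (2 ^ (m ℕ.* 3)) ≡ pow (pow z Q) q
    z^Qq = trans (cong (pow z) (trans (cong (2 ^_) (3m m)) (ℕ.^-distribˡ-+-* 2 m₁ m))) (pow-* z Q q)

  pow-3j+2 : ∀ {z} → Cubic z → pow z q ≡ z * z
  pow-3j+2 {z} hz = begin
    pow z q                        ≡⟨ cong (pow z) 2^m≡3j+2 ⟩
    pow z (3 ℕ.* j ℕ.+ 2)          ≡⟨ pow-+ z (3 ℕ.* j) 2 ⟩
    pow z (3 ℕ.* j) * pow z 2      ≡⟨ cong₂ _*_ (begin
      pow z (3 ℕ.* j)                ≡⟨ pow-* z 3 j ⟩
      pow (pow z 3) j                ≡⟨ cong (λ w → pow w j) (trans (sym (cube≡pow3 z)) hz) ⟩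
      pow 1# j                       ≡⟨ pow-1# j ⟩
      1#                             ∎) (cong (z *_) (*-identityʳ z)) ⟩
    1# * (z * z)                   ≡⟨ *-identityˡ _ ⟩
    z * z                          ∎

  norm-one : ∀ {x} → pow x (q ℕ.+ 1) ≡ 1# → x * pow x q ≡ 1#
  norm-one {x} h = trans (cong (pow x) (ℕ.+-comm 1 q)) h

  -- On `U₁` the power u^(Q-1) is u⁻², and its conjugate over G is u². The relative trace of a u⁻²
  -- is therefore a(u + u⁻¹)².
  tr-m₀ : ∀ {a u} → Sub m₁ a → U₁ u ≡ true → tr (4 ℕ.* m) (a * pow u (Q ∸ 1)) ≡ tr m₁ (a * (x+x⁻¹ u * x+x⁻¹ u))
  tr-m₀ {a} {u} ha hu = begin
    tr (4 ℕ.* m) (a * pow u (Q ∸ 1))  ≡⟨ cong₂ (λ k z → tr k (a * z)) 4m≡2[2m] u^[Q-1] ⟩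
    tr (2 ℕ.* m₁) (a * (i * i))       ≡⟨ tr-double m₁ _ ⟩
    tr m₁ (a * (i * i) + pow (a * (i * i)) Q) ≡⟨ cong (λ z → tr m₁ (a * (i * i) + z)) (begin
      pow (a * (i * i)) Q               ≡⟨ pow-distrib-* a (i * i) Q ⟩
      pow a Q * pow (i * i) Q           ≡⟨ cong₂ _*_ ha (pow-distrib-* i i Q) ⟩
      a * (pow i Q * pow i Q)           ≡⟨ cong (λ z → a * (z * z)) i^Q ⟩
      a * (u * u)                       ∎) ⟩
    tr m₁ (a * (i * i) + a * (u * u))
      ≡⟨ cong (tr m₁) (solve 3 (λ a u i → a :* (i :* i) :+ a :* (u :* u) := a :* ((u :+ i) :* (u :+ i))) refl a u i) ⟩
    tr m₁ (a * (x+x⁻¹ u * x+x⁻¹ u))   ∎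
    where
    i = u ⁻¹
    u≢0 = U₁-≢0 hu
    i^Q : pow i Q ≡ u
    i^Q = trans (pow-⁻¹ Q u≢0) (trans (cong _⁻¹ (U₁-conj hu)) (⁻¹-involutive u≢0))
    u^[Q-1] : pow u (Q ∸ 1) ≡ i * i
    u^[Q-1] = *-cancelˡ u≢0 (begin
      u * pow u (Q ∸ 1)   ≡⟨ cong (λ k → u * pow u k) Q∸1≡3r ⟩
      u * pow u (3 ℕ.* r) ≡⟨ cong (pow u) Q≡1+3r ⟨
      pow u Q             ≡⟨ U₁-conj hu ⟩
      i                   ≡⟨ *-identityˡ i ⟨
      1# * i              ≡⟨ cong (_* i) (inverseʳ u u≢0) ⟨
      u * i * i           ≡⟨ *-assoc u i i ⟩
      u * (i * i)         ∎)

  -- Reduction of `S₂` to sums over a class of κ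

  module Reduction {a b ω w y : Carrier}
    (a∈G* : G* a ≡ true) (hb : Cubic b)
    (ω∈G : Sub m₁ ω) (ω≢0 : ω ≢ 0#) (w∈G : Sub m₁ w) (w^[q+1] : pow w (q ℕ.+ 1) ≡ 1#)
    (y∈Fq : Sub m y) (y≢0 : y ≢ 0#) (ω≡wy : ω ≡ w * y) where

    γ : Carrier
    γ = b * κ w

    w≢0 : w ≢ 0#
    w≢0 = xy≡1⇒x≢0 (norm-one w^[q+1])

    Cubic-γ : Cubic γ
    Cubic-γ = Cubic-* hb (Cubic-κ (G*⁺ w∈G w≢0))

    P₂ : Carrier → Bool
    P₂ u₂ = inSub m₁ u₂ ∧ inRootsOfUnity m u₂

    summand : Carrier → Carrier → ℤ
    summand u u₂ =
      if not (isZero (trRel m₁ 2 (u * u₂ * ω))) ∧ isZero (trRel m 4 (u * u₂ * ω)) ∧ eqB (b * ψ (4 ℕ.* m) u₂) 1#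
      then χ (tr (4 ℕ.* m) (a * pow u (Q ∸ 1))) else 0ℤ

    relTrace : ∀ {u u₂} → U₁ u ≡ true → Sub m₁ u₂ → (u * u₂ * ω) + pow (u * u₂ * ω) Q ≡ u₂ * ω * x+x⁻¹ u
    relTrace {u} {u₂} hu hu₂ = begin
      u * u₂ * ω + pow (u * u₂ * ω) Q        ≡⟨ cong (u * u₂ * ω +_) (begin
        pow (u * u₂ * ω) Q                     ≡⟨ pow-distrib-* (u * u₂) ω Q ⟩
        pow (u * u₂) Q * pow ω Q               ≡⟨ cong₂ _*_ (trans (pow-distrib-* u u₂ Q) (cong₂ _*_ (U₁-conj hu) hu₂)) ω∈G ⟩
        u ⁻¹ * u₂ * ω                          ∎) ⟩
      u * u₂ * ω + u ⁻¹ * u₂ * ω             ≡⟨ solve 4 (λ u i v w → u :* v :* w :+ i :* v :* w := v :* w :* (u :+ i)) refl u (u ⁻¹) u₂ ω ⟩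
      u₂ * ω * x+x⁻¹ u                       ∎

    module _ {u : Carrier} (hu : U₁∖1 u ≡ true) where

      private
        u∈U₁ = proj₁ (∖⁻ U₁ hu)

      t : Carrier
      t = x+x⁻¹ u

      t∈G* : G* t ≡ true
      t∈G* = U₁-s∈G* hu

      t∈G : Sub m₁ t
      t∈G = proj₁ (G*⁻ t∈G*)

      t≢0 : t ≢ 0#
      t≢0 = proj₂ (G*⁻ t∈G*)

      -- Written as a quotient, which avoids subtraction in the exponent.
      t^[q-1] : Carrier
      t^[q-1] = pow t q * t ⁻¹

      root : ∃[ s ] Sub m₁ s × s * s ≡ t^[q-1]
      root = sqrt (Sub-* m₁ (Sub-pow m₁ q t∈G) (Sub-⁻¹ m₁ t∈G))

      s : Carrier
      s = proj₁ root

      s²t≡t^q : s * s * t ≡ pow t q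
      s²t≡t^q = begin
        s * s * t              ≡⟨ cong (_* t) (proj₂ (proj₂ root)) ⟩
        pow t q * t ⁻¹ * t     ≡⟨ *-assoc _ _ _ ⟩
        pow t q * (t ⁻¹ * t)   ≡⟨ cong (pow t q *_) (inverseˡ t≢0) ⟩
        pow t q * 1#           ≡⟨ *-identityʳ _ ⟩
        pow t q                ∎

      -- The only u₂ with vanishing trace to 𝔽_q for the given u: the condition forces (u₂w)² = s²,
      -- and square roots are unique.
      u₂* : Carrier
      u₂* = s * w ⁻¹

      -- The square of the left side is (t^(q-1))^(q+1) = t^(Q-1) = 1, and 1 is the only square root
      -- of 1.
      s^[q+1] : pow s (q ℕ.+ 1) ≡ 1#
      s^[q+1] = x²≡y²⇒x≡y (begin
        pow s (q ℕ.+ 1) * pow s (q ℕ.+ 1)        ≡⟨ pow-distrib-* s s (q ℕ.+ 1) ⟨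
        pow (s * s) (q ℕ.+ 1)                    ≡⟨ cong (λ z → pow z (q ℕ.+ 1)) (proj₂ (proj₂ root)) ⟩
        pow t^[q-1] (q ℕ.+ 1)                    ≡⟨ pow-+ t^[q-1] q 1 ⟩
        pow t^[q-1] q * pow t^[q-1] 1            ≡⟨ cong₂ _*_ (begin
          pow (pow t q * t ⁻¹) q                   ≡⟨ pow-distrib-* (pow t q) (t ⁻¹) q ⟩
          pow (pow t q) q * pow (t ⁻¹) q           ≡⟨ cong₂ _*_ (trans (sym (pow-2^[2k] m t)) t∈G) (pow-⁻¹ q t≢0) ⟩
          t * pow t q ⁻¹                           ∎) (pow-1 t^[q-1]) ⟩
        t * pow t q ⁻¹ * (pow t q * t ⁻¹)        ≡⟨ solve 4 (λ t i x j → t :* j :* (x :* i) := t :* i :* (x :* j)) refl t (t ⁻¹) (pow t q) (pow t q ⁻¹) ⟩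
        t * t ⁻¹ * (pow t q * pow t q ⁻¹)        ≡⟨ cong₂ _*_ (inverseʳ t t≢0) (inverseʳ (pow t q) (pow-≢0 q t≢0)) ⟩
        1# * 1#                                  ∎)

      u₂*∈P₂ : P₂ u₂* ≡ true
      u₂*∈P₂ = ∧-true⁺ (eqB-true⁺ (Sub-* m₁ (proj₁ (proj₂ root)) (Sub-⁻¹ m₁ w∈G))) (eqB-true⁺ (begin
        pow (s * w ⁻¹) (q ℕ.+ 1)                 ≡⟨ pow-distrib-* s (w ⁻¹) (q ℕ.+ 1) ⟩
        pow s (q ℕ.+ 1) * pow (w ⁻¹) (q ℕ.+ 1)
          ≡⟨ cong₂ _*_ s^[q+1] (trans (pow-⁻¹ (q ℕ.+ 1) w≢0) (trans (cong _⁻¹ w^[q+1]) 1⁻¹≡1)) ⟩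
        1# * 1#                                  ≡⟨ *-identityˡ 1# ⟩
        1#                                       ∎))

      module _ {u₂ : Carrier} (hu₂ : P₂ u₂ ≡ true) where

        private
          u₂∈G : Sub m₁ u₂
          u₂∈G = eqB-true⁻ (proj₁ (∧-true⁻ hu₂))
          u₂≢0 : u₂ ≢ 0#
          u₂≢0 = xy≡1⇒x≢0 (norm-one (eqB-true⁻ (proj₂ (∧-true⁻ hu₂))))
          p T : Carrier
          p = u₂ * w
          T = u₂ * ω * t
          p-norm : p * pow p q ≡ 1#
          p-norm = norm-one (trans (pow-distrib-* u₂ w (q ℕ.+ 1))
            (trans (cong₂ _*_ (eqB-true⁻ (proj₂ (∧-true⁻ hu₂))) w^[q+1]) (*-identityˡ 1#)))
          T≡p[yt] : T ≡ p * (y * t)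
          T≡p[yt] = trans (cong (λ z → u₂ * z * t) ω≡wy)
            (solve 4 (λ u w y t → u :* (w :* y) :* t := u :* w :* (y :* t)) refl u₂ w y t)
          T^q : pow T q ≡ pow p q * (y * pow t q)
          T^q = trans (cong (λ z → pow z q) T≡p[yt]) (trans (pow-distrib-* p (y * t) q)
            (cong (pow p q *_) (trans (pow-distrib-* y t q) (cong (_* pow t q) y∈Fq))))

        -- T = pyt is the trace to G, with y in 𝔽_q and p^q = p⁻¹. Multiplying T = T^q by p gives
        -- p²yt = yt^q = ys²t, hence p = s.
        trace-zero⇒u₂≡u₂* : T + pow T q ≡ 0# → u₂ ≡ u₂*
        trace-zero⇒u₂≡u₂* h = begin
          u₂               ≡⟨ *-identityʳ u₂ ⟨
          u₂ * 1#          ≡⟨ cong (u₂ *_) (inverseʳ w w≢0) ⟨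
          u₂ * (w * w ⁻¹)  ≡⟨ *-assoc _ _ _ ⟨
          p * w ⁻¹         ≡⟨ cong (_* w ⁻¹) p≡s ⟩
          s * w ⁻¹         ∎
          where
          y[t[pp]]≡y[t[ss]] : y * (t * (p * p)) ≡ y * (t * (s * s))
          y[t[pp]]≡y[t[ss]] = begin
            y * (t * (p * p))              ≡⟨ solve 3 (λ y t p → y :* (t :* (p :* p)) := p :* (p :* (y :* t))) refl y t p ⟩
            p * (p * (y * t))              ≡⟨ cong (p *_) T≡p[yt] ⟨
            p * T                          ≡⟨ cong (p *_) (x+y≡0⇒x≡y h) ⟩
            p * pow T q                    ≡⟨ cong (p *_) T^q ⟩
            p * (pow p q * (y * pow t q))  ≡⟨ *-assoc _ _ _ ⟨
            p * pow p q * (y * pow t q)    ≡⟨ cong (_* (y * pow t q)) p-norm ⟩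
            1# * (y * pow t q)             ≡⟨ *-identityˡ _ ⟩
            y * pow t q                    ≡⟨ cong (y *_) (trans (*-comm t (s * s)) s²t≡t^q) ⟨
            y * (t * (s * s))              ∎
          p≡s : p ≡ s
          p≡s = x²≡y²⇒x≡y (*-cancelˡ t≢0 (*-cancelˡ y≢0 y[t[pp]]≡y[t[ss]]))

        p≡s : u₂ ≡ u₂* → p ≡ s
        p≡s refl = trans (*-assoc s (w ⁻¹) w) (trans (cong (s *_) (inverseˡ w≢0)) (*-identityʳ s))

        u₂≡u₂*⇒trace-zero : u₂ ≡ u₂* → T + pow T q ≡ 0#
        u₂≡u₂*⇒trace-zero h = x≡y⇒x+y≡0 (begin
          T                               ≡⟨ T≡p[yt] ⟩
          p * (y * t)                     ≡⟨ *-identityˡ _ ⟨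
          1# * (p * (y * t))              ≡⟨ cong (_* (p * (y * t))) p-norm ⟨
          p * pow p q * (p * (y * t))     ≡⟨ solve 4 (λ p x y t → p :* x :* (p :* (y :* t)) := x :* (y :* (p :* p :* t))) refl p (pow p q) y t ⟩
          pow p q * (y * (p * p * t))     ≡⟨ cong (λ z → pow p q * (y * (z * z * t))) (p≡s h) ⟩
          pow p q * (y * (s * s * t))     ≡⟨ cong (λ z → pow p q * (y * z)) s²t≡t^q ⟩
          pow p q * (y * pow t q)         ≡⟨ T^q ⟨
          pow T q                         ∎)

        private
          k = κ t
          hk : Cubic k
          hk = Cubic-κ t∈G*
          hκu₂ : Cubic (κ u₂)
          hκu₂ = Cubic-κ (G*⁺ u₂∈G u₂≢0)

        -- Applying κ to p²t = t^q gives κ(p)²κ(t) = κ(t)^q = κ(t)², the last step because q = 3j +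
        -- 2. So κ(p)² = κ(t), and squaring once more yields κ(p) = κ(p)⁴ = κ(t²).
        κp≡κt² : u₂ ≡ u₂* → κ u₂ * κ w ≡ κ (t * t)
        κp≡κt² h = begin
          κ u₂ * κ w                  ≡⟨ κ-* u₂ w ⟨
          κ p                         ≡⟨ *-identityʳ (κ p) ⟨
          κ p * 1#                    ≡⟨ cong (κ p *_) hκp ⟨
          κ p * (κ p * (κ p * κ p))   ≡⟨ *-assoc _ _ _ ⟨
          κ p * κ p * (κ p * κ p)     ≡⟨ cong₂ _*_ κp²≡k κp²≡k ⟩
          k * k                       ≡⟨ κ-* t t ⟨
          κ (t * t)                   ∎
          where
          hκp : Cubic (κ p)
          hκp = subst Cubic (sym (κ-* u₂ w)) (Cubic-* hκu₂ (Cubic-κ (G*⁺ w∈G w≢0)))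
          κp²≡k : κ p * κ p ≡ k
          κp²≡k = *-cancelˡ (Cubic-≢0 hk) (begin
            k * (κ p * κ p)      ≡⟨ *-comm _ _ ⟩
            κ p * κ p * k        ≡⟨ cong (_* k) (κ-* p p) ⟨
            κ (p * p) * k        ≡⟨ κ-* (p * p) t ⟨
            κ (p * p * t)        ≡⟨ cong (λ z → κ (z * z * t)) (p≡s h) ⟩
            κ (s * s * t)        ≡⟨ cong κ s²t≡t^q ⟩
            κ (pow t q)          ≡⟨ pow-comm t q r ⟩
            pow k q              ≡⟨ pow-3j+2 hk ⟩
            k * k                ∎)

        -- By `ψ-m₀` the condition on the left says b = κ(u₂); multiplied by κ(w) it becomes γ =
        -- κ(u₂w) = κ(t²).
        class-condition : u₂ ≡ u₂* → eqB (b * ψ (4 ℕ.* m) u₂) 1# ≡ eqB (κ (t * t)) γ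
        class-condition h = eqB-cong to from
          where
          κu₂≢0 = Cubic-≢0 hκu₂
          to : b * ψ (4 ℕ.* m) u₂ ≡ 1# → κ (t * t) ≡ b * κ w
          to eq = trans (sym (κp≡κt² h)) (cong (_* κ w) (sym (begin
            b                             ≡⟨ Cubic-divide hκu₂ (trans (cong (b *_) (sym (ψ-m₀ u₂∈G))) eq) ⟩
            κ u₂ * 1#                     ≡⟨ *-identityʳ _ ⟩
            κ u₂                          ∎)))
          from : κ (t * t) ≡ b * κ w → b * ψ (4 ℕ.* m) u₂ ≡ 1#
          from eq = trans (cong₂ _*_ b≡κu₂ (ψ-m₀ u₂∈G)) hκu₂
            where
            b≡κu₂ : b ≡ κ u₂
            b≡κu₂ = *-cancelˡ (Cubic-≢0 (Cubic-κ (G*⁺ w∈G w≢0))) (begin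
              κ w * b     ≡⟨ *-comm _ _ ⟩
              b * κ w     ≡⟨ trans (κp≡κt² h) eq ⟨
              κ u₂ * κ w  ≡⟨ *-comm _ _ ⟩
              κ w * κ u₂  ∎)

        -- The trace to G is u₂ωt, and t vanishes only for u = 1: the first trace condition excludes
        -- precisely that element.
        trRel-m₁-2-≢0 : not (isZero (trRel m₁ 2 (u * u₂ * ω))) ≡ true
        trRel-m₁-2-≢0 = not-eqB⁺ (subst (_≢ 0#) (sym (trans (trRel-m₁-2 _) (relTrace u∈U₁ u₂∈G))) (*-≢0 (*-≢0 u₂≢0 ω≢0) t≢0))

        trRel-m-4-zero : isZero (trRel m 4 (u * u₂ * ω)) ≡ eqB u₂ u₂*
        trRel-m-4-zero = eqB-cong
          (λ h → trace-zero⇒u₂≡u₂* (trans (sym trRel≡) h))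
          (λ h → trans trRel≡ (u₂≡u₂*⇒trace-zero h))
          where
          trRel≡ : trRel m 4 (u * u₂ * ω) ≡ T + pow T q
          trRel≡ = trans (trRel-m-4 _) (cong (λ z → z + pow z q) (relTrace u∈U₁ u₂∈G))

      value : ℤ
      value = δ (κ (t * t)) γ ℤ.* e (a * (t * t))

      summand≡ : ∀ u₂ → P₂ u₂ ≡ true → summand u u₂ ≡ δ u₂ u₂* ℤ.* value
      summand≡ u₂ hu₂ = trans
        (if-∧∧ _ (trRel-m₁-2-≢0 hu₂) (trRel-m-4-zero hu₂) (class-condition hu₂ ∘ eqB-true⁻))
        (cong (λ z → δ u₂ u₂* ℤ.* (δ (κ (t * t)) γ ℤ.* χ z)) (tr-m₀ (proj₁ (G*⁻ a∈G*)) u∈U₁))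

      inner-sum : sumWhere P₂ (summand u) ≡ value
      inner-sum = trans (∑-cong summand≡) (∑-δ (λ _ → value) u₂*∈P₂)

    inner-sum-1 : sumWhere P₂ (summand 1#) ≡ 0ℤ
    inner-sum-1 = sumList-0 elements (λ u₂ hu₂ → cong (λ c → if c ∧ isZero (trRel m 4 (1# * u₂ * ω)) ∧ eqB (b * ψ (4 ℕ.* m) u₂) 1#
        then χ (tr (4 ℕ.* m) (a * pow 1# (Q ∸ 1))) else 0ℤ) (cong not (eqB-true⁺ (begin
      trRel m₁ 2 (1# * u₂ * ω)                      ≡⟨ trRel-m₁-2 _ ⟩
      1# * u₂ * ω + pow (1# * u₂ * ω) Q             ≡⟨ relTrace 1∈U₁ (eqB-true⁻ (proj₁ (∧-true⁻ hu₂))) ⟩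
      u₂ * ω * x+x⁻¹ 1#                             ≡⟨ cong (λ z → u₂ * ω * (1# + z)) 1⁻¹≡1 ⟩
      u₂ * ω * (1# + 1#)                            ≡⟨ cong (u₂ * ω *_) (x+x≡0 1#) ⟩
      u₂ * ω * 0#                                   ≡⟨ zeroʳ _ ⟩
      0#                                            ∎))))

    S₂≡A-B : S₂ m a b ω ≡ ∑ᶜ γ (λ v → e (a * v)) ℤ.- B a γ
    S₂≡A-B = begin
      sumWhere U₁ (λ u → sumWhere P₂ (summand u))                    ≡⟨ ∑-split {U₁} {1#} _ 1∈U₁ ⟩
      sumWhere P₂ (summand 1#) ℤ.+ sumWhere U₁∖1 (λ u → sumWhere P₂ (summand u))
        ≡⟨ cong₂ ℤ._+_ inner-sum-1 (∑-cong (λ u hu → inner-sum hu)) ⟩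
      0ℤ ℤ.+ sumWhere U₁∖1 (h ∘ x+x⁻¹)                               ≡⟨ ℤ.+-identityˡ _ ⟩
      sumWhere U₁∖1 (h ∘ x+x⁻¹)                                      ≡⟨ Inert.∑-x+x⁻¹ h ⟩
      sumWhere G* h ℤ.+ -1ℤ ℤ.* sumWhere G* (λ s → e (s ⁻¹) ℤ.* h s)
        ≡⟨ cong₂ (λ s t → s ℤ.+ t) (∑G*-square (λ v → δ (κ v) γ ℤ.* e (a * v)))
             (trans (ℤ.-1*i≡-i _) (cong ℤ.-_ kloosterman-part)) ⟩
      ∑ᶜ γ (λ v → e (a * v)) ℤ.- B a γ                               ∎
      where
      h : Carrier → ℤ
      h s = δ (κ (s * s)) γ ℤ.* e (a * (s * s))
      -- Rewriting e(s⁻¹) as e(s⁻²) makes the whole summand a function of v = s², so squaring can be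
      -- undone as a change of variable.
      kloosterman-part : sumWhere G* (λ s → e (s ⁻¹) ℤ.* h s) ≡ B a γ
      kloosterman-part = begin
        sumWhere G* (λ s → e (s ⁻¹) ℤ.* h s)
          ≡⟨ ∑-cong (λ s hs → trans
               (cong (ℤ._* h s) (trans (sym (e-square (Sub-⁻¹ m₁ (proj₁ (G*⁻ hs))))) (cong e (sym (square-⁻¹ s)))))
               (swap (e ((s * s) ⁻¹)) (δ (κ (s * s)) γ) (e (a * (s * s))))) ⟩
        sumWhere G* (λ s → δ (κ (s * s)) γ ℤ.* (e ((s * s) ⁻¹) ℤ.* e (a * (s * s))))
          ≡⟨ ∑G*-square (λ v → δ (κ v) γ ℤ.* (e (v ⁻¹) ℤ.* e (a * v))) ⟩
        B a γ ∎
        where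
        swap : ∀ x y z → x ℤ.* (y ℤ.* z) ≡ y ℤ.* (x ℤ.* z)
        swap = solve-∀

    3S₂ : ℤ.+ 3 ℤ.* S₂ m a b ω ≡ (ℤ.+ 3 ℤ.* ℤ.+ q ℤ.* δ (γ * κ a) 1# ℤ.- ℤ.+ q ℤ.- 1ℤ) ℤ.- ℤ.+ 3 ℤ.* B a γ
    3S₂ = begin
      ℤ.+ 3 ℤ.* S₂ m a b ω                                     ≡⟨ cong (ℤ.+ 3 ℤ.*_) S₂≡A-B ⟩
      ℤ.+ 3 ℤ.* (A ℤ.- B a γ)                                  ≡⟨ distribute A (B a γ) ⟩
      ℤ.+ 3 ℤ.* A ℤ.- ℤ.+ 3 ℤ.* B a γ                          ≡⟨ cong (ℤ._- ℤ.+ 3 ℤ.* B a γ) (3∑ᶜ-linear a∈G* Cubic-γ) ⟩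
      (ℤ.+ 3 ℤ.* ℤ.+ q ℤ.* δ (γ * κ a) 1# ℤ.- ℤ.+ q ℤ.- 1ℤ) ℤ.- ℤ.+ 3 ℤ.* B a γ ∎
      where
      A = ∑ᶜ γ (λ v → e (a * v))
      distribute : ∀ x y → ℤ.+ 3 ℤ.* (x ℤ.- y) ≡ ℤ.+ 3 ℤ.* x ℤ.- ℤ.+ 3 ℤ.* y
      distribute = solve-∀

    P1 P2 : ℤ
    P1 = ℤ.+ (2 ^ (m ℕ.+ 1))
    P2 = ℤ.+ (2 ^ m)

    P1≡2q : P1 ≡ ℤ.+ q ℤ.* ℤ.+ 2
    P1≡2q = trans (cong ℤ.+_ (ℕ.^-distribˡ-+-* 2 m 1)) (ℤ.pos-* q 2)

    linear≡ : γ ≡ κ a ⁻¹ → ℤ.+ 3 ℤ.* ℤ.+ q ℤ.* δ (γ * κ a) 1# ℤ.- ℤ.+ q ℤ.- 1ℤ ≡ P1 ℤ.- 1ℤ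
    linear≡ h = trans (cong (λ d → ℤ.+ 3 ℤ.* ℤ.+ q ℤ.* d ℤ.- ℤ.+ q ℤ.- 1ℤ)
        (δ-≡ (trans (cong (_* κ a) h) (inverseˡ (Cubic-≢0 (Cubic-κ a∈G*))))))
      (trans (simplify (ℤ.+ q)) (cong (ℤ._- 1ℤ) (sym P1≡2q)))
      where
      simplify : ∀ x → ℤ.+ 3 ℤ.* x ℤ.* ℤ.+ 1 ℤ.- x ℤ.- ℤ.+ 1 ≡ x ℤ.* ℤ.+ 2 ℤ.- ℤ.+ 1
      simplify = solve-∀

    linear≢ : γ ≢ κ a ⁻¹ → ℤ.+ 3 ℤ.* ℤ.+ q ℤ.* δ (γ * κ a) 1# ℤ.- ℤ.+ q ℤ.- 1ℤ ≡ ℤ.- P2 ℤ.- 1ℤ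
    linear≢ h = trans (cong (λ d → ℤ.+ 3 ℤ.* ℤ.+ q ℤ.* d ℤ.- ℤ.+ q ℤ.- 1ℤ)
        (δ-≢ (λ γα≡1 → h (⁻¹-unique (trans (*-comm (κ a) γ) γα≡1)))))
      (simplify (ℤ.+ q))
      where
      simplify : ∀ x → ℤ.+ 3 ℤ.* x ℤ.* ℤ.+ 0 ℤ.- x ℤ.- ℤ.+ 1 ≡ ℤ.- x ℤ.- ℤ.+ 1
      simplify = solve-∀

    private
      C₁ K₁ : ℤ
      C₁ = C m₁ a a
      K₁ = K m₁ a

    combine-≡α : ∀ P → γ ≡ κ a → ℤ.+ 3 ℤ.* ℤ.+ q ℤ.* δ (γ * κ a) 1# ℤ.- ℤ.+ q ℤ.- 1ℤ ≡ P ℤ.- 1ℤ →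
      ℤ.+ 3 ℤ.* S₂ m a b ω ≡ P ℤ.- ℤ.+ 2 ℤ.* C₁ ℤ.- K₁
    combine-≡α P h linear = trans 3S₂ (trans (cong₂ ℤ._-_ linear (trans (cong (λ g → ℤ.+ 3 ℤ.* B a g) h) (3B-α a∈G*)))
      (simplify P C₁ K₁))
      where
      simplify : ∀ P C K → P ℤ.- ℤ.+ 1 ℤ.- (ℤ.+ 2 ℤ.* C ℤ.+ K ℤ.- ℤ.+ 1) ≡ P ℤ.- ℤ.+ 2 ℤ.* C ℤ.- K
      simplify = solve-∀

    combine-≢α : ∀ P → γ ≢ κ a → ℤ.+ 3 ℤ.* ℤ.+ q ℤ.* δ (γ * κ a) 1# ℤ.- ℤ.+ q ℤ.- 1ℤ ≡ P ℤ.- 1ℤ →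
      ℤ.+ 3 ℤ.* S₂ m a b ω ≡ P ℤ.+ C₁ ℤ.- K₁
    combine-≢α P h linear = trans 3S₂ (trans (cong₂ ℤ._-_ linear (3B-≢α a∈G* Cubic-γ h)) (simplify P C₁ K₁))
      where
      simplify : ∀ P C K → P ℤ.- ℤ.+ 1 ℤ.- (K ℤ.- C ℤ.- ℤ.+ 1) ≡ P ℤ.+ C ℤ.- K
      simplify = solve-∀

    -- Abstracted over γ and α so that the result, proved for κ, can be transported along `ψ-m₁` to
    -- the characters of the theorem.
    Cases : Carrier → Carrier → Set
    Cases γ α =
      (γ ≡ α → γ ≡ α ⁻¹ → ℤ.+ 3 ℤ.* S₂ m a b ω ≡ P1 ℤ.- ℤ.+ 2 ℤ.* C₁ ℤ.- K₁) ×
      (γ ≡ α → γ ≢ α ⁻¹ → ℤ.+ 3 ℤ.* S₂ m a b ω ≡ ℤ.- P2 ℤ.- ℤ.+ 2 ℤ.* C₁ ℤ.- K₁) ×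
      (γ ≢ α → γ ≡ α ⁻¹ → ℤ.+ 3 ℤ.* S₂ m a b ω ≡ P1 ℤ.+ C₁ ℤ.- K₁) ×
      (γ ≢ α → γ ≢ α ⁻¹ → ℤ.+ 3 ℤ.* S₂ m a b ω ≡ ℤ.- P2 ℤ.+ C₁ ℤ.- K₁)

    four-cases : Cases γ (κ a)
    four-cases =
        (λ h h′ → combine-≡α P1 h (linear≡ h′))
      , (λ h h′ → combine-≡α (ℤ.- P2) h (linear≢ h′))
      , (λ h h′ → combine-≢α P1 h (linear≡ h′))
      , (λ h h′ → combine-≢α (ℤ.- P2) h (linear≢ h′))

-- Odd powers of 2 modulo 3, and the theorem

2^[1+2k]≡3j+2 : ∀ k → ∃[ j ] 2 ^ (1 ℕ.+ k ℕ.* 2) ≡ 3 ℕ.* j ℕ.+ 2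
2^[1+2k]≡3j+2 zero    = 0 , refl
2^[1+2k]≡3j+2 (suc k) with 2^[1+2k]≡3j+2 k
... | j , h = 4 ℕ.* j ℕ.+ 2 , trans (cong (λ z → 2 ℕ.* (2 ℕ.* z)) h) (expand j)
  where
  expand : ∀ j → 2 ℕ.* (2 ℕ.* (3 ℕ.* j ℕ.+ 2)) ≡ 3 ℕ.* (4 ℕ.* j ℕ.+ 2) ℕ.+ 2
  expand = ℕ-Solver.solve-∀

odd⇒2^m≡3j+2 : ∀ m → m ℕ.% 2 ≡ 1 → ∃[ j ] 2 ^ m ≡ 3 ℕ.* j ℕ.+ 2
odd⇒2^m≡3j+2 m odd = subst (λ l → ∃[ j ] 2 ^ l ≡ 3 ℕ.* j ℕ.+ 2)
  (sym (trans (ℕ.m≡m%n+[m/n]*n m 2) (cong (ℕ._+ m ℕ./ 2 ℕ.* 2) odd))) (2^[1+2k]≡3j+2 (m ℕ./ 2))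

odd⇒NonZero : ∀ m → m ℕ.% 2 ≡ 1 → ℕ.NonZero m
odd⇒NonZero (suc m) _ = _

mainTheorem10 : (m₂ : ℕ) → m₂ % 2 ≡ 1 →
  (F : FiniteField2 (4 ℕ.* m₂)) →
  let open FiniteField2 F
      open FieldOps F
      m₁ = 2 ℕ.* m₂
      m₀ = 4 ℕ.* m₂
  in (a b ω w₂ y : Carrier) →
     pow a (2 ^ m₁) ≡ a → a ≢ 0# →
     pow b 4 ≡ b → b ≢ 0# →
     pow ω (2 ^ m₁) ≡ ω → ω ≢ 0# →
     pow w₂ (2 ^ m₁) ≡ w₂ → pow w₂ (2 ^ m₂ ℕ.+ 1) ≡ 1# →
     pow y (2 ^ m₂) ≡ y → y ≢ 0# →
     ω ≡ w₂ * y →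
     let γ = b * ψ m₁ w₂
         α = ψ m₁ a
         S = S₂ m₂ a b ω
         Cc = C m₁ a a
         Kk = K m₁ a
         P1 = ℤ.+ (2 ^ (m₂ ℕ.+ 1))
         P2 = ℤ.+ (2 ^ m₂)
     in (γ ≡ α → γ ≡ α ⁻¹ →
           ℤ.+ 3 ℤ.* S ≡ P1 ℤ.- ℤ.+ 2 ℤ.* Cc ℤ.- Kk)
      × (γ ≡ α → γ ≢ α ⁻¹ →
           ℤ.+ 3 ℤ.* S ≡ ℤ.- P2 ℤ.- ℤ.+ 2 ℤ.* Cc ℤ.- Kk)
      × (γ ≢ α → γ ≡ α ⁻¹ →
           ℤ.+ 3 ℤ.* S ≡ P1 ℤ.+ Cc ℤ.- Kk)
      × (γ ≢ α → γ ≢ α ⁻¹ →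
           ℤ.+ 3 ℤ.* S ≡ ℤ.- P2 ℤ.+ Cc ℤ.- Kk)
mainTheorem10 m odd F a b ω w y a∈G a≢0 b⁴≡b b≢0 ω∈G ω≢0 w∈G w^[q+1] y∈Fq y≢0 ω≡wy =
  subst₂ (λ κw α → Cases (b * κw) α) (sym (ψ-m₁ w)) (sym (ψ-m₁ a)) four-cases
  where
  instance
    m≢0 : ℕ.NonZero m
    m≢0 = odd⇒NonZero m odd
  open FiniteField2 F
  open FieldOps F
  open FiniteFieldTheory F
  j = proj₁ (odd⇒2^m≡3j+2 m odd)
  2^m≡3j+2 = proj₂ (odd⇒2^m≡3j+2 m odd)
  open Tower m j 2^m≡3j+2 F
  hb : Cubic b
  -- Cancelling one factor b from b⁴ = b leaves b³ = 1, the form in which membership of b in 𝔽₄^* is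
  -- used.
  hb = *-cancelˡ b≢0 (trans (cong (λ z → b * (b * (b * z))) (sym (*-identityʳ b))) (trans b⁴≡b (sym (*-identityʳ b))))
  open Reduction (G*⁺ a∈G a≢0) hb ω∈G ω≢0 w∈G w^[q+1] y∈Fq y≢0 ω≡wy
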